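{- Let $n\ge1$. The map $\phi=\Phi_{\mathrm{FV}}^{ -1}\circ\xi\circ\Phi_{\mathrm{FV}}:\mathfrak S_n\to\mathfrak S_n$ is a bijection such that for every $\pi\in\mathfrak S_n$, componentwise as equalities of (multi)sets, $$(\mathrm{Dtb},\mathrm{Dta},\mathrm{Abb},\mathrm{Aba},\mathbf 2\underline{13},\mathbf 2\underline{31},\underline{31}\mathbf 2)(\pi)=\kappa_{n+1}\circ(\mathrm{Aba},\mathrm{Abb},\mathrm{Dta},\mathrm{Dtb},\mathbf 2\underline{31},\mathbf 2\underline{13},\underline{31}\mathbf 2)(\phi(\pi)),$$ $$[n-1]\setminus\mathrm{Db}(\pi)=\kappa_n(\mathrm{Db}(\phi(\pi))),\qquad [n-1]\setminus\mathrm{Ides}(\pi)=\kappa_n(\mathrm{Ides}(\phi(\pi))).$$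
   Context: $[n]=\{1,\dots,n\}$; $\mathfrak S_n$ is the set of permutations of $[n]$, written $\pi=\pi(1)\cdots\pi(n)$. For a multiset $S$, $\kappa_N(S)$ is the multiset obtained by replacing each element $s$ (with multiplicity) by $N-s$; it is applied componentwise to tuples. Histories. A 2-Motzkin path of length $n$ is a word $w=w_1\cdots w_n$ over $\{\mathrm N,\mathrm S,\mathrm E,\mathrm{dE}\}$ such that, with $h_i:=\#\{j<i: w_j=\mathrm N\}-\#\{j<i: w_j=\mathrm S\}$ for $1\le i\le n+1$, one has $h_i\ge 0$ for all $i$ and $h_{n+1}=0$. An sr-Laguerre history of length $n$ is a triple $W=(w,h,c)$ where $w$ is a 2-Motzkin path of length $n$, $h=h_1\cdots h_n$ is its height sequence, and $c=c_1\cdots c_n$ is a sequence of integers with $0\le c_i\le h_i$ if $w_i\in\{\mathrm N,\mathrm E\}$ and $1\le c_i\le h_i$ if $w_i\in\{\mathrm S,\mathrm{dE}\}$. $\mathfrak L_n$ is the set of all of these; $\mathrm{cs}(W):=\max\{i\in[n]: c_i=0\}$. The map $\xi:\mathfrak L_n\to\mathfrak L_n$ is the unique involution such that for $W=(w,h,c)$ with $\mathrm{cs}(W)=m$ and $\xi(W)=(v,g,b)$: (1) $\mathrm{cs}(\xi(W))=n+1-m$; (2) for $j\ne n+1-m$, $v_j\in\{\mathrm N,\mathrm E\}$ iff $w_{n+1-j}\in\{\mathrm S,\mathrm{dE}\}$; (3) $g_j=h_{n+1-j}+1$ if $j>n+1-m$ and $v_j\in\{\mathrm S,\mathrm{dE}\}$,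 $g_j=h_{n+1-j}-1$ if $j<n+1-m$ and $v_j\in\{\mathrm N,\mathrm E\}$, and $g_j=h_{n+1-j}$ otherwise; (4) $b_j=g_j-h_{n+1-j}+c_{n+1-j}$ for all $j\in[n]$. The bijection $\Phi_{\mathrm{FV}}:\mathfrak S_n\to\mathfrak L_n$. Put $\pi(0)=-\infty$, $\pi(n+1)=+\infty$. Then $\Phi_{\mathrm{FV}}(\pi)=(w,h,c)$ where, for $i=\pi(k)$: $w_i=\mathrm S$ if $\pi(k-1)<\pi(k)>\pi(k+1)$; $w_i=\mathrm N$ if $\pi(k-1)>\pi(k)<\pi(k+1)$; $w_i=\mathrm E$ if $\pi(k-1)<\pi(k)<\pi(k+1)$; $w_i=\mathrm{dE}$ if $\pi(k-1)>\pi(k)>\pi(k+1)$; $h$ is the height sequence of $w$; and $c_i=\#\{j: k<j<n,\ \pi(j+1)<\pi(k)<\pi(j)\}+\chi(w_i\in\{\mathrm S,\mathrm{dE}\})$, where $\chi$ is $1$ if the statement is true and $0$ otherwise. Permutation statistics. $\mathrm{Des}(\pi)=\{i\in[n-1]:\pi(i)>\pi(i+1)\}$; $\mathrm{Dt}(\pi)=\{\pi(i): i\in\mathrm{Des}(\pi)\}$; $\mathrm{Db}(\pi)=\{\pi(i+1): i\in\mathrm{Des}(\pi)\}$; $\mathrm{Ab}(\pi)=\{\pi(i): 1\le i<n,\ \pi(i)<\pi(i+1)\}$; $\mathrm{Ides}(\pi)=\mathrm{Des}(\pi^{ -1})$. $\mathrm{Dtb},\mathrm{Abb}$ (resp. $\mathrm{Dta},\mathrm{Aba}$)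 of $\pi$ are the subsets of $\mathrm{Dt}(\pi),\mathrm{Ab}(\pi)$ of elements $<\pi(n)$ (resp. $>\pi(n)$). $\mathbf 2\underline{13}(\pi)$ (resp. $\mathbf 2\underline{31}(\pi)$) is the multiset in which $\pi(i)$ has multiplicity $\#\{j: i<j<n,\ \pi(j)<\pi(i)<\pi(j+1)\}$ (resp. $\#\{j: i<j<n,\ \pi(j+1)<\pi(i)<\pi(j)\}$); $\underline{31}\mathbf 2(\pi)$ is the multiset in which $\pi(i)$ has multiplicity $\#\{j: 1\le j<i-1,\ \pi(j+1)<\pi(i)<\pi(j)\}$. -}

module Defs where

open import Data.Bool.Base using (Bool; true; false; if_then_else_)
open import Data.Fin.Base as Fin using (Fin; toℕ; fromℕ; fromℕ<; inject₁; opposite)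
open import Data.Fin.Permutation as Perm using (Permutation′; _⟨$⟩ʳ_; _⟨$⟩ˡ_)
open import Data.Fin.Properties using (toℕ<n; toℕ≤pred[n]; toℕ-fromℕ; toℕ-inject₁; toℕ-injective; toℕ-fromℕ<; fromℕ<-toℕ)
open import Data.Integer.Base as ℤ using (ℤ; 0ℤ; 1ℤ; _⊖_)
import Data.Integer.Properties as ℤ
open import Data.List.Base using
  (List; []; _∷_; _++_; map; filter; length; concatMap; replicate; applyUpTo; tabulate; allFin)
open import Data.List.Extrema.Nat using (max)
open import Data.List.Membership.Propositional using (_∈_)
open import Data.List.Membership.Propositional.Properties using (∈-applyUpTo⁺)
open import Data.List.Membership.DecPropositional using (_∈?_)
open import Data.List.Properties using (length-++; filter-++; applyUpTo-∷ʳ)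
open import Data.List.Relation.Unary.Any using (here; there)
open import Data.Nat.Base using (ℕ; zero; suc; _+_; _∸_; _≤_; _<_; z≤n; s≤s)
open import Data.Nat.Solver using (module +-*-Solver)
open import Data.Nat.Properties using
  (_≟_; _<?_; suc-injective; ≤∧≢⇒<; _≤?_; ≤-refl; ≤-reflexive; ≤-trans; ≤-pred; <⇒≤; <⇒≱; ≰⇒>; ≮⇒≥; m≤n⇒m≤1+n; m≤n+m; 0<1+n;
   +-comm; +-assoc; +-identityʳ; +-0-commutativeMonoid; n≮n)
open import Data.Product.Base using (_×_; _,_; proj₁)
open import Data.Sum.Base using (_⊎_; inj₁; inj₂)
open import Function.Base using (_∘_; id)
open import Function.Bundles using (_⇔_)
open import Function.Structures using (IsBijection)
open import Level using (Level; 0ℓ)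
open import Relation.Binary.Core using (Rel)
open import Relation.Binary.Definitions using (DecidableEquality)
open import Relation.Binary.PropositionalEquality
open import Relation.Nullary.Decidable using (Dec; yes; no; does; ¬?; _×-dec_; _⊎-dec_)
open import Relation.Nullary.Negation using (¬_; contradiction)
open import Relation.Unary using (Pred; Decidable)

open import Algebra.Properties.CommutativeMonoid.Sum +-0-commutativeMonoid
  using (sum; sum-permute; sum-cong-≗)

private variable
  a p q : Level
  A B : Set a
  n : ℕ

[1…_] : ℕ → List ℕ
[1… n ] = applyUpTo suc n

-- The element of [n] represented by an element of Fin n.
⌜_⌝ : Fin n → ℕ
⌜ i ⌝ = suc (toℕ i)

χ : Dec A → ℕ
χ P? = if does P? then 1 else 0

#[1…_] : ∀ {P : Pred ℕ p} → ℕ → Decidable P → ℕ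
#[1… n ] P? = length (filter P? [1… n ])

-- Multisets of naturals are lists up to permutation (_↭_).  Sets are
-- represented in the same way by duplicate-free lists.

-- κ N is only applied to multisets of numbers ≤ N, where ∸ is subtraction.
κ : ℕ → List ℕ → List ℕ
κ N = map (N ∸_)

infix 6 _∖_

_∖_ : List ℕ → List ℕ → List ℕ
S ∖ T = filter (λ s → ¬? (_∈?_ _≟_ s T)) S

𝔖 : ℕ → Set
𝔖 = Permutation′

infix 30 _⟨_⟩

-- The one-line notation π(1)⋯π(n), extended by π(0) = −∞ and
-- π(n+1) = +∞.  As they are only ever compared with elements of [n], the
-- values 0 and n+1 serve as −∞ and +∞; indices above n+1 are not used.
_⟨_⟩ : 𝔖 n → ℕ → ℕ
π ⟨ zero ⟩ = 0
_⟨_⟩ {n} π (suc k) with k <? n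
... | yes k<n = ⌜ π ⟨$⟩ʳ fromℕ< k<n ⌝
... | no  _   = suc n

module _ {n : ℕ} (π : 𝔖 n) where

  Des : List ℕ
  Des = filter (λ i → π ⟨ suc i ⟩ <? π ⟨ i ⟩) [1… n ∸ 1 ]

  Dt Db Ab : List ℕ
  Dt = map (λ i → π ⟨ i ⟩) Des
  Db = map (λ i → π ⟨ suc i ⟩) Des
  Ab = map (λ i → π ⟨ i ⟩) (filter (λ i → π ⟨ i ⟩ <? π ⟨ suc i ⟩) [1… n ∸ 1 ])

  Dtb Dta Abb Aba : List ℕ
  Dtb = filter (λ x → x <? π ⟨ n ⟩) Dt
  Dta = filter (λ x → π ⟨ n ⟩ <? x) Dt
  Abb = filter (λ x → x <? π ⟨ n ⟩) Ab
  Aba = filter (λ x → π ⟨ n ⟩ <? x) Ab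

  -- The number of occurrences of the vincular pattern in which π(i) plays
  -- the role of the 2 and π(j), π(j+1) that of the two adjacent letters.
  mult2-13 mult2-31 mult31-2 : ℕ → ℕ
  mult2-13 i = #[1… n ] λ j →
    (i <? j ×-dec j <? n) ×-dec (π ⟨ j ⟩ <? π ⟨ i ⟩ ×-dec π ⟨ i ⟩ <? π ⟨ suc j ⟩)
  mult2-31 i = #[1… n ] λ j →
    (i <? j ×-dec j <? n) ×-dec (π ⟨ suc j ⟩ <? π ⟨ i ⟩ ×-dec π ⟨ i ⟩ <? π ⟨ j ⟩)
  mult31-2 i = #[1… n ] λ j →
    (j <? i ∸ 1) ×-dec (π ⟨ suc j ⟩ <? π ⟨ i ⟩ ×-dec π ⟨ i ⟩ <? π ⟨ j ⟩)

  fromMult : (ℕ → ℕ) → List ℕ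
  fromMult mult = concatMap (λ i → replicate (mult i) (π ⟨ i ⟩)) [1… n ]

  pat2-13 pat2-31 pat31-2 : List ℕ
  pat2-13 = fromMult mult2-13
  pat2-31 = fromMult mult2-31
  pat31-2 = fromMult mult31-2

Ides : 𝔖 n → List ℕ
Ides π = Des (Perm.flip π)

data Letter : Set where
  N S E dE : Letter

infix 4 _≟ᴸ_

_≟ᴸ_ : DecidableEquality Letter
N  ≟ᴸ N  = yes refl
N  ≟ᴸ S  = no λ ()
N  ≟ᴸ E  = no λ ()
N  ≟ᴸ dE = no λ ()
S  ≟ᴸ N  = no λ ()
S  ≟ᴸ S  = yes refl
S  ≟ᴸ E  = no λ ()
S  ≟ᴸ dE = no λ ()
E  ≟ᴸ N  = no λ ()
E  ≟ᴸ S  = no λ ()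
E  ≟ᴸ E  = yes refl
E  ≟ᴸ dE = no λ ()
dE ≟ᴸ N  = no λ ()
dE ≟ᴸ S  = no λ ()
dE ≟ᴸ E  = no λ ()
dE ≟ᴸ dE = yes refl

_∈NE _∈SdE : Pred Letter 0ℓ
l ∈NE  = l ≡ N ⊎ l ≡ E
l ∈SdE = l ≡ S ⊎ l ≡ dE

_∈SdE? : Decidable _∈SdE
l ∈SdE? = (l ≟ᴸ S) ⊎-dec (l ≟ᴸ dE)

#before : (Fin n → Letter) → ℕ → Letter → ℕ
#before {n} w i l = length (filter (λ j → (⌜ j ⌝ <? i) ×-dec (w j ≟ᴸ l)) (allFin n))

height : (Fin n → Letter) → Fin (suc n) → ℤ
height w i = #before w ⌜ i ⌝ N ⊖ #before w ⌜ i ⌝ S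

record Is2Motzkin {n : ℕ} (w : Fin n → Letter) : Set where
  field
    height-nonneg : ∀ i → 0ℤ ℤ.≤ height w i
    height-end    : height w (fromℕ n) ≡ 0ℤ

record 𝔏 (n : ℕ) : Set where
  field
    w        : Fin n → Letter
    motzkin  : Is2Motzkin w

  h : Fin n → ℤ
  h i = height w (inject₁ i)

  field
    c      : Fin n → ℤ
    c-NE   : ∀ i → w i ∈NE  → 0ℤ ℤ.≤ c i × c i ℤ.≤ h i
    c-SdE  : ∀ i → w i ∈SdE → 1ℤ ℤ.≤ c i × c i ℤ.≤ h i

infix 4 _≈ₕ_

_≈ₕ_ : Rel (𝔏 n) 0ℓ
W ≈ₕ V = (∀ i → W.w i ≡ V.w i) × (∀ i → W.c i ≡ V.c i)
  where module W = 𝔏 W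
        module V = 𝔏 V

-- The default value 0 of the maximum is never attained when n ≥ 1: the
-- constraints on c force c₁ = 0.
cs : 𝔏 n → ℕ
cs {n} W = max 0 (map ⌜_⌝ (filter (λ i → 𝔏.c W i ℤ.≟ 0ℤ) (allFin n)))

-- The conditions relating W = (w, h, c) to ξ(W) = V = (v, g, b).  Here
-- opposite j : Fin n represents n + 1 − j.
record ξ-Conditions {n : ℕ} (W V : 𝔏 n) : Set where
  open 𝔏 W using (w; h; c)
  open 𝔏 V renaming (w to v; h to g; c to b) using ()

  m : ℕ
  m = cs W

  Raised : Fin n → Set
  Raised j = suc n ∸ m < ⌜ j ⌝ × v j ∈SdE

  Lowered : Fin n → Set
  Lowered j = ⌜ j ⌝ < suc n ∸ m × v j ∈NE

  field
    cs-reversed      : cs V ≡ suc n ∸ m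
    letters-reversed : ∀ j → ⌜ j ⌝ ≢ suc n ∸ m → v j ∈NE ⇔ w (opposite j) ∈SdE
    height-raised    : ∀ j → Raised j → g j ≡ h (opposite j) ℤ.+ 1ℤ
    height-lowered   : ∀ j → Lowered j → g j ≡ h (opposite j) ℤ.- 1ℤ
    height-otherwise : ∀ j → ¬ Raised j → ¬ Lowered j → g j ≡ h (opposite j)
    c-reversed       : ∀ j → b j ≡ g j ℤ.- h (opposite j) ℤ.+ c (opposite j)

record Is-ξ {n : ℕ} (ξ : 𝔏 n → 𝔏 n) : Set where
  field
    involutive : ∀ W → ξ (ξ W) ≈ₕ W
    conditions : ∀ W → ξ-Conditions W (ξ W)

infix 4 _≗ₕ_

_≗ₕ_ : Rel (𝔏 n → 𝔏 n) 0ℓ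
ξ ≗ₕ ξ′ = ∀ W → ξ W ≈ₕ ξ′ W

-- The Booleans say whether there is an ascent on the left, resp. right.
shape : Bool → Bool → Letter
shape true  false = S
shape false true  = N
shape true  true  = E
shape false false = dE

letterAt : (ℕ → ℕ) → ℕ → Letter
letterAt x k = shape (does (x (k ∸ 1) <? x k)) (does (x k <? x (suc k)))

position : 𝔖 n → Fin n → ℕ
position π i = ⌜ π ⟨$⟩ˡ i ⌝

FV-w : 𝔖 n → Fin n → Letter
FV-w π i = letterAt (π ⟨_⟩) (position π i)

FV-c : 𝔖 n → Fin n → ℕ
FV-c π i = mult2-31 π (position π i) + χ (FV-w π i ∈SdE?)

-- It remains to check that these data form an sr-Laguerre history.

module ΦFV-WellDefined where

  length-filter-∷ : ∀ {P : Pred A p} (P? : Decidable P) x xs →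
    length (filter P? (x ∷ xs)) ≡ χ (P? x) + length (filter P? xs)
  length-filter-∷ P? x xs with P? x
  ... | yes _ = refl
  ... | no  _ = refl

  length-filter-tabulate : ∀ {P : Pred A p} (P? : Decidable P) {n} (f : Fin n → A) →
    length (filter P? (tabulate f)) ≡ sum (λ i → χ (P? (f i)))
  length-filter-tabulate P? {zero}  f = refl
  length-filter-tabulate P? {suc n} f =
    trans (length-filter-∷ P? (f Fin.zero) _)
          (cong (_+_ (χ (P? (f Fin.zero)))) (length-filter-tabulate P? (f ∘ Fin.suc)))

  length-filter-applyUpTo : ∀ {P : Pred A p} (P? : Decidable P) (f : ℕ → A) n →
    length (filter P? (applyUpTo f n)) ≡ sum {n} (λ i → χ (P? (f (toℕ i))))
  length-filter-applyUpTo P? f zero    = refl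
  length-filter-applyUpTo P? f (suc n) =
    trans (length-filter-∷ P? (f 0) _)
          (cong (_+_ (χ (P? (f 0)))) (length-filter-applyUpTo P? (f ∘ suc) n))

  count-suc : ∀ {P : Pred ℕ p} (P? : Decidable P) n →
    #[1… suc n ] P? ≡ χ (P? (suc n)) + #[1… n ] P?
  count-suc P? n = begin
    length (filter P? [1… suc n ])
      ≡⟨ cong (length ∘ filter P?) (applyUpTo-∷ʳ suc n) ⟨
    length (filter P? ([1… n ] ++ (suc n ∷ [])))
      ≡⟨ cong length (filter-++ P? [1… n ] _) ⟩
    length (filter P? [1… n ] ++ filter P? (suc n ∷ []))
      ≡⟨ length-++ (filter P? [1… n ]) ⟩
    #[1… n ] P? + length (filter P? (suc n ∷ []))
      ≡⟨ cong (_+_ (#[1… n ] P?)) (trans (length-filter-∷ P? (suc n) []) (+-identityʳ _)) ⟩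
    #[1… n ] P? + χ (P? (suc n))
      ≡⟨ +-comm (#[1… n ] P?) _ ⟩
    χ (P? (suc n)) + #[1… n ] P? ∎
    where open ≡-Reasoning

  χ-yes : ∀ {A : Set p} (A? : Dec A) → A → χ A? ≡ 1
  χ-yes (yes _) _ = refl
  χ-yes (no ¬a) a = contradiction a ¬a

  χ-no : ∀ {A : Set p} (A? : Dec A) → ¬ A → χ A? ≡ 0
  χ-no (yes a) ¬a = contradiction a ¬a
  χ-no (no _)  _  = refl

  χ-cong : ∀ {A : Set p} {B : Set q} (A? : Dec A) (B? : Dec B) →
    (A → B) → (B → A) → χ A? ≡ χ B?
  χ-cong (yes _) (yes _) _ _ = refl
  χ-cong (yes a) (no ¬b) f _ = contradiction (f a) ¬b
  χ-cong (no ¬a) (yes b) _ g = contradiction (g b) ¬a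
  χ-cong (no _)  (no _)  _ _ = refl

  module _ {P : Pred A p} {Q : Pred A q} (P? : Decidable P) (Q? : Decidable Q)
           (P⊆Q : ∀ {x} → P x → Q x) where

    filter-≤ : ∀ xs → length (filter P? xs) ≤ length (filter Q? xs)
    filter-≤ []       = z≤n
    filter-≤ (x ∷ xs) with P? x | Q? x
    ... | yes _ | yes _ = s≤s (filter-≤ xs)
    ... | yes p | no ¬q = contradiction (P⊆Q p) ¬q
    ... | no _  | yes _ = m≤n⇒m≤1+n (filter-≤ xs)
    ... | no _  | no _  = filter-≤ xs

    filter-< : ∀ {x xs} → x ∈ xs → ¬ P x → Q x →
               length (filter P? xs) < length (filter Q? xs)
    filter-< {x} {.x ∷ xs} (here refl) ¬p q with P? x | Q? x
    ... | yes p | _     = contradiction p ¬p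
    ... | no _  | yes _ = s≤s (filter-≤ xs)
    ... | no _  | no ¬q = contradiction q ¬q
    filter-< {x} {y ∷ xs} (there x∈xs) ¬p q with P? y | Q? y
    ... | yes _ | yes _ = s≤s (filter-< x∈xs ¬p q)
    ... | yes p | no ¬q = contradiction (P⊆Q p) ¬q
    ... | no _  | yes _ = m≤n⇒m≤1+n (filter-< x∈xs ¬p q)
    ... | no _  | no _  = filter-< x∈xs ¬p q

  filter-none′ : ∀ {P : Pred ℕ p} (P? : Decidable P) n →
    (∀ {j} → j < n → ¬ P (suc j)) → #[1… n ] P? ≡ 0
  filter-none′ P? zero    _  = refl
  filter-none′ P? (suc n) ¬P rewrite count-suc P? n with P? (suc n)
  ... | yes p = contradiction p (¬P ≤-refl)
  ... | no _  = filter-none′ P? n (¬P ∘ m≤n⇒m≤1+n)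

  -- In a sequence that starts with an ascent, the number of N's minus the
  -- number of S's among the entries ≤ t is, up to a boundary term, the
  -- number of descents crossing t.

  module Crossings (x : ℕ → ℕ) (start : x 0 < x 1) (t : ℕ) where

    low? : ∀ l → Decidable (λ k → x k ≤ t × letterAt x k ≡ l)
    low? l k = x k ≤? t ×-dec letterAt x k ≟ᴸ l

    cross? : Decidable (λ k → t < x k × x (suc k) ≤ t)
    cross? k = t <? x k ×-dec x (suc k) ≤? t

    edge : ∀ k → Dec (x (suc k) ≤ t × ¬ x k < x (suc k))
    edge k = x (suc k) ≤? t ×-dec ¬? (x k <? x (suc k))

    step-aux : ∀ {u v w} (a? : Dec (v ≤ t)) (a′? : Dec (w ≤ t)) (d? : Dec (t < v))
               (l? : Dec (u < v)) (r? : Dec (v < w)) →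
               χ (a′? ×-dec ¬? r?) + χ (a? ×-dec shape (does l?) (does r?) ≟ᴸ N)
             ≡ χ (a? ×-dec shape (does l?) (does r?) ≟ᴸ S) + (χ (d? ×-dec a′?) + χ (a? ×-dec ¬? l?))
    step-aux (yes p)  _        (yes q)  _        _ = contradiction p (<⇒≱ q)
    step-aux (no ¬p)  _        (no ¬q)  _        _ = contradiction (≰⇒> ¬p) ¬q
    step-aux (no ¬p)  (yes r)  _        _        (yes s) = contradiction (≤-trans (<⇒≤ s) r) ¬p
    step-aux (yes p)  (no ¬r)  _        _        (no ¬s) = contradiction (≤-trans (≮⇒≥ ¬s) p) ¬r
    step-aux (yes _)  (yes _)  (no _)   (yes _)  (yes _) = refl
    step-aux (yes _)  (yes _)  (no _)   (yes _)  (no _) = refl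
    step-aux (yes _)  (yes _)  (no _)   (no _)   (yes _) = refl
    step-aux (yes _)  (yes _)  (no _)   (no _)   (no _) = refl
    step-aux (yes _)  (no _)   (no _)   (yes _)  (yes _) = refl
    step-aux (yes _)  (no _)   (no _)   (no _)   (yes _) = refl
    step-aux (no _)   (yes _)  (yes _)  (yes _)  (no _) = refl
    step-aux (no _)   (yes _)  (yes _)  (no _)   (no _) = refl
    step-aux (no _)   (no _)   (yes _)  (yes _)  (yes _) = refl
    step-aux (no _)   (no _)   (yes _)  (yes _)  (no _) = refl
    step-aux (no _)   (no _)   (yes _)  (no _)   (yes _) = refl
    step-aux (no _)   (no _)   (yes _)  (no _)   (no _) = refl

    step : ∀ k → χ (edge (suc k)) + χ (low? N (suc k))
               ≡ χ (low? S (suc k)) + (χ (cross? (suc k)) + χ (edge k))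
    step k = step-aux (x (suc k) ≤? t) (x (suc (suc k)) ≤? t) (t <? x (suc k))
                      (x k <? x (suc k)) (x (suc k) <? x (suc (suc k)))

    balance : ∀ m → χ (edge m) + #[1… m ] (low? N) ≡ #[1… m ] (low? S) + #[1… m ] cross?
    balance zero = trans (+-identityʳ _) (χ-no (edge 0) (λ (_ , ¬start) → ¬start start))
    balance (suc m)
      rewrite count-suc (low? N) m | count-suc (low? S) m | count-suc cross? m =
      begin
        e′ + (ν + #N)           ≡⟨ +-assoc e′ ν #N ⟨
        (e′ + ν) + #N           ≡⟨ cong (λ u → u + #N) (step m) ⟩
        (σ + (δ + e)) + #N      ≡⟨ +-*-Solver.solve 4 (λ σ δ e #N →
                                     (σ :+ (δ :+ e)) :+ #N := (σ :+ δ) :+ (e :+ #N)) refl σ δ e #N ⟩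
        (σ + δ) + (e + #N)      ≡⟨ cong (_+_ (σ + δ)) (balance m) ⟩
        (σ + δ) + (#S + #D)     ≡⟨ +-*-Solver.solve 4 (λ σ δ #S #D →
                                     (σ :+ δ) :+ (#S :+ #D) := (σ :+ #S) :+ (δ :+ #D)) refl σ δ #S #D ⟩
        (σ + #S) + (δ + #D)     ∎
      where
        open ≡-Reasoning
        open +-*-Solver
        e′ = χ (edge (suc m))
        e  = χ (edge m)
        ν  = χ (low? N (suc m))
        σ  = χ (low? S (suc m))
        δ  = χ (cross? (suc m))
        #N = #[1… m ] (low? N)
        #S = #[1… m ] (low? S)
        #D = #[1… m ] cross?

  module FV {n : ℕ} (π : 𝔖 n) where

    x : ℕ → ℕ
    x = π ⟨_⟩

    x-value : (k : Fin n) → x ⌜ k ⌝ ≡ ⌜ π ⟨$⟩ʳ k ⌝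
    x-value k with toℕ k <? n
    ... | yes k<n = cong (λ l → ⌜ π ⟨$⟩ʳ l ⌝) (fromℕ<-toℕ k k<n)
    ... | no  k≮n = contradiction (toℕ<n k) k≮n

    x-position : (i : Fin n) → x (position π i) ≡ ⌜ i ⌝
    x-position i = trans (x-value (π ⟨$⟩ˡ i)) (cong ⌜_⌝ (Perm.inverseʳ π))

    x-start : x 0 < x 1
    x-start with 0 <? n
    ... | yes _ = 0<1+n
    ... | no  _ = 0<1+n

    x-end : x (suc n) ≡ suc n
    x-end with n <? n
    ... | yes n<n = contradiction n<n (n≮n n)
    ... | no  _   = refl

    x-bound : ∀ {k} → k < n → x (suc k) ≤ n
    x-bound {k} k<n with k <? n
    ... | yes k<n′ = toℕ<n (π ⟨$⟩ʳ fromℕ< k<n′)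
    ... | no  k≮n  = contradiction k<n k≮n

    module _ (t : ℕ) (t≤n : t ≤ n) where
      open Crossings x x-start t public

      #before-low : ∀ l → #before (FV-w π) (suc t) l ≡ #[1… n ] (low? l)
      #before-low l = begin
        #before (FV-w π) (suc t) l
          ≡⟨ length-filter-tabulate P? id ⟩
        sum (λ i → χ (P? i))
          ≡⟨ sum-permute (λ i → χ (P? i)) π ⟩
        sum (λ k → χ (P? (π ⟨$⟩ʳ k)))
          ≡⟨ sum-cong-≗ (λ k → χ-cong (P? (π ⟨$⟩ʳ k)) (low? l ⌜ k ⌝) (to k) (from k)) ⟩
        sum {n} (λ k → χ (low? l ⌜ k ⌝))
          ≡⟨ length-filter-applyUpTo (low? l) suc n ⟨
        #[1… n ] (low? l) ∎
        where
          open ≡-Reasoning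
          P? : Decidable (λ j → ⌜ j ⌝ < suc t × FV-w π j ≡ l)
          P? j = ⌜ j ⌝ <? suc t ×-dec FV-w π j ≟ᴸ l

          position-image : ∀ k → position π (π ⟨$⟩ʳ k) ≡ ⌜ k ⌝
          position-image k = cong ⌜_⌝ (Perm.inverseˡ π)

          to : ∀ k → ⌜ π ⟨$⟩ʳ k ⌝ < suc t × FV-w π (π ⟨$⟩ʳ k) ≡ l →
               x ⌜ k ⌝ ≤ t × letterAt x ⌜ k ⌝ ≡ l
          to k (s≤s le , eq) =
            ≤-trans (≤-reflexive (x-value k)) le ,
            trans (cong (letterAt x) (sym (position-image k))) eq

          from : ∀ k → x ⌜ k ⌝ ≤ t × letterAt x ⌜ k ⌝ ≡ l →
                 ⌜ π ⟨$⟩ʳ k ⌝ < suc t × FV-w π (π ⟨$⟩ʳ k) ≡ l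
          from k (le , eq) =
            s≤s (≤-trans (≤-reflexive (sym (x-value k))) le) ,
            trans (cong (letterAt x) (position-image k)) eq

      #N≡#S+crossings : #before (FV-w π) (suc t) N
                      ≡ #before (FV-w π) (suc t) S + #[1… n ] cross?
      #N≡#S+crossings = begin
        #before (FV-w π) (suc t) N              ≡⟨ #before-low N ⟩
        #[1… n ] (low? N)                       ≡⟨ cong (λ u → u + #[1… n ] (low? N)) no-edge ⟨
        χ (edge n) + #[1… n ] (low? N)          ≡⟨ balance n ⟩
        #[1… n ] (low? S) + #[1… n ] cross?     ≡⟨ cong (λ u → u + #[1… n ] cross?) (#before-low S) ⟨
        #before (FV-w π) (suc t) S + #[1… n ] cross? ∎
        where
          open ≡-Reasoning
          no-edge : χ (edge n) ≡ 0
          no-edge = χ-no (edge n) λ (le , _) →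
            n≮n n (≤-trans (≤-trans (≤-reflexive (sym x-end)) le) t≤n)

    crossings : ℕ → ℕ
    crossings t = #[1… n ] (Crossings.cross? x x-start t)

    height≡crossings : ∀ i → height (FV-w π) i ≡ ℤ.+ crossings (toℕ i)
    height≡crossings i = begin
      #N ⊖ #S                ≡⟨ cong (_⊖ #S) (#N≡#S+crossings (toℕ i) (toℕ≤pred[n] i)) ⟩
      (#S + #D) ⊖ #S         ≡⟨ cong ((#S + #D) ⊖_) (+-identityʳ #S) ⟨
      (#S + #D) ⊖ (#S + 0)   ≡⟨ ℤ.+-cancelˡ-⊖ #S #D 0 ⟩
      #D ⊖ 0                 ≡⟨⟩
      ℤ.+ #D                 ∎
      where
        open ≡-Reasoning
        #N = #before (FV-w π) ⌜ i ⌝ N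
        #S = #before (FV-w π) ⌜ i ⌝ S
        #D = crossings (toℕ i)

    h≡crossings : ∀ i → height (FV-w π) (inject₁ i) ≡ ℤ.+ crossings (toℕ i)
    h≡crossings i = trans (height≡crossings (inject₁ i))
                          (cong (λ t → ℤ.+ crossings t) (toℕ-inject₁ i))

    crossings-n : crossings n ≡ 0
    crossings-n = filter-none′ (Crossings.cross? x x-start n) n
      (λ j<n (n<xj , _) → contradiction (x-bound j<n) (<⇒≱ n<xj))

    motzkin : Is2Motzkin (FV-w π)
    motzkin = record
      { height-nonneg = λ i → subst (0ℤ ℤ.≤_) (sym (height≡crossings i)) (ℤ.+≤+ z≤n)
      ; height-end    = trans (height≡crossings (fromℕ n))
                              (cong ℤ.+_ (trans (cong crossings (toℕ-fromℕ n)) crossings-n))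
      }

    module _ (i : Fin n) where

      k = position π i
      t = toℕ i

      pattern? : Decidable (λ j → (k < j × j < n) × (x (suc j) < x k × x k < x j))
      pattern? j = (k <? j ×-dec j <? n) ×-dec (x (suc j) <? x k ×-dec x k <? x j)

      pattern⊆cross : ∀ {j} → (k < j × j < n) × (x (suc j) < x k × x k < x j) →
                      t < x j × x (suc j) ≤ t
      pattern⊆cross (_ , below , above) =
        ≤-trans (≤-reflexive (sym (x-position i))) (<⇒≤ above) ,
        ≤-pred (≤-trans below (≤-reflexive (x-position i)))

      mult≤crossings : mult2-31 π k ≤ crossings t
      mult≤crossings = filter-≤ pattern? (Crossings.cross? x x-start t) pattern⊆cross [1… n ]

      shape-SdE : ∀ {u v w} (l? : Dec (u < v)) (r? : Dec (v < w)) →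
                  shape (does l?) (does r?) ∈SdE → w ≤ v
      shape-SdE _       (no ≮) _         = ≮⇒≥ ≮
      shape-SdE (yes _) (yes _) (inj₁ ())
      shape-SdE (yes _) (yes _) (inj₂ ())
      shape-SdE (no _)  (yes _) (inj₁ ())
      shape-SdE (no _)  (yes _) (inj₂ ())

      descent : FV-w π i ∈SdE → x (suc k) ≤ x k
      descent = shape-SdE (x (k ∸ 1) <? x k) (x k <? x (suc k))

      x≢next : x (suc k) ≢ suc t
      x≢next eq with k <? n
      ... | yes k<n = n≮n (toℕ (π ⟨$⟩ˡ i)) (≤-reflexive (begin
        k                                       ≡⟨ toℕ-fromℕ< k<n ⟨
        toℕ (fromℕ< k<n)                        ≡⟨ cong toℕ (Perm.inverseˡ π) ⟨
        toℕ (π ⟨$⟩ˡ (π ⟨$⟩ʳ fromℕ< k<n))        ≡⟨ cong (λ l → toℕ (π ⟨$⟩ˡ l)) (toℕ-injective (suc-injective eq)) ⟩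
        toℕ (π ⟨$⟩ˡ i)                          ∎))
        where open ≡-Reasoning
      ... | no  _   = n≮n n (≤-trans (≤-reflexive eq) (toℕ<n i))

      next≤t : FV-w π i ∈SdE → x (suc k) ≤ t
      next≤t l = ≤-pred (≤∧≢⇒< (≤-trans (descent l) (≤-reflexive (x-position i))) x≢next)

      mult<crossings : FV-w π i ∈SdE → mult2-31 π k < crossings t
      mult<crossings l =
        filter-< pattern? (Crossings.cross? x x-start t) pattern⊆cross
          (∈-applyUpTo⁺ suc (toℕ<n (π ⟨$⟩ˡ i)))
          (λ ((k<k , _) , _) → n≮n k k<k)
          (≤-reflexive (sym (x-position i)) , next≤t l)

      c≤crossings : (l? : Dec (FV-w π i ∈SdE)) → mult2-31 π k + χ l? ≤ crossings t
      c≤crossings (yes l) = ≤-trans (≤-reflexive (+-comm _ 1)) (mult<crossings l)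
      c≤crossings (no _)  = ≤-trans (≤-reflexive (+-identityʳ _)) mult≤crossings

      c≤h : ℤ.+ FV-c π i ℤ.≤ height (FV-w π) (inject₁ i)
      c≤h = subst (ℤ.+ FV-c π i ℤ.≤_) (sym (h≡crossings i)) (ℤ.+≤+ (c≤crossings (FV-w π i ∈SdE?)))

      1≤c : FV-w π i ∈SdE → 1 ≤ FV-c π i
      1≤c l = ≤-trans (≤-reflexive (sym (χ-yes (FV-w π i ∈SdE?) l))) (m≤n+m _ (mult2-31 π k))

ΦFV : 𝔖 n → 𝔏 n
ΦFV π = record
  { w       = FV-w π
  ; motzkin = ΦFV-WellDefined.FV.motzkin π
  ; c       = λ i → ℤ.+ FV-c π i
  ; c-NE    = λ i _ → ℤ.+≤+ z≤n , ΦFV-WellDefined.FV.c≤h π i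
  ; c-SdE   = λ i l → ℤ.+≤+ (ΦFV-WellDefined.FV.1≤c π i l) , ΦFV-WellDefined.FV.c≤h π i
  }

inverse : ∀ {ℓ₁ ℓ₂} {_≈₁_ : Rel A ℓ₁} {_≈₂_ : Rel B ℓ₂} {f : A → B} →
          IsBijection _≈₁_ _≈₂_ f → B → A
inverse f-bijection y = proj₁ (IsBijection.surjective f-bijection y)

{-# OPTIONS --safe #-}

module Submission where

-- For a value i of π let a, b say whether its left, right neighbour is smaller,
-- larger, and let d = 31-2(i) be the number of descents crossing i before i.  Then
-- w_i encodes (a, b), h_i counts all descents from ≥ i to < i, and c_i = h_i − d_i.
--
-- ΦFV is injective because i comes before t + 1 (for i ≤ t) exactly when at most
-- d_{t+1} descents from above t to below it end at or before i, and these numbers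
-- are computed recursively in t.  It is surjective because π is obtained from the
-- word ∞ by inserting 1, …, n: the element t replaces the d_t-th ∞, and an ∞ is
-- kept on each side on which a larger neighbour is needed.
--
-- In these terms, with m = cs(W) = π(n) and j = n + 1 − i, ξ is
-- b′_j = ¬ b_i for i ≠ m, a′_j = ¬ a_{i−1} and d′_j = d_i.  The first two formulas
-- give the statements on Dt, Ab and Db.  The multiplicities of the patterns
-- are read off (b, c, d), as 2-31(i) = c_i − [¬ b_i] and 2-13(i) = c_i − [m < i].
-- Finally i is in Ides(π) exactly when d_{i+1} < d_i + [¬ a_i], and this condition
-- turns into its negation.

open import Data.Fin.Permutation using (_≈_)
open import Data.List.Relation.Binary.Permutation.Propositional using (_↭_)
open import Data.Nat.Base using (ℕ; suc; _∸_; _≤_)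
open import Data.Product using (Σ; _×_; _,_; ∃!)
open import Function.Base using (_∘_)
open import Function.Structures using (IsBijection)
open import Defs

open import Data.Bool.Base using (Bool; true; false; not; if_then_else_)
open import Data.Bool.Properties using (not-involutive; ¬-not)
open import Data.Fin.Base as Fin using (Fin; toℕ; fromℕ; fromℕ<; inject₁; opposite)
open import Data.Fin.Induction using (<-weakInduction)
open import Data.Fin.Permutation as Perm using (_⟨$⟩ʳ_; _⟨$⟩ˡ_)
open import Data.Fin.Properties using
  (toℕ<n; toℕ-injective; toℕ-fromℕ; toℕ-fromℕ<; toℕ-inject₁; toℕ-cast; toℕ≤pred[n];
   cast-involutive; opposite-prop; opposite-involutive)
open import Data.Fin.Relation.Unary.Top using (View; view; ‵fromℕ; ‵inject₁)
open import Data.Integer.Base as ℤ using (ℤ; 0ℤ; 1ℤ; _⊖_)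
import Data.Integer.Properties as ℤ
import Data.Integer.Solver as ℤ
open import Data.List.Base using
  (List; []; _∷_; _∷ʳ_; length; lookup; map; filter; allFin; applyUpTo; concat; concatMap; replicate)
open import Data.List.Extrema.Nat using (xs≤max; argmax-sel; max≤v⁺)
open import Data.List.Membership.Propositional using (_∈_)
open import Data.List.Membership.Propositional.Properties using
  (∈-allFin; ∈-map⁺; ∈-map⁻; ∈-filter⁺; ∈-filter⁻; ∈-map∘filter⁺; ∈-map∘filter⁻;
   ∈-applyUpTo⁺; ∈-applyUpTo⁻)
open import Data.List.Membership.Propositional.Properties.WithK using (unique∧set⇒bag)
open import Data.List.Properties using
  (length-applyUpTo; lookup-applyUpTo; applyUpTo-∷ʳ; filter-accept; filter-reject;
   map-cong-local; map-concatMap; map-replicate; concatMap-map)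
open import Data.List.Relation.Binary.BagAndSetEquality using (∼bag⇒↭; ↭⇒∼bag; concat-cong; map-cong)
open import Data.List.Relation.Binary.Permutation.Homogeneous using (onIndices)
open import Data.List.Relation.Binary.Permutation.Propositional using
  (↭-refl; ↭-reflexive; ↭-trans; ↭-prep; ↭-swap; ↭⇒↭ₛ; module PermutationReasoning)
open import Data.List.Relation.Binary.Permutation.Propositional.Properties using (↭-length; ∷↭∷ʳ)
import Data.List.Relation.Unary.All as All
import Data.List.Relation.Unary.All.Properties as All
open import Data.List.Relation.Unary.AllPairs as AllPairs using ([]; _∷_)
import Data.List.Relation.Unary.AllPairs.Properties as AllPairs
import Data.List.Relation.Unary.Any as Any
open import Data.List.Relation.Unary.Unique.Propositional using (Unique)
open import Data.Nat.Base
open import Data.Nat.Properties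
open import Data.Product using (∃; proj₁; proj₂)
open import Data.Sum.Base using (inj₁; inj₂)
open import Data.Unit.Base using (⊤; tt)
open import Function.Base using (id)
open import Function.Bundles using (mk⇔; module Equivalence)
open import Level using (0ℓ)
open import Relation.Binary.Core using (Rel)
open import Relation.Binary.Definitions using (Tri; tri<; tri≈; tri>)
open import Relation.Binary.PropositionalEquality
open import Relation.Binary.Structures using (IsEquivalence)
open import Relation.Nullary.Decidable using
  (Dec; yes; no; does; ¬?; _×-dec_; dec-true; dec-false; does-⇔)
open import Relation.Nullary.Negation using (¬_; contradiction)
open import Relation.Unary using (Pred; Decidable)

open import Algebra.Properties.CommutativeMonoid.Sum +-0-commutativeMonoid
  using (sum; sum-permute; sum-cong-≗)
open import Algebra.Properties.CommutativeSemigroup +-commutativeSemigroup using (interchange)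
open import Data.List.Membership.DecPropositional _≟_ using (_∈?_)
open import Data.List.Relation.Binary.Permutation.Setoid.Properties (setoid ℕ) using (onIndices-lookup)
open ΦFV-WellDefined using
  (χ-yes; χ-no; χ-cong; count-suc; length-filter-tabulate; module FV)

-- The Booleans a, b are chosen because h_{i+1} - h_i = [b_i] - [a_i]. The conditions on ξ speak of
-- b (N, E against S, dE), of h and of c, never of a: the left ascents are forced by consecutive
-- heights. This makes ξ unique, and it is the origin of the index i - 1 in a′. Since the conditions
-- are symmetric in W and ξ(W), uniqueness also shows that ξ is an involution. Everything about a
-- permutation rests on `entries`, the number of descents into [0, t] up to a given position. Cut at
-- the position of t + 1 it is d_{t+1}, taken over all positions it is the height, and its change
-- from t to t + 1 is explicit. No inverse of `ΦFV` is evaluated to compare statistics: they are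
-- compared for any σ whose history is ξ of the history of π.

private variable
  n : ℕ

-- Sums over positions

Σ< : ℕ → (ℕ → ℕ) → ℕ
Σ< zero    f = 0
Σ< (suc m) f = f m + Σ< m f

Σ<-cong : ∀ {f g} m → (∀ {j} → j < m → f j ≡ g j) → Σ< m f ≡ Σ< m g
Σ<-cong zero    f≗g = refl
Σ<-cong (suc m) f≗g = cong₂ _+_ (f≗g ≤-refl) (Σ<-cong m (f≗g ∘ m≤n⇒m≤1+n))

Σ<-+ : ∀ f g m → Σ< m (λ j → f j + g j) ≡ Σ< m f + Σ< m g
Σ<-+ f g zero    = refl
Σ<-+ f g (suc m) = trans (cong (f m + g m +_) (Σ<-+ f g m)) (interchange (f m) (g m) _ _)

Σ<-front : ∀ f m → Σ< (suc m) f ≡ f 0 + Σ< m (f ∘ suc)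
Σ<-front f zero    = refl
Σ<-front f (suc m) = begin
  f (suc m) + Σ< (suc m) f             ≡⟨ cong (f (suc m) +_) (Σ<-front f m) ⟩
  f (suc m) + (f 0 + Σ< m (f ∘ suc))   ≡⟨ +-assoc (f (suc m)) _ _ ⟨
  f (suc m) + f 0 + Σ< m (f ∘ suc)     ≡⟨ cong (_+ Σ< m (f ∘ suc)) (+-comm (f (suc m)) (f 0)) ⟩
  f 0 + f (suc m) + Σ< m (f ∘ suc)     ≡⟨ +-assoc (f 0) _ _ ⟩
  f 0 + Σ< (suc m) (f ∘ suc)           ∎
  where open ≡-Reasoning

Σ<-zero : ∀ {f} m → (∀ {j} → j < m → f j ≡ 0) → Σ< m f ≡ 0
Σ<-zero zero    f≡0 = refl
Σ<-zero (suc m) f≡0 = cong₂ _+_ (f≡0 ≤-refl) (Σ<-zero m (f≡0 ∘ m≤n⇒m≤1+n))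

Σ<-truncate : ∀ {f k m} → k ≤ m → (∀ {j} → k ≤ j → f j ≡ 0) → Σ< m f ≡ Σ< k f
Σ<-truncate {f} {k} {m} k≤m f≡0 with m≤n⇒m<n∨m≡n k≤m
... | inj₂ refl = refl
Σ<-truncate {f} {k} {suc m} _ f≡0 | inj₁ (s≤s k≤m) =
  cong₂ _+_ (f≡0 k≤m) (Σ<-truncate k≤m f≡0)

-- A Kronecker delta of weight c; it carries the boundary terms at a single position through the
-- sums.
[_≡_]*_ : ℕ → ℕ → ℕ → ℕ
[ j ≡ q ]* c = if does (j ≟ q) then c else 0

δ-≡ : ∀ j {q} c → j ≡ q → [ j ≡ q ]* c ≡ c
δ-≡ j {q} c eq rewrite dec-true (j ≟ q) eq = refl

δ-≢ : ∀ {j q} c → j ≢ q → [ j ≡ q ]* c ≡ 0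
δ-≢ {j} {q} c neq rewrite dec-false (j ≟ q) neq = refl

Σ<-δ : ∀ {q} c m → Σ< m (λ j → [ j ≡ q ]* c) ≡ (if does (q <? m) then c else 0)
Σ<-δ c zero = refl
Σ<-δ {q} c (suc m) with <-cmp m q
... | tri< m<q m≢q _ rewrite δ-≢ c m≢q | Σ<-δ {q} c m
  | dec-false (q <? m) (<⇒≯ m<q) | dec-false (q <? suc m) (λ q≤m → <⇒≱ m<q (≤-pred q≤m)) = refl
... | tri≈ _ refl _ rewrite δ-≡ m c refl | Σ<-δ {m} c m
  | dec-false (m <? m) (n≮n m) | dec-true (m <? suc m) ≤-refl = +-identityʳ c
... | tri> _ m≢q q<m rewrite δ-≢ c m≢q | Σ<-δ {q} c m
  | dec-true (q <? m) q<m | dec-true (q <? suc m) (m≤n⇒m≤1+n q<m) = refl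

#≡Σ< : ∀ {p} {P : Pred ℕ p} (P? : Decidable P) m → #[1… m ] P? ≡ Σ< m (λ j → χ (P? (suc j)))
#≡Σ< P? zero    = refl
#≡Σ< P? (suc m) = trans (count-suc P? m) (cong (χ (P? (suc m)) +_) (#≡Σ< P? m))

-- Descents into [0, t]

enters? : (x : ℕ → ℕ) (t j : ℕ) → Dec (t < x j × x (suc j) ≤ t)
enters? x t j = t <? x j ×-dec x (suc j) ≤? t

-- `enters?` unfolds to the predicate `cross?` behind `h≡crossings`, so over all positions the
-- entries make up the height. Stopping at k is what records the order of positions.
entries : (ℕ → ℕ) → ℕ → ℕ → ℕ
entries x t k = Σ< k (λ j → χ (enters? x t j))

entries-mono : ∀ x t {j k} → j ≤ k → entries x t j ≤ entries x t k
entries-mono x t {j} {k} j≤k with m≤n⇒m<n∨m≡n j≤k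
... | inj₂ refl = ≤-refl
entries-mono x t {j} {suc k} _ | inj₁ (s≤s j≤k) =
  ≤-trans (entries-mono x t j≤k) (m≤n+m _ (χ (enters? x t k)))

-- A walk from a letter above t to a letter at most t must enter [0, t] on the way.
entries-strict : ∀ x t {j k} → j ≤ k → t < x j → x k ≤ t → entries x t j < entries x t k
entries-strict x t {j} {k} j≤k t<xj xk≤t with m≤n⇒m<n∨m≡n j≤k
... | inj₂ refl = contradiction xk≤t (<⇒≱ t<xj)
entries-strict x t {j} {suc k} _ t<xj xk≤t | inj₁ (s≤s j≤k) with t <? x k
... | yes t<xk rewrite dec-true (t <? x k) t<xk | dec-true (x (suc k) ≤? t) xk≤t = s≤s (entries-mono x t j≤k)
... | no  t≮xk rewrite dec-false (t <? x k) t≮xk = entries-strict x t j≤k t<xj (≮⇒≥ t≮xk)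

leftAscent rightAscent : (ℕ → ℕ) → ℕ → Bool
leftAscent  x k = does (x (k ∸ 1) <? x k)
rightAscent x k = does (x k <? x (suc k))

χ¬ : Bool → ℕ
χ¬ b = if b then 0 else 1

left right : Letter → Bool
left N  = false
left S  = true
left E  = true
left dE = false
right N  = true
right S  = false
right E  = true
right dE = false

left-shape : ∀ a b → left (shape a b) ≡ a
left-shape true  true  = refl
left-shape true  false = refl
left-shape false true  = refl
left-shape false false = refl

right-shape : ∀ a b → right (shape a b) ≡ b
right-shape true  true  = refl
right-shape true  false = refl
right-shape false true  = refl
right-shape false false = refl

shape-left-right : ∀ l → shape (left l) (right l) ≡ l
shape-left-right N  = refl
shape-left-right S  = refl
shape-left-right E  = refl
shape-left-right dE = refl

χ-∈SdE : ∀ l → χ (l ∈SdE?) ≡ χ¬ (right l)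
χ-∈SdE N  = refl
χ-∈SdE S  = refl
χ-∈SdE E  = refl
χ-∈SdE dE = refl

-- The statistics at one value t + 1, standing at position q

module AtValue
  (n : ℕ) (x : ℕ → ℕ) (x-zero : x 0 ≡ 0) (x-end : x (suc n) ≡ suc n)
  (t q′ : ℕ) (t<n : t < n) (q≤n : q′ < n)
  (x-q : x (suc q′) ≡ suc t) (unique : ∀ {j} → x j ≡ suc t → j ≡ suc q′)
  where

  q : ℕ
  q = suc q′

  A B : Bool
  A = leftAscent  x q
  B = rightAscent x q

  x≢ : ∀ {j} → j ≢ q → x j ≢ suc t
  x≢ j≢q eq = j≢q (unique eq)

  x≮0 : ∀ {m} → ¬ m < x 0
  x≮0 lt = n≮0 (≤-trans lt (≤-reflexive x-zero))

  31-2? : ∀ j → Dec (j < q ∸ 1 × (x (suc j) < x q × x q < x j))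
  31-2? j = (j <? q ∸ 1) ×-dec (x (suc j) <? x q ×-dec x q <? x j)

  2-31? : ∀ j → Dec ((q < j × j < n) × (x (suc j) < x q × x q < x j))
  2-31? j = (q <? j ×-dec j <? n) ×-dec (x (suc j) <? x q ×-dec x q <? x j)

  2-13? : ∀ j → Dec ((q < j × j < n) × (x j < x q × x q < x (suc j)))
  2-13? j = (q <? j ×-dec j <? n) ×-dec (x j <? x q ×-dec x q <? x (suc j))

  crossings d e f c : ℕ
  crossings = #[1… n ] (enters? x t)
  d = #[1… n ] 31-2?
  e = #[1… n ] 2-31?
  f = #[1… n ] 2-13?
  c = e + χ¬ B

  d≡ : d ≡ Σ< (suc n) (χ ∘ 31-2?)
  d≡ = trans (#≡Σ< 31-2? n) (sym (trans (Σ<-front (χ ∘ 31-2?) n)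
    (cong (_+ Σ< n (χ ∘ 31-2? ∘ suc)) (χ-no (31-2? 0) λ (_ , _ , lt) → x≮0 lt))))

  e≡ : e ≡ Σ< (suc n) (χ ∘ 2-31?)
  e≡ = trans (#≡Σ< 2-31? n) (sym (trans (Σ<-front (χ ∘ 2-31?) n)
    (cong (_+ Σ< n (χ ∘ 2-31? ∘ suc)) (χ-no (2-31? 0) λ { ((() , _) , _) }))))

  f≡ : f ≡ Σ< (suc n) (χ ∘ 2-13?)
  f≡ = trans (#≡Σ< 2-13? n) (sym (trans (Σ<-front (χ ∘ 2-13?) n)
    (cong (_+ Σ< n (χ ∘ 2-13? ∘ suc)) (χ-no (2-13? 0) λ { ((() , _) , _) }))))

  crossings≡ : crossings ≡ entries x t (suc n)
  crossings≡ = trans (#≡Σ< (enters? x t) n) (sym (trans (Σ<-front (χ ∘ enters? x t) n)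
    (cong (_+ Σ< n (χ ∘ enters? x t ∘ suc)) (χ-no (enters? x t 0) λ (lt , _) → x≮0 lt))))

  -- Away from q no letter equals t + 1, so being above the level t and being above the value t + 1
  -- agree there.
  above : ∀ {j} → j ≢ q → t < x j → x q < x j
  above j≢q t<xj = ≤-trans (s≤s (≤-reflexive x-q)) (≤∧≢⇒< t<xj (x≢ j≢q ∘ sym))

  above⁻ : ∀ {j} → x q < x j → t < x j
  above⁻ lt = <⇒≤ (≤-trans (s≤s (≤-reflexive (sym x-q))) lt)

  below : ∀ {j} → x j ≤ t → x j < x q
  below le = ≤-trans (s≤s le) (≤-reflexive (sym x-q))

  below⁻ : ∀ {j} → x j < x q → x j ≤ t
  below⁻ lt = ≤-pred (≤-trans lt (≤-reflexive x-q))

  -- The letter t + 1 lies above the level t, so a descent out of it is an entry. At level t + 1 it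
  -- lies inside, so in `¬A-enters` a descent into it is one. Equal neighbours are excluded by
  -- `unique`.
  ¬B-enters : χ (enters? x t q) ≡ χ¬ B
  ¬B-enters with x q <? x (suc q)
  ... | yes up rewrite dec-true (x q <? x (suc q)) up =
    χ-no (enters? x t q) λ (_ , le) → <⇒≱ up (<⇒≤ (below le))
  ... | no ¬up rewrite dec-false (x q <? x (suc q)) ¬up = χ-yes (enters? x t q) (≤-reflexive (sym x-q) ,
    below⁻ (≤∧≢⇒< (≮⇒≥ ¬up) (λ eq → 1+n≢n (unique (trans eq x-q)))))

  ¬A-enters : χ (enters? x (suc t) q′) ≡ χ¬ A
  ¬A-enters with x q′ <? x q
  ... | yes up rewrite dec-true (x q′ <? x q) up =
    χ-no (enters? x (suc t) q′) λ (lt , _) → <⇒≱ up (<⇒≤ (≤-trans (s≤s (≤-reflexive x-q)) lt))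
  ... | no ¬up rewrite dec-false (x q′ <? x q) ¬up = χ-yes (enters? x (suc t) q′)
    (≤∧≢⇒< (≤-trans (≤-reflexive (sym x-q)) (≮⇒≥ ¬up)) (x≢ (1+n≢n ∘ sym) ∘ sym) ,
     ≤-reflexive x-q)

  -- An entry before q is an occurrence of 31-2, one after q an occurrence of 2-31, and the step out
  -- of q is an entry when it descends. The step into q ends at t + 1 and is no entry, in accordance
  -- with j < q - 1 in 31-2; nor is the last step, to +∞.
  splits : ∀ {j} → j < suc n →
    χ (enters? x t j) ≡ χ (31-2? j) + χ (2-31? j) + [ j ≡ q ]* χ¬ B
  splits {j} j≤n with <-cmp j q
  ... | tri≈ _ j≡q _ = trans (trans (cong (χ ∘ enters? x t) j≡q) ¬B-enters) (sym (cong₂ _+_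
      (cong₂ _+_ (χ-no (31-2? j) (λ (j<q′ , _) → <⇒≱ j<q′ (≤-trans (n≤1+n q′) (≤-reflexive (sym j≡q)))))
                 (χ-no (2-31? j) (λ ((q<j , _) , _) → <⇒≱ q<j (≤-reflexive j≡q))))
      (δ-≡ j (χ¬ B) j≡q)))
  ... | tri< (s≤s j≤q′) j≢q _ = trans
      (χ-cong (enters? x t j) (31-2? j)
        (λ (hi , lo) → ≤∧≢⇒< j≤q′ (λ { refl → n≮n t (≤-trans (≤-reflexive (sym x-q)) lo) })
                     , below lo , above j≢q hi)
        (λ (_ , lo , hi) → above⁻ hi , below⁻ lo))
      (sym (trans (cong₂ (λ u v → χ (31-2? j) + u + v)
                    (χ-no (2-31? j) (λ ((q<j , _) , _) → <⇒≱ q<j (m≤n⇒m≤1+n j≤q′)))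
                    (δ-≢ (χ¬ B) j≢q))
                  (trans (+-identityʳ _) (+-identityʳ _))))
  ... | tri> _ j≢q q<j = trans
      (χ-cong (enters? x t j) (2-31? j)
        (λ (hi , lo) → (q<j , ≤∧≢⇒< (≤-pred j≤n) (λ { refl →
             n≮n n (≤-trans (≤-reflexive (sym x-end)) (≤-trans lo (<⇒≤ t<n))) }))
           , below lo , above j≢q hi)
        (λ (_ , lo , hi) → above⁻ hi , below⁻ lo))
      (sym (trans (cong₂ (λ u v → u + χ (2-31? j) + v)
                    (χ-no (31-2? j) (λ (j<q′ , _) → <⇒≱ (≤-trans q<j (<⇒≤ j<q′)) (n≤1+n q′)))
                    (δ-≢ (χ¬ B) j≢q))
                  (+-identityʳ _)))

  crossings≡d+c : crossings ≡ d + c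
  crossings≡d+c = begin
    crossings
      ≡⟨ crossings≡ ⟩
    Σ< (suc n) (χ ∘ enters? x t)
      ≡⟨ Σ<-cong (suc n) splits ⟩
    Σ< (suc n) (λ j → χ (31-2? j) + χ (2-31? j) + [ j ≡ q ]* χ¬ B)
      ≡⟨ Σ<-+ (λ j → χ (31-2? j) + χ (2-31? j)) (λ j → [ j ≡ q ]* χ¬ B) (suc n) ⟩
    Σ< (suc n) (λ j → χ (31-2? j) + χ (2-31? j)) + Σ< (suc n) (λ j → [ j ≡ q ]* χ¬ B)
      ≡⟨ cong₂ _+_ (Σ<-+ (χ ∘ 31-2?) (χ ∘ 2-31?) (suc n))
                   (trans (Σ<-δ (χ¬ B) (suc n))
                          (cong (if_then χ¬ B else 0) (dec-true (q <? suc n) (s≤s q≤n)))) ⟩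
    Σ< (suc n) (χ ∘ 31-2?) + Σ< (suc n) (χ ∘ 2-31?) + χ¬ B
      ≡⟨ cong₂ (λ u v → u + v + χ¬ B) d≡ e≡ ⟨
    d + e + χ¬ B
      ≡⟨ +-assoc d e _ ⟩
    d + c ∎
    where open ≡-Reasoning

  d≡entries : d ≡ entries x t q
  d≡entries = begin
    d                            ≡⟨ d≡ ⟩
    Σ< (suc n) (χ ∘ 31-2?)       ≡⟨ Σ<-truncate (m≤n⇒m≤1+n q≤n) (λ {j} q≤j →
                                      χ-no (31-2? j) (λ (j<q′ , _) → <⇒≱ j<q′ (<⇒≤ q≤j))) ⟩
    Σ< q (χ ∘ 31-2?)             ≡⟨ Σ<-cong q (λ {j} j<q → sym (trans (splits (≤-trans j<q (m≤n⇒m≤1+n q≤n)))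
                                      (trans (cong₂ (λ u v → χ (31-2? j) + u + v)
                                               (χ-no (2-31? j) (λ ((q<j , _) , _) → <⇒≯ q<j j<q))
                                               (δ-≢ (χ¬ B) (<⇒≢ j<q)))
                                             (trans (+-identityʳ _) (+-identityʳ _))))) ⟩
    entries x t q                ∎
    where open ≡-Reasoning

  -- Raising the level moves only the letter t + 1 from outside to inside, which affects the two
  -- steps at q alone: a descent out of q ceases to be an entry, and a descent into q becomes one.
  raise : ∀ j → χ (enters? x (suc t) j) + [ j ≡ q ]* χ¬ B
              ≡ χ (enters? x t j) + [ suc j ≡ q ]* χ¬ A
  raise j with j ≟ q
  ... | yes j≡q = trans
      (cong₂ _+_ (χ-no (enters? x (suc t) j) (λ (lt , _) →
                    n≮n (suc t) (≤-trans lt (≤-reflexive (trans (cong x j≡q) x-q)))))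
                 (δ-≡ j (χ¬ B) j≡q))
      (sym (trans (cong₂ _+_ (trans (cong (χ ∘ enters? x t) j≡q) ¬B-enters)
                             (δ-≢ (χ¬ A) (λ eq → 1+n≢n (trans eq (sym j≡q)))))
                  (+-identityʳ _)))
  ... | no j≢q with suc j ≟ q
  ...   | yes sj≡q = trans
      (cong₂ _+_ (trans (cong (χ ∘ enters? x (suc t)) (suc-injective sj≡q)) ¬A-enters) (δ-≢ (χ¬ B) j≢q))
      (trans (+-identityʳ _) (sym (cong₂ _+_
        (χ-no (enters? x t j) (λ (_ , le) →
           n≮n t (≤-trans (≤-reflexive (sym (trans (cong x sj≡q) x-q))) le)))
        (δ-≡ (suc j) (χ¬ A) sj≡q))))
  ...   | no sj≢q = cong₂ _+_ (χ-cong (enters? x (suc t) j) (enters? x t j)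
      (λ (hi , lo) → <⇒≤ hi , ≤-pred (≤∧≢⇒< lo (x≢ sj≢q)))
      (λ (hi , lo) → ≤∧≢⇒< hi (x≢ j≢q ∘ sym) , m≤n⇒m≤1+n lo))
      (trans (δ-≢ (χ¬ B) j≢q) (sym (δ-≢ (χ¬ A) sj≢q)))

  -- The recursion in t on which injectivity rests: the correction terms depend only on a, b and the
  -- order of q and k.
  entries-raise : ∀ k → entries x (suc t) k + (if does (q <? k) then χ¬ B else 0)
                      ≡ entries x t k + (if does (q <? suc k) then χ¬ A else 0)
  entries-raise k = begin
    entries x (suc t) k + (if does (q <? k) then χ¬ B else 0)
      ≡⟨ cong (entries x (suc t) k +_) (Σ<-δ (χ¬ B) k) ⟨
    entries x (suc t) k + Σ< k (λ j → [ j ≡ q ]* χ¬ B)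
      ≡⟨ Σ<-+ (χ ∘ enters? x (suc t)) (λ j → [ j ≡ q ]* χ¬ B) k ⟨
    Σ< k (λ j → χ (enters? x (suc t) j) + [ j ≡ q ]* χ¬ B)
      ≡⟨ Σ<-cong k (λ {j} _ → raise j) ⟩
    Σ< k (λ j → χ (enters? x t j) + [ suc j ≡ q ]* χ¬ A)
      ≡⟨ Σ<-+ (χ ∘ enters? x t) (λ j → [ suc j ≡ q ]* χ¬ A) k ⟩
    entries x t k + Σ< k (λ j → [ suc j ≡ q ]* χ¬ A)
      -- Shifting the index adds the term at 0, which computes to 0 because q is a successor.
      ≡⟨ cong (entries x t k +_) (Σ<-front (λ j → [ j ≡ q ]* χ¬ A) k) ⟨
    entries x t k + Σ< (suc k) (λ j → [ j ≡ q ]* χ¬ A)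
      ≡⟨ cong (entries x t k +_) (Σ<-δ (χ¬ A) (suc k)) ⟩
    entries x t k + (if does (q <? suc k) then χ¬ A else 0) ∎
    where open ≡-Reasoning

  -- The initial value of the recursion, for the letter that has just come to lie inside the level.
  entries-at-q : entries x (suc t) q ≡ d + χ¬ A
  entries-at-q = begin
    entries x (suc t) q ≡⟨ +-identityʳ _ ⟨
    entries x (suc t) q + 0
      ≡⟨ cong (λ b → entries x (suc t) q + (if b then χ¬ B else 0)) (dec-false (q <? q) (n≮n q)) ⟨
    entries x (suc t) q + (if does (q <? q) then χ¬ B else 0)
      ≡⟨ entries-raise q ⟩
    entries x t q + (if does (q <? suc q) then χ¬ A else 0)
      ≡⟨ cong₂ (λ u b → u + (if b then χ¬ A else 0)) (sym d≡entries) (dec-true (q <? suc q) ≤-refl) ⟩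
    d + χ¬ A ∎
    where open ≡-Reasoning

  -- Together with `after⇒` this is a test: for a letter at most t at position k, comparing the
  -- entries up to k with d tells on which side of q it stands.
  before⇒ : ∀ {k} → k < q → entries x t k ≤ d
  before⇒ k<q = ≤-trans (entries-mono x t (<⇒≤ k<q)) (≤-reflexive (sym d≡entries))

  after⇒ : ∀ {k} → q < k → x k ≤ t → d < entries x t k
  after⇒ q<k xk≤t = ≤-trans (s≤s (≤-reflexive d≡entries))
    (entries-strict x t (<⇒≤ q<k) (≤-reflexive (sym x-q)) xk≤t)

  low? : ∀ k → Dec (x k < x q)
  low? k = x k <? x q

  low-step : ∀ {j} → q < j → j < n →
    χ (low? (suc j)) + χ (2-13? j) ≡ χ (low? j) + χ (2-31? j)
  low-step {j} q<j j<n
    rewrite dec-true (q <? j) q<j | dec-true (j <? n) j<n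
    with <-cmp (x j) (x q) | <-cmp (x (suc j)) (x q)
  ... | tri≈ _ eq _ | _ = contradiction (trans eq x-q) (x≢ (<⇒≢ q<j ∘ sym))
  ... | _ | tri≈ _ eq _ = contradiction (trans eq x-q) (x≢ (<⇒≢ (m≤n⇒m≤1+n q<j) ∘ sym))
  ... | tri< a _ ¬a | tri< b _ ¬b
    rewrite dec-true (x j <? x q) a | dec-true (x (suc j) <? x q) b
          | dec-false (x q <? x j) ¬a | dec-false (x q <? x (suc j)) ¬b = refl
  ... | tri< a _ ¬a | tri> ¬b _ b
    rewrite dec-true (x j <? x q) a | dec-false (x (suc j) <? x q) ¬b
          | dec-true (x q <? x (suc j)) b = refl
  ... | tri> ¬a _ a | tri< b _ ¬b
    rewrite dec-false (x j <? x q) ¬a | dec-true (x (suc j) <? x q) b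
          | dec-true (x q <? x j) a = refl
  ... | tri> ¬a _ a | tri> ¬b _ b
    rewrite dec-false (x j <? x q) ¬a | dec-false (x (suc j) <? x q) ¬b = refl

  no-2-13 : ∀ {j} → j ≤ q → χ (2-13? j) ≡ 0
  no-2-13 {j} j≤q = χ-no (2-13? j) (λ ((q<j , _) , _) → <⇒≱ q<j j≤q)

  no-2-31 : ∀ {j} → j ≤ q → χ (2-31? j) ≡ 0
  no-2-31 {j} j≤q = χ-no (2-31? j) (λ ((q<j , _) , _) → <⇒≱ q<j j≤q)

  -- After position q, the sequence crosses the value x q alternately upwards
  -- and downwards.
  low-balance : ∀ k → q < k → k ≤ n →
    χ (low? k) + Σ< k (χ ∘ 2-13?) ≡ χ¬ B + Σ< k (χ ∘ 2-31?)
  low-balance (suc k) (s≤s q≤k) k<n with m≤n⇒m<n∨m≡n q≤k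
  ... | inj₂ refl
    rewrite Σ<-zero {χ ∘ 2-13?} (suc q) (no-2-13 ∘ ≤-pred)
          | Σ<-zero {χ ∘ 2-31?} (suc q) (no-2-31 ∘ ≤-pred) = cong (_+ 0) low-start
    where
    low-start : χ (low? (suc q)) ≡ χ¬ B
    low-start with x q <? x (suc q)
    ... | yes up rewrite dec-true (x q <? x (suc q)) up = χ-no (low? (suc q)) (<⇒≯ up)
    ... | no ¬up rewrite dec-false (x q <? x (suc q)) ¬up = χ-yes (low? (suc q)) (≤∧≢⇒< (≮⇒≥ ¬up)
      (λ eq → x≢ {suc q} 1+n≢n (trans eq x-q)))
  ... | inj₁ q<k = begin
    lo′ + (F + ΣF)    ≡⟨ +-assoc lo′ F ΣF ⟨
    lo′ + F + ΣF      ≡⟨ cong (_+ ΣF) (trans (low-step q<k k<n) (+-comm lo E′)) ⟩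
    E′ + lo + ΣF      ≡⟨ +-assoc E′ lo ΣF ⟩
    E′ + (lo + ΣF)    ≡⟨ cong (E′ +_) (low-balance k q<k (<⇒≤ k<n)) ⟩
    E′ + (χ¬ B + ΣE)  ≡⟨ +-assoc E′ (χ¬ B) ΣE ⟨
    E′ + χ¬ B + ΣE    ≡⟨ cong (_+ ΣE) (+-comm E′ _) ⟩
    χ¬ B + E′ + ΣE    ≡⟨ +-assoc (χ¬ B) E′ ΣE ⟩
    χ¬ B + (E′ + ΣE)  ∎
    where
    open ≡-Reasoning
    lo′ = χ (low? (suc k))
    lo = χ (low? k)
    F = χ (2-13? k)
    E′ = χ (2-31? k)
    ΣF = Σ< k (χ ∘ 2-13?)
    ΣE = Σ< k (χ ∘ 2-31?)

  last-f : f ≡ Σ< n (χ ∘ 2-13?)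
  last-f = trans f≡ (cong (_+ Σ< n (χ ∘ 2-13?)) (χ-no (2-13? n) (λ ((_ , n<n) , _) → n≮n n n<n)))

  last-e : e ≡ Σ< n (χ ∘ 2-31?)
  last-e = trans e≡ (cong (_+ Σ< n (χ ∘ 2-31?)) (χ-no (2-31? n) (λ ((_ , n<n) , _) → n≮n n n<n)))

  B-last : q ≡ n → B ≡ true
  B-last q≡n = dec-true (x q <? x (suc q)) (begin-strict
    x q        ≡⟨ x-q ⟩
    suc t      ≤⟨ t<n ⟩
    n          <⟨ n<1+n n ⟩
    suc n      ≡⟨ x-end ⟨
    x (suc n)  ≡⟨ cong (x ∘ suc) q≡n ⟨
    x (suc q)  ∎)
    where open ≤-Reasoning

  c-last : q ≡ n → c ≡ 0
  c-last q≡n = cong₂ (λ u b → u + χ¬ b)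
    (trans last-e (Σ<-zero n (λ {j} j<n → no-2-31 (≤-trans (<⇒≤ j<n) (≤-reflexive (sym q≡n))))))
    (B-last q≡n)

  -- By `low-balance` at the last position: after q the upward crossings of x q number f and the
  -- downward ones, with a descent out of q included, number c. They alternate, and the surplus is
  -- one exactly if the word ends below x q.
  f+low≡c : f + χ (x n <? suc t) ≡ c
  f+low≡c with m≤n⇒m<n∨m≡n q≤n
  ... | inj₁ q<n = begin
    f + χ (x n <? suc t)             ≡⟨ cong₂ (λ u v → u + χ (x n <? v)) last-f (sym x-q) ⟩
    Σ< n (χ ∘ 2-13?) + χ (low? n)    ≡⟨ +-comm _ (χ (low? n)) ⟩
    χ (low? n) + Σ< n (χ ∘ 2-13?)    ≡⟨ low-balance n q<n ≤-refl ⟩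
    χ¬ B + Σ< n (χ ∘ 2-31?)          ≡⟨ +-comm (χ¬ B) _ ⟩
    Σ< n (χ ∘ 2-31?) + χ¬ B          ≡⟨ cong (_+ χ¬ B) last-e ⟨
    c                                ∎
    where open ≡-Reasoning
  ... | inj₂ q≡n = trans (cong₂ _+_
    (trans last-f (Σ<-zero n (λ {j} j<n → no-2-13 (≤-trans (<⇒≤ j<n) (≤-reflexive (sym q≡n))))))
    (χ-no (x n <? suc t) (λ lt → <⇒≢ lt (trans (cong x (sym q≡n)) x-q))))
    (sym (c-last q≡n))

-- The statistics of a permutation

module Stats {n : ℕ} (π : 𝔖 n) where
  open FV π public using (x; x-value; x-position; x-start; x-end; x-bound; h≡crossings)

  pos : Fin n → ℕ
  pos = position π

  pos≤n : ∀ i → pos i ≤ n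
  pos≤n i = toℕ<n (π ⟨$⟩ˡ i)

  position-unique : ∀ i {j} → x j ≡ ⌜ i ⌝ → j ≡ pos i
  position-unique i {suc j} eq with j <? n
  ... | no  _   = contradiction (toℕ<n i) (≤⇒≯ (≤-pred (≤-reflexive eq)))
  ... | yes j<n = cong suc (begin
    j                                       ≡⟨ toℕ-fromℕ< j<n ⟨
    toℕ (fromℕ< j<n)                        ≡⟨ cong toℕ (Perm.inverseˡ π) ⟨
    toℕ (π ⟨$⟩ˡ (π ⟨$⟩ʳ fromℕ< j<n))
      ≡⟨ cong (λ l → toℕ (π ⟨$⟩ˡ l)) (toℕ-injective (suc-injective eq)) ⟩
    toℕ (π ⟨$⟩ˡ i)                          ∎)
    where open ≡-Reasoning

  module _ (i : Fin n) where
    open AtValue n x refl x-end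
        (toℕ i) (toℕ (π ⟨$⟩ˡ i)) (toℕ<n i) (pos≤n i) (x-position i) (position-unique i)
      using (A; B; crossings≡d+c; d≡entries; f+low≡c; B-last; c-last;
             entries-raise; entries-at-q; before⇒; after⇒)
      renaming (d to d31-2; e to e2-31; f to f2-13) public

    FV-left : left (FV-w π i) ≡ A
    FV-left = left-shape A B

    FV-right : right (FV-w π i) ≡ B
    FV-right = right-shape A B

    FV-c≡ : FV-c π i ≡ mult2-31 π (pos i) + χ¬ B
    FV-c≡ = cong (mult2-31 π (pos i) +_) (trans (χ-∈SdE (FV-w π i)) (cong χ¬ FV-right))

-- Heights, and the injectivity of ΦFV

⟦_⟧ : Bool → ℤ
⟦ b ⟧ = if b then 1ℤ else 0ℤ

-- The height change of a letter, which is 1 for N, -1 for S and 0 otherwise. Written in terms of b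
-- and a it lets heights be computed with the two Booleans alone.
δ : Letter → ℤ
δ l = ⟦ right l ⟧ ℤ.- ⟦ left l ⟧

#before-first : (w : Fin n → Letter) → ∀ l → #before w 1 l ≡ 0
#before-first {n} w l = trans (length-filter-tabulate before? id) (none w)
  where
  before? : Decidable (λ j → ⌜ j ⌝ < 1 × w j ≡ l)
  before? j = (⌜ j ⌝ <? 1) ×-dec (w j ≟ᴸ l)

  none : ∀ {m} (v : Fin m → Letter) → sum (λ j → χ ((⌜ j ⌝ <? 1) ×-dec (v j ≟ᴸ l))) ≡ 0
  none {zero}  v = refl
  none {suc m} v = none (v ∘ Fin.suc)

#before-suc : ∀ (w : Fin (suc n) → Letter) (i : Fin (suc n)) l →
  #before w (suc ⌜ i ⌝) l ≡ χ (w Fin.zero ≟ᴸ l) + #before (w ∘ Fin.suc) ⌜ i ⌝ l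
#before-suc {n} w i l = trans
  (length-filter-tabulate (λ j → (⌜ j ⌝ <? suc ⌜ i ⌝) ×-dec (w j ≟ᴸ l)) id)
  (cong (χ (w Fin.zero ≟ᴸ l) +_)
    (sym (length-filter-tabulate (λ j → (⌜ j ⌝ <? ⌜ i ⌝) ×-dec (w (Fin.suc j) ≟ᴸ l)) id)))

height-zero : (w : Fin n → Letter) → height w Fin.zero ≡ 0ℤ
height-zero w = cong₂ _⊖_ (#before-first w N) (#before-first w S)

-- Counts over `allFin` peel off their first letter, so this recursion at the front is the
-- accessible one; `height-step` follows from it by induction.
height-front : ∀ (w : Fin (suc n) → Letter) i →
  height w (Fin.suc i) ≡ δ (w Fin.zero) ℤ.+ height (w ∘ Fin.suc) i
height-front w i = begin
  height w (Fin.suc i)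
    ≡⟨ cong₂ _⊖_ (#before-suc w i N) (#before-suc w i S) ⟩
  (χN + #N) ⊖ (χS + #S)
    ≡⟨ ℤ.m-n≡m⊖n (χN + #N) (χS + #S) ⟨
  ℤ.+ (χN + #N) ℤ.- ℤ.+ (χS + #S)
    ≡⟨ cong₂ ℤ._-_ (ℤ.pos-+ χN #N) (ℤ.pos-+ χS #S) ⟩
  (ℤ.+ χN ℤ.+ ℤ.+ #N) ℤ.- (ℤ.+ χS ℤ.+ ℤ.+ #S)
    ≡⟨ solve 4 (λ a b c d → (a :+ b) :- (c :+ d) := (a :- c) :+ (b :- d)) refl
         (ℤ.+ χN) (ℤ.+ #N) (ℤ.+ χS) (ℤ.+ #S) ⟩
  (ℤ.+ χN ℤ.- ℤ.+ χS) ℤ.+ (ℤ.+ #N ℤ.- ℤ.+ #S)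
    ≡⟨ cong₂ ℤ._+_ (letter (w Fin.zero)) (ℤ.m-n≡m⊖n #N #S) ⟩
  δ (w Fin.zero) ℤ.+ height (w ∘ Fin.suc) i ∎
  where
  open ≡-Reasoning
  open ℤ.+-*-Solver
  χN = χ (w Fin.zero ≟ᴸ N)
  χS = χ (w Fin.zero ≟ᴸ S)
  #N = #before (w ∘ Fin.suc) ⌜ i ⌝ N
  #S = #before (w ∘ Fin.suc) ⌜ i ⌝ S

  letter : ∀ l → ℤ.+ χ (l ≟ᴸ N) ℤ.- ℤ.+ χ (l ≟ᴸ S) ≡ δ l
  letter N  = refl
  letter S  = refl
  letter E  = refl
  letter dE = refl

height-step : ∀ (w : Fin n → Letter) i →
  height w (Fin.suc i) ≡ height w (inject₁ i) ℤ.+ δ (w i)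
height-step w Fin.zero = begin
  height w (Fin.suc Fin.zero)                ≡⟨ height-front w Fin.zero ⟩
  δ (w Fin.zero) ℤ.+ height (w ∘ Fin.suc) Fin.zero
    ≡⟨ cong (λ u → δ (w Fin.zero) ℤ.+ u) (height-zero (w ∘ Fin.suc)) ⟩
  δ (w Fin.zero) ℤ.+ 0ℤ                      ≡⟨ ℤ.+-comm (δ (w Fin.zero)) 0ℤ ⟩
  0ℤ ℤ.+ δ (w Fin.zero)                      ≡⟨ cong (ℤ._+ δ (w Fin.zero)) (height-zero w) ⟨
  height w Fin.zero ℤ.+ δ (w Fin.zero)       ∎
  where open ≡-Reasoning
height-step w (Fin.suc i) = begin
  height w (Fin.suc (Fin.suc i))
    ≡⟨ height-front w (Fin.suc i) ⟩
  δ (w Fin.zero) ℤ.+ height (w ∘ Fin.suc) (Fin.suc i)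
    ≡⟨ cong (λ u → δ (w Fin.zero) ℤ.+ u) (height-step (w ∘ Fin.suc) i) ⟩
  δ (w Fin.zero) ℤ.+ (height (w ∘ Fin.suc) (inject₁ i) ℤ.+ δ (w (Fin.suc i)))
    ≡⟨ ℤ.+-assoc (δ (w Fin.zero)) _ _ ⟨
  δ (w Fin.zero) ℤ.+ height (w ∘ Fin.suc) (inject₁ i) ℤ.+ δ (w (Fin.suc i))
    ≡⟨ cong (ℤ._+ δ (w (Fin.suc i))) (height-front w (inject₁ i)) ⟨
  height w (inject₁ (Fin.suc i)) ℤ.+ δ (w (Fin.suc i)) ∎
  where open ≡-Reasoning

height-cong : ∀ {w v : Fin n → Letter} → (∀ i → w i ≡ v i) → ∀ i → height w i ≡ height v i
height-cong {w = w} {v} w≗v = <-weakInduction (λ i → height w i ≡ height v i)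
  (trans (height-zero w) (sym (height-zero v)))
  (λ i eq → trans (height-step w i) (trans (cong₂ ℤ._+_ eq (cong δ (w≗v i))) (sym (height-step v i))))

≈ₕ-sym : ∀ {W V : 𝔏 n} → W ≈ₕ V → V ≈ₕ W
≈ₕ-sym (w≗ , c≗) = sym ∘ w≗ , sym ∘ c≗

≈ₕ-trans : ∀ {U V W : 𝔏 n} → U ≈ₕ V → V ≈ₕ W → U ≈ₕ W
≈ₕ-trans (w≗ , c≗) (w≗′ , c≗′) = (λ i → trans (w≗ i) (w≗′ i)) , (λ i → trans (c≗ i) (c≗′ i))

inverse-cong : {π σ : 𝔖 n} → π ≈ σ → ∀ i → π ⟨$⟩ˡ i ≡ σ ⟨$⟩ˡ i
inverse-cong {π = π} {σ} π≈σ i = begin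
  π ⟨$⟩ˡ i                        ≡⟨ cong (π ⟨$⟩ˡ_) (Perm.inverseʳ σ) ⟨
  π ⟨$⟩ˡ (σ ⟨$⟩ʳ (σ ⟨$⟩ˡ i))      ≡⟨ cong (π ⟨$⟩ˡ_) (π≈σ (σ ⟨$⟩ˡ i)) ⟨
  π ⟨$⟩ˡ (π ⟨$⟩ʳ (σ ⟨$⟩ˡ i))      ≡⟨ Perm.inverseˡ π ⟩
  σ ⟨$⟩ˡ i                        ∎
  where open ≡-Reasoning

⟨⟩-cong : {π σ : 𝔖 n} → π ≈ σ → ∀ k → π ⟨ k ⟩ ≡ σ ⟨ k ⟩
⟨⟩-cong π≈σ zero = refl
⟨⟩-cong {n} π≈σ (suc k) with k <? n
... | yes k<n = cong ⌜_⌝ (π≈σ (fromℕ< k<n))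
... | no  _   = refl

mult2-31-cong : {π σ : 𝔖 n} → π ≈ σ → ∀ k → mult2-31 π k ≡ mult2-31 σ k
mult2-31-cong {n} {π} {σ} π≈σ k = begin
  mult2-31 π k                ≡⟨ #≡Σ< _ n ⟩
  Σ< n (λ j → χ (P? j (π ⟨ suc (suc j) ⟩) (π ⟨ k ⟩) (π ⟨ suc j ⟩)))
    ≡⟨ Σ<-cong n (λ {j} _ → trans
         (cong₂ (λ u v → χ (P? j u v (π ⟨ suc j ⟩))) (⟨⟩-cong π≈σ (suc (suc j))) (⟨⟩-cong π≈σ k))
         (cong (λ u → χ (P? j (σ ⟨ suc (suc j) ⟩) (σ ⟨ k ⟩) u)) (⟨⟩-cong π≈σ (suc j)))) ⟩
  Σ< n (λ j → χ (P? j (σ ⟨ suc (suc j) ⟩) (σ ⟨ k ⟩) (σ ⟨ suc j ⟩)))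
    ≡⟨ #≡Σ< _ n ⟨
  mult2-31 σ k                ∎
  where
  open ≡-Reasoning
  P? : ∀ j u v w → Dec ((k < suc j × suc j < n) × (u < v × v < w))
  P? j u v w = (k <? suc j ×-dec suc j <? n) ×-dec (u <? v ×-dec v <? w)

letterAt-cong : ∀ {x y : ℕ → ℕ} → (∀ k → x k ≡ y k) → ∀ k → letterAt x k ≡ letterAt y k
letterAt-cong x≗y k = cong₂ shape
  (cong₂ (λ u v → does (u <? v)) (x≗y (k ∸ 1)) (x≗y k))
  (cong₂ (λ u v → does (u <? v)) (x≗y k) (x≗y (suc k)))

ΦFV-cong : {π σ : 𝔖 n} → π ≈ σ → ΦFV π ≈ₕ ΦFV σ
ΦFV-cong {π = π} {σ} π≈σ = w≗ , λ i → cong ℤ.+_ (cong₂ (λ u l → u + χ (l ∈SdE?))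
    (trans (mult2-31-cong {π = π} {σ} π≈σ (position π i)) (cong (mult2-31 σ) (position≡ i))) (w≗ i))
  where
  position≡ : ∀ i → position π i ≡ position σ i
  position≡ i = cong ⌜_⌝ (inverse-cong {π = π} {σ} π≈σ i)

  w≗ : ∀ i → FV-w π i ≡ FV-w σ i
  w≗ i = trans (letterAt-cong (⟨⟩-cong {π = π} {σ} π≈σ) (position π i))
               (cong (letterAt (σ ⟨_⟩)) (position≡ i))

h≡d+c : ∀ (π : 𝔖 n) i → height (FV-w π) (inject₁ i) ≡ ℤ.+ (Stats.d31-2 π i + FV-c π i)
h≡d+c π i = trans (h≡crossings i) (cong ℤ.+_
  (trans (crossings≡d+c i) (cong (d31-2 i +_) (sym (FV-c≡ i)))))
  where open Stats π

-- The order of the positions of i < j is read off the entries at level j − 1.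
before-transfer : ∀ (π σ : 𝔖 n) {i j} → let module P = Stats π; module Q = Stats σ in
  toℕ i < toℕ j → P.d31-2 j ≡ Q.d31-2 j →
  entries P.x (toℕ j) (P.pos i) ≡ entries Q.x (toℕ j) (Q.pos i) →
  P.pos i < P.pos j → Q.pos i < Q.pos j
before-transfer π σ {i} {j} i<j d≡ K≡ before with <-cmp (position σ i) (position σ j)
... | tri< lt _ _ = lt
... | tri≈ _ eq _ = contradiction
  (suc-injective (trans (sym (Stats.x-position σ i)) (trans (cong (σ ⟨_⟩) eq) (Stats.x-position σ j))))
  (<⇒≢ i<j)
... | tri> _ _ gt = contradiction
  (begin-strict
    Stats.d31-2 σ j
      <⟨ Stats.after⇒ σ j gt (≤-trans (≤-reflexive (Stats.x-position σ i)) i<j) ⟩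
    entries (σ ⟨_⟩) (toℕ j) (position σ i)    ≡⟨ K≡ ⟨
    entries (π ⟨_⟩) (toℕ j) (position π i)    ≤⟨ Stats.before⇒ π j before ⟩
    Stats.d31-2 π j                           ≡⟨ d≡ ⟩
    Stats.d31-2 σ j                           ∎)
  (n≮n _)
  where open ≤-Reasoning

sum-below : ∀ (l : Fin n) → sum {n} (λ k → χ (⌜ k ⌝ <? ⌜ l ⌝)) ≡ toℕ l
sum-below {suc n} Fin.zero = none n
  where
  none : ∀ m → sum {m} (λ k → 0) ≡ 0
  none zero    = refl
  none (suc m) = none m
sum-below {suc n} (Fin.suc l) = cong suc (sum-below {n} l)

-- With this a permutation is determined by the relative order of its positions, which is all that
-- the induction below compares.
position-rank : ∀ (π : 𝔖 n) i → toℕ (π ⟨$⟩ˡ i) ≡ sum {n} (λ j → χ (position π j <? position π i))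
position-rank {n} π i = sym (begin
  sum {n} (λ j → χ (position π j <? position π i))
    ≡⟨ sum-permute (λ j → χ (position π j <? position π i)) π ⟩
  sum {n} (λ k → χ (position π (π ⟨$⟩ʳ k) <? position π i))
    ≡⟨ sum-cong-≗ {n} (λ k → cong (λ l → χ (⌜ l ⌝ <? position π i)) (Perm.inverseˡ π {k})) ⟩
  sum {n} (λ k → χ (⌜ k ⌝ <? position π i))
    ≡⟨ sum-below {n} (π ⟨$⟩ˡ i) ⟩
  toℕ (π ⟨$⟩ˡ i) ∎)
  where open ≡-Reasoning

position-injective : ∀ (π : 𝔖 n) {i j} → position π i ≡ position π j → i ≡ j
position-injective π {i} {j} eq = toℕ-injective (suc-injective
  (trans (sym (Stats.x-position π i)) (trans (cong (π ⟨_⟩) eq) (Stats.x-position π j))))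

ΦFV-injective : {π σ : 𝔖 n} → ΦFV π ≈ₕ ΦFV σ → π ≈ σ
ΦFV-injective {n} {π} {σ} (w≗ , c≗) k = begin
  π ⟨$⟩ʳ k                          ≡⟨ Perm.inverseʳ σ ⟨
  σ ⟨$⟩ʳ (σ ⟨$⟩ˡ (π ⟨$⟩ʳ k))        ≡⟨ cong (σ ⟨$⟩ʳ_) (toℕ-injective (inverses≡ (π ⟨$⟩ʳ k))) ⟨
  σ ⟨$⟩ʳ (π ⟨$⟩ˡ (π ⟨$⟩ʳ k))        ≡⟨ cong (σ ⟨$⟩ʳ_) (Perm.inverseˡ π) ⟩
  σ ⟨$⟩ʳ k                          ∎
  where
  open ≡-Reasoning
  module P = Stats π
  module Q = Stats σ

  A≡ : ∀ i → P.A i ≡ Q.A i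
  A≡ i = trans (sym (P.FV-left i)) (trans (cong left (w≗ i)) (Q.FV-left i))

  B≡ : ∀ i → P.B i ≡ Q.B i
  B≡ i = trans (sym (P.FV-right i)) (trans (cong right (w≗ i)) (Q.FV-right i))

  d≡ : ∀ i → P.d31-2 i ≡ Q.d31-2 i
  d≡ i = +-cancelʳ-≡ (FV-c π i) (P.d31-2 i) (Q.d31-2 i) (ℤ.+-injective (begin
    ℤ.+ (P.d31-2 i + FV-c π i)     ≡⟨ h≡d+c π i ⟨
    height (FV-w π) (inject₁ i)    ≡⟨ height-cong w≗ (inject₁ i) ⟩
    height (FV-w σ) (inject₁ i)    ≡⟨ h≡d+c σ i ⟩
    ℤ.+ (Q.d31-2 i + FV-c σ i)     ≡⟨ cong (λ u → ℤ.+ (Q.d31-2 i + u)) (ℤ.+-injective (c≗ i)) ⟨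
    ℤ.+ (Q.d31-2 i + FV-c π i)     ∎))

  -- The invariant of an induction on t. At level `toℕ j` it decides for every smaller i whether i
  -- stands before j, and this order is what `entries-raise` needs to reach the next level.
  SameEntries : ℕ → Set
  SameEntries t = ∀ i → toℕ i < t → entries P.x t (P.pos i) ≡ entries Q.x t (Q.pos i)

  after-transfer : ∀ {i j} → SameEntries (toℕ j) → toℕ i < toℕ j → P.pos j < P.pos i → Q.pos j < Q.pos i
  after-transfer {i} {j} same i<j after with <-cmp (Q.pos j) (Q.pos i)
  ... | tri< lt _ _ = lt
  ... | tri≈ _ eq _ = contradiction (cong toℕ (sym (position-injective σ eq))) (<⇒≢ i<j)
  ... | tri> _ _ gt = contradiction
    (before-transfer σ π i<j (sym (d≡ j)) (sym (same i i<j)) gt) (<⇒≯ after)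

  after-transfer⁻ : ∀ {i j} → SameEntries (toℕ j) → toℕ i < toℕ j → Q.pos j < Q.pos i → P.pos j < P.pos i
  after-transfer⁻ {i} {j} same i<j after with <-cmp (P.pos j) (P.pos i)
  ... | tri< lt _ _ = lt
  ... | tri≈ _ eq _ = contradiction (cong toℕ (sym (position-injective π eq))) (<⇒≢ i<j)
  ... | tri> _ _ gt = contradiction
    (before-transfer π σ i<j (d≡ j) (same i i<j) gt) (<⇒≯ after)

  same-step : ∀ j → SameEntries (toℕ j) → SameEntries (suc (toℕ j))
  same-step j same i (s≤s i≤j) with m≤n⇒m<n∨m≡n i≤j
  ... | inj₂ i≡j rewrite toℕ-injective i≡j = begin
    entries P.x (suc (toℕ j)) (P.pos j)   ≡⟨ P.entries-at-q j ⟩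
    P.d31-2 j + χ¬ (P.A j)                ≡⟨ cong₂ (λ u b → u + χ¬ b) (d≡ j) (A≡ j) ⟩
    Q.d31-2 j + χ¬ (Q.A j)                ≡⟨ Q.entries-at-q j ⟨
    entries Q.x (suc (toℕ j)) (Q.pos j)   ∎
  ... | inj₁ i<j = +-cancelʳ-≡ (if does (P.pos j <? P.pos i) then χ¬ (P.B j) else 0) _ _ (begin
    entries P.x (suc (toℕ j)) (P.pos i) + (if does (P.pos j <? P.pos i) then χ¬ (P.B j) else 0)
      ≡⟨ P.entries-raise j (P.pos i) ⟩
    entries P.x (toℕ j) (P.pos i) + (if does (P.pos j <? suc (P.pos i)) then χ¬ (P.A j) else 0)
      ≡⟨ cong₂ _+_ (same i i<j) (cong₂ (λ b a → if b then χ¬ a else 0) after≤≡ (A≡ j)) ⟩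
    entries Q.x (toℕ j) (Q.pos i) + (if does (Q.pos j <? suc (Q.pos i)) then χ¬ (Q.A j) else 0)
      ≡⟨ Q.entries-raise j (Q.pos i) ⟨
    entries Q.x (suc (toℕ j)) (Q.pos i) + (if does (Q.pos j <? Q.pos i) then χ¬ (Q.B j) else 0)
      ≡⟨ cong₂ (λ b a → entries Q.x (suc (toℕ j)) (Q.pos i) + (if b then χ¬ a else 0)) after≡ (B≡ j) ⟨
    entries Q.x (suc (toℕ j)) (Q.pos i) + (if does (P.pos j <? P.pos i) then χ¬ (P.B j) else 0) ∎)
    where
    after≡ : does (P.pos j <? P.pos i) ≡ does (Q.pos j <? Q.pos i)
    after≡ = does-⇔ (mk⇔ (after-transfer same i<j) (after-transfer⁻ same i<j))
                    (P.pos j <? P.pos i) (Q.pos j <? Q.pos i)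

    strict : ∀ (τ : 𝔖 n) → position τ j < suc (position τ i) → position τ j < position τ i
    strict τ (s≤s le) = ≤∧≢⇒< le (λ eq → <⇒≢ i<j (cong toℕ (sym (position-injective τ eq))))

    after≤≡ : does (P.pos j <? suc (P.pos i)) ≡ does (Q.pos j <? suc (Q.pos i))
    after≤≡ = does-⇔ (mk⇔ (m≤n⇒m≤1+n ∘ after-transfer same i<j ∘ strict π)
                          (m≤n⇒m≤1+n ∘ after-transfer⁻ same i<j ∘ strict σ))
                     (P.pos j <? suc (P.pos i)) (Q.pos j <? suc (Q.pos i))

  same-entries : ∀ j → SameEntries (toℕ j)
  same-entries = <-weakInduction (SameEntries ∘ toℕ) (λ _ ())
    (λ j same → same-step j (subst SameEntries (toℕ-inject₁ j) same))

  same : ∀ j → SameEntries (toℕ j)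
  same j = subst SameEntries (toℕ-inject₁ j) (same-entries (inject₁ j))

  order⇒ : ∀ {i j} → P.pos i < P.pos j → Q.pos i < Q.pos j
  order⇒ {i} {j} lt with <-cmp (toℕ i) (toℕ j)
  ... | tri< i<j _ _ = before-transfer π σ i<j (d≡ j) (same j i i<j) lt
  ... | tri≈ _ i≡j _ = contradiction (cong P.pos (toℕ-injective i≡j)) (<⇒≢ lt)
  ... | tri> _ _ j<i = after-transfer (same i) j<i lt

  order⇐ : ∀ {i j} → Q.pos i < Q.pos j → P.pos i < P.pos j
  order⇐ {i} {j} lt with <-cmp (toℕ i) (toℕ j)
  ... | tri< i<j _ _ = before-transfer σ π i<j (sym (d≡ j)) (sym (same j i i<j)) lt
  ... | tri≈ _ i≡j _ = contradiction (cong Q.pos (toℕ-injective i≡j)) (<⇒≢ lt)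
  ... | tri> _ _ j<i = after-transfer⁻ (same i) j<i lt

  inverses≡ : ∀ i → toℕ (π ⟨$⟩ˡ i) ≡ toℕ (σ ⟨$⟩ˡ i)
  inverses≡ i = begin
    toℕ (π ⟨$⟩ˡ i)                            ≡⟨ position-rank π i ⟩
    sum {n} (λ j → χ (P.pos j <? P.pos i))
      ≡⟨ sum-cong-≗ {n} (λ j → χ-cong (P.pos j <? P.pos i) (Q.pos j <? Q.pos i) order⇒ order⇐) ⟩
    sum {n} (λ j → χ (Q.pos j <? Q.pos i))        ≡⟨ position-rank σ i ⟨
    toℕ (σ ⟨$⟩ˡ i)                            ∎

-- The involution ξ

right⇒NE : ∀ {l} → right l ≡ true → l ∈NE
right⇒NE {N} _ = inj₁ refl
right⇒NE {E} _ = inj₂ refl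

NE⇒right : ∀ {l} → l ∈NE → right l ≡ true
NE⇒right (inj₁ refl) = refl
NE⇒right (inj₂ refl) = refl

¬right⇒SdE : ∀ {l} → right l ≡ false → l ∈SdE
¬right⇒SdE {S}  _ = inj₁ refl
¬right⇒SdE {dE} _ = inj₂ refl

SdE⇒¬right : ∀ {l} → l ∈SdE → right l ≡ false
SdE⇒¬right (inj₁ refl) = refl
SdE⇒¬right (inj₂ refl) = refl

letter-ext : ∀ {l l′} → left l ≡ left l′ → right l ≡ right l′ → l ≡ l′
letter-ext {l} {l′} a≡ b≡ =
  trans (sym (shape-left-right l)) (trans (cong₂ shape a≡ b≡) (shape-left-right l′))

⌜opposite⌝ : ∀ (j : Fin n) → ⌜ opposite j ⌝ + ⌜ j ⌝ ≡ suc n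
⌜opposite⌝ {n} j = cong suc (trans (cong (_+ ⌜ j ⌝) (opposite-prop j)) (m∸n+n≡m (toℕ<n j)))

suc∸⌜⌝ : ∀ (j : Fin n) → suc n ∸ ⌜ j ⌝ ≡ ⌜ opposite j ⌝
suc∸⌜⌝ {n} j = trans (cong (_∸ ⌜ j ⌝) (sym (⌜opposite⌝ j))) (m+n∸n≡m ⌜ opposite j ⌝ ⌜ j ⌝)

opposite-< : ∀ {i j : Fin n} → ⌜ i ⌝ < ⌜ j ⌝ → ⌜ opposite j ⌝ < ⌜ opposite i ⌝
opposite-< {n} {i} {j} i<j = +-cancelʳ-< ⌜ i ⌝ ⌜ opposite j ⌝ ⌜ opposite i ⌝ (begin-strict
  ⌜ opposite j ⌝ + ⌜ i ⌝  <⟨ +-monoʳ-< ⌜ opposite j ⌝ i<j ⟩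
  ⌜ opposite j ⌝ + ⌜ j ⌝  ≡⟨ ⌜opposite⌝ j ⟩
  suc n                   ≡⟨ ⌜opposite⌝ i ⟨
  ⌜ opposite i ⌝ + ⌜ i ⌝  ∎)
  where open ≤-Reasoning

opposite-<ˡ : ∀ {i j : Fin n} → ⌜ opposite i ⌝ < ⌜ j ⌝ → ⌜ opposite j ⌝ < ⌜ i ⌝
opposite-<ˡ {i = i} lt = subst (λ k → _ < ⌜ k ⌝) (opposite-involutive i) (opposite-< lt)

opposite-<ʳ : ∀ {i j : Fin n} → ⌜ j ⌝ < ⌜ opposite i ⌝ → ⌜ i ⌝ < ⌜ opposite j ⌝
opposite-<ʳ {i = i} lt = subst (λ k → ⌜ k ⌝ < _) (opposite-involutive i) (opposite-< lt)

⌜⌝-injective : ∀ {i j : Fin n} → ⌜ i ⌝ ≡ ⌜ j ⌝ → i ≡ j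
⌜⌝-injective = toℕ-injective ∘ suc-injective

-- The last zero of c

IsLastZero : 𝔏 n → Fin n → Set
IsLastZero W μ = c μ ≡ 0ℤ × ∀ j → ⌜ μ ⌝ < ⌜ j ⌝ → c j ≢ 0ℤ
  where open 𝔏 W

module _ (W : 𝔏 n) where
  open 𝔏 W

  zeros = map ⌜_⌝ (filter (λ i → c i ℤ.≟ 0ℤ) (allFin n))

  ∈-zeros⁺ : ∀ i → c i ≡ 0ℤ → ⌜ i ⌝ ∈ zeros
  ∈-zeros⁺ i ci≡0 = ∈-map∘filter⁺ ⌜_⌝ (λ i → c i ℤ.≟ 0ℤ) (i , ∈-allFin i , refl , ci≡0)

  cs-lastZero : ∀ {μ} → IsLastZero W μ → cs W ≡ ⌜ μ ⌝
  cs-lastZero {μ} (cμ≡0 , last) = ≤-antisym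
    (max≤v⁺ {⊥ = 0} {xs = zeros} z≤n (All.tabulate bounded))
    (All.lookup (xs≤max 0 zeros) (∈-zeros⁺ μ cμ≡0))
    where
    bounded : ∀ {k} → k ∈ zeros → k ≤ ⌜ μ ⌝
    bounded k∈ with ∈-map∘filter⁻ ⌜_⌝ (λ i → c i ℤ.≟ 0ℤ) {f = ⌜_⌝} {xs = allFin n} k∈
    ... | j , _ , refl , cj≡0 = ≮⇒≥ (λ lt → last j lt cj≡0)

c-bounds : ∀ (W : 𝔏 n) i → let open 𝔏 W in 0ℤ ℤ.≤ c i × c i ℤ.≤ h i
c-bounds W i with right (𝔏.w W i) in eq
... | true  = 𝔏.c-NE W i (right⇒NE eq)
... | false with 𝔏.c-SdE W i (¬right⇒SdE eq)
...   | 1≤c , c≤h = ℤ.≤-trans (ℤ.+≤+ z≤n) 1≤c , c≤h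

opaque
  -- The maximum is not the default value 0, because 0 ≤ c₁ ≤ h₁ = 0 puts 1 among the zeros.
  ∃-lastZero : ∀ (W : 𝔏 (suc n)) → ∃ (IsLastZero W)
  ∃-lastZero {n} W with argmax-sel id 0 (zeros W)
  ... | inj₁ max≡0 = contradiction
    (≤-trans (All.lookup (xs≤max 0 (zeros W)) (∈-zeros⁺ W Fin.zero c₁≡0)) (≤-reflexive max≡0)) (n≮n 0)
    where
    open 𝔏 W
    c₁≡0 : c Fin.zero ≡ 0ℤ
    c₁≡0 = ℤ.≤-antisym (ℤ.≤-trans (proj₂ (c-bounds W Fin.zero)) (ℤ.≤-reflexive (height-zero w)))
                       (proj₁ (c-bounds W Fin.zero))
  ... | inj₂ max∈ with ∈-map∘filter⁻ ⌜_⌝ (λ i → 𝔏.c W i ℤ.≟ 0ℤ) {f = ⌜_⌝} {xs = allFin (suc n)} max∈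
  ...   | μ , _ , max≡μ , cμ≡0 = μ , cμ≡0 , λ j μ<j cj≡0 →
    <⇒≱ μ<j (≤-trans (All.lookup (xs≤max 0 (zeros W)) (∈-zeros⁺ W j cj≡0)) (≤-reflexive max≡μ))

  side : ∀ (μ i : Fin n) → Tri (⌜ i ⌝ < ⌜ μ ⌝) (⌜ i ⌝ ≡ ⌜ μ ⌝) (⌜ i ⌝ > ⌜ μ ⌝)
  side μ i = <-cmp ⌜ i ⌝ ⌜ μ ⌝

1≤-of : ∀ {z} → 0ℤ ℤ.≤ z → z ≢ 0ℤ → 1ℤ ℤ.≤ z
1≤-of {ℤ.+ zero}  _ z≢0 = contradiction refl z≢0
1≤-of {ℤ.+ suc k} _ _   = ℤ.+≤+ (s≤s z≤n)

-- The difference g_j − h_i for i = n + 1 − j, from the comparison of i with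
-- cs(W) and the right ascent at i.
adjust : ∀ {p q r} {A : Set p} {B : Set q} {C : Set r} → Tri A B C → Bool → ℤ
adjust (tri< _ _ _) b = ⟦ b ⟧
adjust (tri≈ _ _ _) b = 0ℤ
adjust (tri> _ _ _) b = ⟦ b ⟧ ℤ.- 1ℤ

-- The right ascents of ξ(W). The case of cs(W), which the condition on letters leaves open, is
-- settled by c = 0 at the reflected place: this excludes S and dE.
flipped : ∀ {p q r} {A : Set p} {B : Set q} {C : Set r} → Tri A B C → Bool → Bool
flipped (tri< _ _ _) b = not b
flipped (tri≈ _ _ _) b = true
flipped (tri> _ _ _) b = not b

-- Read backwards, the right ascents of ξ(W) are the complements of those of W
-- (except at cs(W)), and so are the left ascents, shifted by one place.
previousLeft : (Fin n → Letter) → Fin n → Bool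
-- The default for the missing letter is chosen so that the path of ξ(W) ends at height 0, see
-- `g-end`.
previousLeft w Fin.zero    = false
previousLeft w (Fin.suc i) = left (w (inject₁ i))

ξ-letter : (Fin n → Letter) → Fin n → Fin n → Letter
ξ-letter w μ i = shape (not (previousLeft w i)) (flipped (side μ i) (right (w i)))

shift : (Fin n → Letter) → Fin n → Fin n → ℤ
shift w μ i = adjust (side μ i) (right (w i))

opposite-inject₁ : ∀ (i : Fin n) → opposite (inject₁ i) ≡ Fin.suc (opposite i)
opposite-inject₁ Fin.zero    = refl
opposite-inject₁ (Fin.suc i) = cong inject₁ (opposite-inject₁ i)

-- The construction of ξ(W)

module Reversal {n : ℕ} (W : 𝔏 (suc n)) where
  open 𝔏 W

  μ : Fin (suc n)
  μ = proj₁ (∃-lastZero W)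

  lastZero : IsLastZero W μ
  lastZero = proj₂ (∃-lastZero W)

  cμ≡0 : c μ ≡ 0ℤ
  cμ≡0 = proj₁ lastZero

  c≥0 : ∀ i → 0ℤ ℤ.≤ c i
  c≥0 i = proj₁ (c-bounds W i)

  c≤h : ∀ i → c i ℤ.≤ h i
  c≤h i = proj₂ (c-bounds W i)

  c≥1 : ∀ {i} → ⌜ μ ⌝ < ⌜ i ⌝ → 1ℤ ℤ.≤ c i
  c≥1 {i} μ<i = 1≤-of (c≥0 i) (proj₂ lastZero i μ<i)

  c≥1′ : ∀ {i} → right (w i) ≡ false → 1ℤ ℤ.≤ c i
  c≥1′ {i} eq = proj₁ (c-SdE i (¬right⇒SdE eq))

  right-μ : right (w μ) ≡ true
  right-μ with right (w μ) in eq
  ... | true  = refl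
  ... | false = contradiction (ℤ.≤-trans (c≥1′ eq) (ℤ.≤-reflexive cμ≡0)) λ { (ℤ.+≤+ ()) }

  v : Fin (suc n) → Letter
  v j = ξ-letter w μ (opposite j)

  g′ : Fin (suc n) → ℤ
  g′ i = h i ℤ.+ shift w μ i

  -- Writing s for `shift`, the height recursion of ξ(W), which goes from i to i - 1, reduces to
  -- s_{i-1} = [b_{i-1}] + weight_i. The weight is 0 up to cs(W) and -1 after it.
  weight : ∀ {p q r} {A : Set p} {B : Set q} {C : Set r} → Tri A B C → Bool → ℤ
  weight t b = adjust t b ℤ.+ (⟦ flipped t b ⟧ ℤ.- 1ℤ)

  weight-< : ∀ b → ⟦ b ⟧ ℤ.+ (⟦ not b ⟧ ℤ.- 1ℤ) ≡ 0ℤ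
  weight-< true  = refl
  weight-< false = refl

  weight-> : ∀ b → (⟦ b ⟧ ℤ.- 1ℤ) ℤ.+ (⟦ not b ⟧ ℤ.- 1ℤ) ≡ ℤ.- 1ℤ
  weight-> true  = refl
  weight-> false = refl

  -- Neighbours admit only four combinations of sides. In passing cs(W) the weight -1 is cancelled
  -- by the right ascent at cs(W).
  shift-step : ∀ i →
    ⟦ right (w (inject₁ i)) ⟧ ℤ.+ weight (side μ (Fin.suc i)) (right (w (Fin.suc i)))
      ≡ shift w μ (inject₁ i)
  shift-step i with side μ (Fin.suc i) | side μ (inject₁ i)
  ... | tri< _ _ _ | tri< _ _ _ = trans
    (cong (λ u → ⟦ right (w (inject₁ i)) ⟧ ℤ.+ u) (weight-< (right (w (Fin.suc i))))) (ℤ.+-identityʳ _)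
  ... | tri≈ _ _ _ | tri< _ _ _ = ℤ.+-identityʳ _
  ... | tri> _ _ _ | tri≈ _ eq _ = trans
    (cong₂ ℤ._+_ (cong ⟦_⟧ (trans (cong (right ∘ w) (⌜⌝-injective eq)) right-μ))
                 (weight-> (right (w (Fin.suc i))))) refl
  ... | tri> _ _ _ | tri> _ _ _ =
    cong (λ u → ⟦ right (w (inject₁ i)) ⟧ ℤ.+ u) (weight-> (right (w (Fin.suc i))))
  ... | tri< lt _ _ | tri≈ _ eq _ = contradiction
    (≤-trans (≤-reflexive (sym eq)) (≤-reflexive (cong suc (toℕ-inject₁ i)))) (<⇒≱ (<-trans (n<1+n _) lt))
  ... | tri< lt _ _ | tri> _ _ gt = contradiction
    (≤-trans (n≤1+n _) (≤-trans gt (≤-reflexive (cong suc (toℕ-inject₁ i))))) (<⇒≱ (<-trans (n<1+n _) lt))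
  ... | tri≈ _ eq _ | tri≈ _ eq′ _ = contradiction
    (trans eq (trans (sym eq′) (cong suc (toℕ-inject₁ i)))) 1+n≢n
  ... | tri≈ _ eq _ | tri> _ _ gt = contradiction
    (≤-trans gt (≤-trans (≤-reflexive (cong suc (toℕ-inject₁ i))) (n≤1+n _))) (≤⇒≯ (≤-reflexive eq))
  ... | tri> _ _ gt | tri< lt _ _ = contradiction
    (≤-trans (s≤s (≤-reflexive (cong suc (sym (toℕ-inject₁ i))))) lt) (<⇒≱ gt)

  weight-≤ : ∀ i → ⌜ i ⌝ ≤ ⌜ μ ⌝ → weight (side μ i) (right (w i)) ≡ 0ℤ
  weight-≤ i i≤μ with side μ i
  ... | tri< _ _ _  = weight-< (right (w i))
  ... | tri≈ _ _ _  = refl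
  ... | tri> _ _ gt = contradiction i≤μ (<⇒≱ gt)

  δ-v : ∀ i → δ (ξ-letter w μ i) ≡
    (⟦ flipped (side μ i) (right (w i)) ⟧ ℤ.- 1ℤ) ℤ.+ ⟦ previousLeft w i ⟧
  δ-v i = trans (cong₂ (λ b a → ⟦ b ⟧ ℤ.- ⟦ a ⟧)
      (right-shape (not (previousLeft w i)) b′) (left-shape (not (previousLeft w i)) b′))
    (complement ⟦ b′ ⟧ (previousLeft w i))
    where
    b′ = flipped (side μ i) (right (w i))
    complement : ∀ z a → z ℤ.- ⟦ not a ⟧ ≡ (z ℤ.- 1ℤ) ℤ.+ ⟦ a ⟧
    complement z true  = trans (ℤ.+-identityʳ z) (sym (trans (ℤ.+-assoc z (ℤ.- 1ℤ) 1ℤ) (ℤ.+-identityʳ z)))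
    complement z false = sym (ℤ.+-identityʳ _)

  h-last : h (fromℕ n) ≡ ⟦ left (w (fromℕ n)) ⟧ ℤ.- ⟦ right (w (fromℕ n)) ⟧
  h-last = begin
    h (fromℕ n)
      ≡⟨ solve 3 (λ H a b → H := (H :+ (b :- a)) :+ (a :- b)) refl (h (fromℕ n)) a b ⟩
    (h (fromℕ n) ℤ.+ (b ℤ.- a)) ℤ.+ (a ℤ.- b)
      ≡⟨ cong (ℤ._+ (a ℤ.- b)) (trans (sym (height-step w (fromℕ n))) (Is2Motzkin.height-end motzkin)) ⟩
    0ℤ ℤ.+ (a ℤ.- b)                   ≡⟨ ℤ.+-identityˡ (a ℤ.- b) ⟩
    a ℤ.- b                            ∎
    where
    open ≡-Reasoning
    open ℤ.+-*-Solver using (solve; _:+_; _:-_; _:=_)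
    a = ⟦ left (w (fromℕ n)) ⟧
    b = ⟦ right (w (fromℕ n)) ⟧

  -- Without a left ascent the last letter would have h = -[b], against 0 ≤ c ≤ h if b holds and 1 ≤
  -- c ≤ h if not. So h = 1 - [b]: this is 0 at cs(W), where b holds, and it is 1 after cs(W), where
  -- c ≥ 1, and then the shift is -1.
  g-first : g′ (fromℕ n) ≡ 0ℤ
  g-first = by-cases (side μ last) (left (w last)) (right (w last)) refl h-last
    where
    last = fromℕ n

    by-cases : (t : Tri (⌜ last ⌝ < ⌜ μ ⌝) (⌜ last ⌝ ≡ ⌜ μ ⌝) (⌜ last ⌝ > ⌜ μ ⌝)) → ∀ a b →
      right (w last) ≡ b → h last ≡ ⟦ a ⟧ ℤ.- ⟦ b ⟧ → h last ℤ.+ adjust t b ≡ 0ℤ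
    by-cases (tri< lt _ _) _ _ _ _ = contradiction (toℕ≤pred[n] μ)
      (<⇒≱ (≤-trans (s≤s (≤-reflexive (sym (toℕ-fromℕ n)))) (≤-pred lt)))
    by-cases (tri≈ _ eq _) _ false b≡ _ =
      contradiction (trans (sym b≡) (trans (cong (right ∘ w) (⌜⌝-injective eq)) right-μ)) λ ()
    by-cases (tri≈ _ _ _) true true _ h≡ rewrite h≡ = refl
    by-cases (tri≈ _ _ _) false true _ h≡ =
      contradiction (subst (0ℤ ℤ.≤_) h≡ (ℤ.≤-trans (c≥0 last) (c≤h last))) λ ()
    by-cases (tri> _ _ _) true false _ h≡ rewrite h≡ = refl
    by-cases (tri> _ _ gt) false false _ h≡ =
      contradiction (subst (1ℤ ℤ.≤_) h≡ (ℤ.≤-trans (c≥1 gt) (c≤h last))) λ { (ℤ.+≤+ ()) }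
    by-cases (tri> _ _ gt) true true _ h≡ =
      contradiction (subst (1ℤ ℤ.≤_) h≡ (ℤ.≤-trans (c≥1 gt) (c≤h last))) λ { (ℤ.+≤+ ()) }
    by-cases (tri> _ _ gt) false true _ h≡ =
      contradiction (subst (1ℤ ℤ.≤_) h≡ (ℤ.≤-trans (c≥1 gt) (c≤h last))) λ ()

  g≡ : ∀ j → height v (inject₁ j) ≡ g′ (opposite j)
  g≡ = <-weakInduction (λ j → height v (inject₁ j) ≡ g′ (opposite j))
    (trans (height-zero v) (sym g-first)) next
    where
    open ≡-Reasoning
    open ℤ.+-*-Solver using (solve; _:+_; _:-_; _:=_)
    next : ∀ k → height v (inject₁ (inject₁ k)) ≡ g′ (opposite (inject₁ k)) →
           height v (inject₁ (Fin.suc k)) ≡ g′ (inject₁ (opposite k))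
    next k ih = begin
      height v (Fin.suc (inject₁ k))
        ≡⟨ height-step v (inject₁ k) ⟩
      height v (inject₁ (inject₁ k)) ℤ.+ δ (v (inject₁ k))
        ≡⟨ cong₂ ℤ._+_ ih refl ⟩
      g′ (opposite (inject₁ k)) ℤ.+ δ (ξ-letter w μ (opposite (inject₁ k)))
        ≡⟨ cong (λ i → g′ i ℤ.+ δ (ξ-letter w μ i)) (opposite-inject₁ k) ⟩
      (h (Fin.suc o) ℤ.+ s) ℤ.+ δ (ξ-letter w μ (Fin.suc o))
        ≡⟨ cong₂ (λ u d → (u ℤ.+ s) ℤ.+ d) (height-step w (inject₁ o)) (δ-v (Fin.suc o)) ⟩
      ((h (inject₁ o) ℤ.+ (b ℤ.- a)) ℤ.+ s) ℤ.+ (b′ ℤ.+ a)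
        ≡⟨ solve 5 (λ H b a s b′ → ((H :+ (b :- a)) :+ s) :+ (b′ :+ a) := H :+ (b :+ (s :+ b′))) refl
             (h (inject₁ o)) b a s b′ ⟩
      h (inject₁ o) ℤ.+ (b ℤ.+ (s ℤ.+ b′))
        ≡⟨ cong (λ u → h (inject₁ o) ℤ.+ u) (shift-step o) ⟩
      g′ (inject₁ o) ∎
      where
      o = opposite k
      s = shift w μ (Fin.suc o)
      b = ⟦ right (w (inject₁ o)) ⟧
      a = ⟦ left (w (inject₁ o)) ⟧
      b′ = ⟦ flipped (side μ (Fin.suc o)) (right (w (Fin.suc o))) ⟧ ℤ.- 1ℤ

  c′ : Fin (suc n) → ℤ
  c′ i = c i ℤ.+ shift w μ i

  right-v : ∀ j → right (v j) ≡ flipped (side μ (opposite j)) (right (w (opposite j)))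
  right-v j = right-shape (not (previousLeft w (opposite j))) _

  -- The shift is negative only after cs(W), where c is at least 1.
  c′≥0 : ∀ i → flipped (side μ i) (right (w i)) ≡ true → 0ℤ ℤ.≤ c′ i
  c′≥0 i eq with side μ i | right (w i)
  ... | tri< _ _ _ | false = ℤ.+-mono-≤ (c≥0 i) (ℤ.≤-refl {0ℤ})
  ... | tri≈ _ _ _ | _     = ℤ.+-mono-≤ (c≥0 i) (ℤ.≤-refl {0ℤ})
  ... | tri> _ _ gt | false = ℤ.+-mono-≤ (c≥1 gt) (ℤ.≤-refl {ℤ.- 1ℤ})

  -- Here b holds: before cs(W) the shift contributes 1, and after it c itself is at least 1.
  c′≥1 : ∀ i → flipped (side μ i) (right (w i)) ≡ false → 1ℤ ℤ.≤ c′ i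
  c′≥1 i eq with side μ i | right (w i)
  ... | tri< _ _ _ | true  = ℤ.+-mono-≤ (c≥0 i) (ℤ.≤-refl {1ℤ})
  ... | tri> _ _ gt | true = ℤ.+-mono-≤ (c≥1 gt) (ℤ.≤-refl {0ℤ})

  c′≤g : ∀ j → c′ (opposite j) ℤ.≤ height v (inject₁ j)
  c′≤g j = ℤ.≤-trans (ℤ.+-monoˡ-≤ (shift w μ (opposite j)) (c≤h (opposite j)))
                     (ℤ.≤-reflexive (sym (g≡ j)))

  g≥0 : ∀ j → 0ℤ ℤ.≤ height v (inject₁ j)
  g≥0 j = by-cases _ refl
    where
    by-cases : ∀ b → flipped (side μ (opposite j)) (right (w (opposite j))) ≡ b →
               0ℤ ℤ.≤ height v (inject₁ j)
    by-cases true  eq = ℤ.≤-trans (c′≥0 (opposite j) eq) (c′≤g j)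
    by-cases false eq = ℤ.≤-trans (ℤ.≤-trans (ℤ.+≤+ z≤n) (c′≥1 (opposite j) eq)) (c′≤g j)

  g-end : height v (fromℕ (suc n)) ≡ 0ℤ
  g-end = begin
    height v (Fin.suc (fromℕ n))
      ≡⟨ height-step v (fromℕ n) ⟩
    height v (inject₁ (fromℕ n)) ℤ.+ δ (v (fromℕ n))
      ≡⟨ cong₂ ℤ._+_ (g≡ (fromℕ n)) refl ⟩
    g′ (opposite (fromℕ n)) ℤ.+ δ (ξ-letter w μ (opposite (fromℕ n)))
      ≡⟨ cong (λ i → g′ i ℤ.+ δ (ξ-letter w μ i)) (opposite-involutive {suc n} Fin.zero) ⟩
    (h Fin.zero ℤ.+ s) ℤ.+ δ (ξ-letter w μ Fin.zero)
      ≡⟨ cong₂ (λ u d → (u ℤ.+ s) ℤ.+ d) (height-zero w) (trans (δ-v Fin.zero) (ℤ.+-identityʳ _)) ⟩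
    (0ℤ ℤ.+ s) ℤ.+ b′
      ≡⟨ cong (ℤ._+ b′) (ℤ.+-identityˡ s) ⟩
    s ℤ.+ b′
      ≡⟨ weight-≤ Fin.zero (s≤s z≤n) ⟩
    0ℤ ∎
    where
    open ≡-Reasoning
    s = shift w μ Fin.zero
    b′ = ⟦ flipped (side μ Fin.zero) (right (w Fin.zero)) ⟧ ℤ.- 1ℤ

  image : 𝔏 (suc n)
  image = record
    { w       = v
    ; motzkin = record { height-nonneg = nonneg ; height-end = g-end }
    ; c       = c′ ∘ opposite
    ; c-NE    = λ j l → c′≥0 (opposite j) (trans (sym (right-v j)) (NE⇒right l)) , c′≤g j
    ; c-SdE   = λ j l → c′≥1 (opposite j) (trans (sym (right-v j)) (SdE⇒¬right l)) , c′≤g j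
    }
    where
    nonneg-view : ∀ {i} → View i → 0ℤ ℤ.≤ height v i
    nonneg-view ‵fromℕ       = ℤ.≤-reflexive (sym g-end)
    nonneg-view (‵inject₁ j) = g≥0 j

    nonneg : ∀ i → 0ℤ ℤ.≤ height v i
    nonneg i = nonneg-view (view i)

  -- The places after the reflection of cs(W) come from i < cs(W), where c_i + [b_i] is positive: if
  -- b_i fails, then c_i ≥ 1 as for every S or dE.
  lastZero-image : IsLastZero image (opposite μ)
  lastZero-image = zero-at , positive
    where
    zero-at : c′ (opposite (opposite μ)) ≡ 0ℤ
    zero-at = trans (cong c′ (opposite-involutive μ)) (trans (cong₂ ℤ._+_ cμ≡0 no-shift) refl)
      where
      no-shift : shift w μ μ ≡ 0ℤ
      no-shift with side μ μ
      ... | tri< lt _ _ = contradiction lt (n≮n _)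
      ... | tri≈ _ _ _  = refl
      ... | tri> _ _ gt = contradiction gt (n≮n _)

    positive : ∀ j → ⌜ opposite μ ⌝ < ⌜ j ⌝ → c′ (opposite j) ≢ 0ℤ
    positive j lt eq with side μ (opposite j) | right (w (opposite j)) in b≡
    ... | tri≈ ≮ _ _ | _     = ≮ (opposite-<ˡ lt)
    ... | tri> ≮ _ _ | _     = ≮ (opposite-<ˡ lt)
    ... | tri< _ _ _ | true  =
      contradiction (subst (1ℤ ℤ.≤_) eq (ℤ.+-mono-≤ (c≥0 (opposite j)) (ℤ.≤-refl {1ℤ}))) λ { (ℤ.+≤+ ()) }
    ... | tri< _ _ _ | false =
      contradiction (subst (1ℤ ℤ.≤_) eq (ℤ.+-mono-≤ (c≥1′ b≡) (ℤ.≤-refl {0ℤ}))) λ { (ℤ.+≤+ ()) }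

  cs≡ : cs W ≡ ⌜ μ ⌝
  cs≡ = cs-lastZero W lastZero

  cs-image : cs image ≡ ⌜ opposite μ ⌝
  cs-image = cs-lastZero image lastZero-image

  reflected : suc (suc n) ∸ cs W ≡ ⌜ opposite μ ⌝
  reflected = trans (cong (suc (suc n) ∸_) cs≡) (suc∸⌜⌝ μ)

  conditions : ξ-Conditions W image
  conditions = record
    { cs-reversed      = trans cs-image (sym reflected)
    ; letters-reversed = λ j j≢ → mk⇔
        (λ l → ¬right⇒SdE (right-w j (j≢ ∘ sym ∘ trans reflected) (trans (sym (right-v j)) (NE⇒right l))))
        (λ l → right⇒NE (trans (right-v j) (right-v′ j (j≢ ∘ sym ∘ trans reflected) (SdE⇒¬right l))))
    ; height-raised    = λ j (lt , l) → trans (g≡ j) (cong (λ u → h (opposite j) ℤ.+ u)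
        (raised (opposite j) (opposite-<ˡ (subst (_< ⌜ j ⌝) reflected lt))
                (trans (sym (right-v j)) (SdE⇒¬right l))))
    ; height-lowered   = λ j (lt , l) → trans (g≡ j) (cong (λ u → h (opposite j) ℤ.+ u)
        (lowered (opposite j) (opposite-<ʳ (subst (⌜ j ⌝ <_) reflected lt))
                (trans (sym (right-v j)) (NE⇒right l))))
    ; height-otherwise = λ j ¬r ¬l → trans (g≡ j) (trans (cong (λ u → h (opposite j) ℤ.+ u)
        (otherwise (opposite j)
          (λ lt eq → ¬r (subst (_< ⌜ j ⌝) (sym reflected) (opposite-<ʳ′ lt)
                      , ¬right⇒SdE (trans (right-v j) eq)))
          (λ lt eq → ¬l (subst (⌜ j ⌝ <_) (sym reflected) (opposite-<ˡ′ lt)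
                      , right⇒NE (trans (right-v j) eq)))))
        (ℤ.+-identityʳ _))
    ; c-reversed       = λ j → trans
        (solve 3 (λ c s H → c :+ s := ((H :+ s) :- H) :+ c) refl
          (c (opposite j)) (shift w μ (opposite j)) (h (opposite j)))
        (cong (λ u → u ℤ.- h (opposite j) ℤ.+ c (opposite j)) (sym (g≡ j)))
    }
    where
    open ℤ.+-*-Solver using (solve; _:+_; _:-_; _:=_)

    opposite-<ʳ′ : ∀ {j} → ⌜ opposite j ⌝ < ⌜ μ ⌝ → ⌜ opposite μ ⌝ < ⌜ j ⌝
    opposite-<ʳ′ {j} lt = subst (λ k → _ < ⌜ k ⌝) (opposite-involutive j) (opposite-< lt)

    opposite-<ˡ′ : ∀ {j} → ⌜ μ ⌝ < ⌜ opposite j ⌝ → ⌜ j ⌝ < ⌜ opposite μ ⌝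
    opposite-<ˡ′ {j} lt = subst (λ k → ⌜ k ⌝ < _) (opposite-involutive j) (opposite-< lt)

    ≢μ : ∀ j → ⌜ opposite μ ⌝ ≢ ⌜ j ⌝ → ⌜ opposite j ⌝ ≢ ⌜ μ ⌝
    ≢μ j neq eq = neq (cong ⌜_⌝ (trans (cong opposite (sym (⌜⌝-injective eq))) (opposite-involutive j)))

    right-w : ∀ j → ⌜ opposite μ ⌝ ≢ ⌜ j ⌝ →
      flipped (side μ (opposite j)) (right (w (opposite j))) ≡ true → right (w (opposite j)) ≡ false
    right-w j neq eq with side μ (opposite j) | right (w (opposite j))
    ... | tri< _ _ _  | false = refl
    ... | tri> _ _ _  | false = refl
    ... | tri≈ _ eq _ | _     = contradiction eq (≢μ j neq)

    right-v′ : ∀ j → ⌜ opposite μ ⌝ ≢ ⌜ j ⌝ → right (w (opposite j)) ≡ false →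
      flipped (side μ (opposite j)) (right (w (opposite j))) ≡ true
    right-v′ j neq eq with side μ (opposite j) | right (w (opposite j))
    ... | tri< _ _ _  | false = refl
    ... | tri> _ _ _  | false = refl
    ... | tri≈ _ eq _ | _     = contradiction eq (≢μ j neq)

    raised : ∀ i → ⌜ i ⌝ < ⌜ μ ⌝ → flipped (side μ i) (right (w i)) ≡ false → shift w μ i ≡ 1ℤ
    raised i lt eq with side μ i | right (w i)
    ... | tri< _ _ _ | true = refl
    ... | tri> ≮ _ _ | true = contradiction lt ≮

    lowered : ∀ i → ⌜ μ ⌝ < ⌜ i ⌝ → flipped (side μ i) (right (w i)) ≡ true → shift w μ i ≡ ℤ.- 1ℤ
    lowered i lt eq with side μ i | right (w i)
    ... | tri> _ _ _ | false = refl
    ... | tri≈ _ _ ≯ | _     = contradiction lt ≯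
    ... | tri< _ _ ≯ | false = contradiction lt ≯

    otherwise : ∀ i →
      (⌜ i ⌝ < ⌜ μ ⌝ → flipped (side μ i) (right (w i)) ≢ false) →
      (⌜ μ ⌝ < ⌜ i ⌝ → flipped (side μ i) (right (w i)) ≢ true) → shift w μ i ≡ 0ℤ
    otherwise i ¬r ¬l with side μ i | right (w i)
    ... | tri< lt _ _ | true  = contradiction refl (¬r lt)
    ... | tri< _ _ _  | false = refl
    ... | tri≈ _ _ _  | _     = refl
    ... | tri> _ _ _  | true  = refl
    ... | tri> _ _ gt | false = contradiction refl (¬l gt)

-- Uniqueness and involutivity of ξ

ξ : 𝔏 (suc n) → 𝔏 (suc n)
ξ W = Reversal.image W

⟦⟧-injective : ∀ {a b} → ⟦ a ⟧ ≡ ⟦ b ⟧ → a ≡ b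
⟦⟧-injective {true}  {true}  _ = refl
⟦⟧-injective {false} {false} _ = refl

right-ext : ∀ {l l′} → (l ∈NE → l′ ∈NE) → (l′ ∈NE → l ∈NE) → right l ≡ right l′
right-ext {l} {l′} f g with right l in eq | right l′ in eq′
... | true  | true  = refl
... | false | false = refl
... | true  | false = trans (sym (NE⇒right (f (right⇒NE eq)))) eq′
... | false | true  = trans (sym eq) (NE⇒right (g (right⇒NE eq′)))

right-at-zero : ∀ (W : 𝔏 n) {i} → 𝔏.c W i ≡ 0ℤ → right (𝔏.w W i) ≡ true
right-at-zero W {i} c≡0 with right (𝔏.w W i) in eq
... | true  = refl
... | false = contradiction
  (subst (1ℤ ℤ.≤_) c≡0 (proj₁ (𝔏.c-SdE W i (¬right⇒SdE eq)))) λ { (ℤ.+≤+ ()) }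

right-at-cs : ∀ (W : 𝔏 (suc n)) i → ⌜ i ⌝ ≡ cs W → right (𝔏.w W i) ≡ true
right-at-cs W i i≡cs = right-at-zero W
  (subst (λ k → 𝔏.c W k ≡ 0ℤ)
    (⌜⌝-injective (trans (sym (cs-lastZero W (proj₂ (∃-lastZero W)))) (sym i≡cs)))
    (proj₁ (proj₂ (∃-lastZero W))))

-- The left ascents are recovered as [a_i] = h_i + [b_i] - h_{i+1}. The height after the last
-- letter, which `𝔏.h` omits, is 0 for both paths.
history-ext : ∀ {U V : 𝔏 (suc n)} → let module U = 𝔏 U; module V = 𝔏 V in
  (∀ i → right (U.w i) ≡ right (V.w i)) → (∀ i → U.h i ≡ V.h i) → ∀ i → U.w i ≡ V.w i
history-ext {n} {U} {V} right≡ h≡ i = letter-ext (⟦⟧-injective (begin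
  ⟦ left (U.w i) ⟧
    ≡⟨ recover U.w ⟩
  (U.h i ℤ.+ ⟦ right (U.w i) ⟧) ℤ.- height U.w (Fin.suc i)
    ≡⟨ cong₂ ℤ._-_ (cong₂ (λ u b → u ℤ.+ ⟦ b ⟧) (h≡ i) (right≡ i)) (height≡ (view (Fin.suc i))) ⟩
  (V.h i ℤ.+ ⟦ right (V.w i) ⟧) ℤ.- height V.w (Fin.suc i)
    ≡⟨ recover V.w ⟨
  ⟦ left (V.w i) ⟧ ∎)) (right≡ i)
  where
  open ≡-Reasoning
  module U = 𝔏 U
  module V = 𝔏 V

  recover : ∀ (w : Fin (suc n) → Letter) → ⟦ left (w i) ⟧ ≡
    (height w (inject₁ i) ℤ.+ ⟦ right (w i) ⟧) ℤ.- height w (Fin.suc i)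
  recover w = trans
    (solve 3 (λ a b H → a := (H :+ b) :- (H :+ (b :- a))) refl
      ⟦ left (w i) ⟧ ⟦ right (w i) ⟧ (height w (inject₁ i)))
    (cong (λ u → (height w (inject₁ i) ℤ.+ ⟦ right (w i) ⟧) ℤ.- u) (sym (height-step w i)))
    where open ℤ.+-*-Solver using (solve; _:+_; _:-_; _:=_)

  height≡ : ∀ {k} → View k → height U.w k ≡ height V.w k
  height≡ ‵fromℕ       = trans (Is2Motzkin.height-end U.motzkin) (sym (Is2Motzkin.height-end V.motzkin))
  height≡ (‵inject₁ j) = h≡ j

module ξC = ξ-Conditions

-- The right ascents agree by the condition on letters and, at the reflected cs(W), by c = 0. Hence
-- the same clause of the height condition applies to both histories.
ξ-unique : ∀ {W U V : 𝔏 (suc n)} → ξ-Conditions W U → ξ-Conditions W V → U ≈ₕ V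
ξ-unique {n} {W} {U} {V} u v = history-ext {U = U} {V} right≡ h≡ , c≡
  where
  module W = 𝔏 W
  module U = 𝔏 U
  module V = 𝔏 V
  r = suc (suc n) ∸ cs W

  right≡ : ∀ j → right (U.w j) ≡ right (V.w j)
  right≡ j with ⌜ j ⌝ ≟ r
  ... | yes j≡r = trans (right-at-cs U j (trans j≡r (sym (ξC.cs-reversed u))))
                        (sym (right-at-cs V j (trans j≡r (sym (ξC.cs-reversed v)))))
  ... | no  j≢r = right-ext
    (Equivalence.from (ξC.letters-reversed v j j≢r) ∘ Equivalence.to (ξC.letters-reversed u j j≢r))
    (Equivalence.from (ξC.letters-reversed u j j≢r) ∘ Equivalence.to (ξC.letters-reversed v j j≢r))

  h≡ : ∀ j → U.h j ≡ V.h j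
  h≡ j with <-cmp ⌜ j ⌝ r | right (U.w j) in eq
  ... | tri< lt _ ≯ | true  = trans (ξC.height-lowered u j (lt , right⇒NE eq))
    (sym (ξC.height-lowered v j (lt , right⇒NE (trans (sym (right≡ j)) eq))))
  ... | tri> ≮ _ gt | false = trans (ξC.height-raised u j (gt , ¬right⇒SdE eq))
    (sym (ξC.height-raised v j (gt , ¬right⇒SdE (trans (sym (right≡ j)) eq))))
  ... | tri< lt _ ≯ | false = trans
    (ξC.height-otherwise u j (≯ ∘ proj₁) (λ (_ , l) → contradiction (trans (sym eq) (NE⇒right l)) λ ()))
    (sym (ξC.height-otherwise v j (≯ ∘ proj₁)
      (λ (_ , l) → contradiction (trans (sym eq) (trans (right≡ j) (NE⇒right l))) λ ())))
  ... | tri> ≮ _ gt | true  = trans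
    (ξC.height-otherwise u j (λ (_ , l) → contradiction (trans (sym eq) (SdE⇒¬right l)) λ ()) (≮ ∘ proj₁))
    (sym (ξC.height-otherwise v j
      (λ (_ , l) → contradiction (trans (sym eq) (trans (right≡ j) (SdE⇒¬right l))) λ ()) (≮ ∘ proj₁)))
  ... | tri≈ ≮ _ ≯ | _ = trans (ξC.height-otherwise u j (≯ ∘ proj₁) (≮ ∘ proj₁))
    (sym (ξC.height-otherwise v j (≯ ∘ proj₁) (≮ ∘ proj₁)))

  c≡ : ∀ j → U.c j ≡ V.c j
  c≡ j = trans (ξC.c-reversed u j) (trans
    (cong (λ g → g ℤ.- W.h (opposite j) ℤ.+ W.c (opposite j)) (h≡ j)) (sym (ξC.c-reversed v j)))

-- Reflection exchanges the two sides of cs and the complement exchanges N, E with S, dE, so raised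
-- and lowered heights change roles.
ξ-Conditions-sym : ∀ {W V : 𝔏 (suc n)} → ξ-Conditions W V → ξ-Conditions V W
ξ-Conditions-sym {n} {W} {V} cond = record
  { cs-reversed      = trans csW≡ (sym m≡)
  ; letters-reversed = λ j j≢ → mk⇔
      (λ l → ¬right⇒SdE (trans (right≡ j (j≢ ∘ λ { refl → sym m≡ })) (cong not (NE⇒right l))))
      (λ l → right⇒NE (trans (sym (not-involutive _)) (cong not
        (trans (sym (right≡ j (j≢ ∘ λ { refl → sym m≡ }))) (SdE⇒¬right l)))))
  ; height-raised    = λ j (lt , l) → let μ<j = subst (_< ⌜ j ⌝) m≡ lt in
      trans (solve 1 (λ H → H := (H :- con 1ℤ) :+ con 1ℤ) refl (W.h j))
        (cong (ℤ._+ 1ℤ) (sym (trans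
          (ξC.height-lowered cond (opposite j) (subst (⌜ opposite j ⌝ <_) (sym r≡) (opposite-< μ<j)
            , right⇒NE (trans (right≡ j (λ { refl → n≮n _ μ<j })) (cong not (SdE⇒¬right l)))))
          (cong (λ i → W.h i ℤ.- 1ℤ) (opposite-involutive j)))))
  ; height-lowered   = λ j (lt , l) → let j<μ = subst (⌜ j ⌝ <_) m≡ lt in
      trans (solve 1 (λ H → H := (H :+ con 1ℤ) :- con 1ℤ) refl (W.h j))
        (cong (ℤ._- 1ℤ) (sym (trans
          (ξC.height-raised cond (opposite j) (subst (_< ⌜ opposite j ⌝) (sym r≡) (opposite-< j<μ)
            , ¬right⇒SdE (trans (right≡ j (λ { refl → n≮n _ j<μ })) (cong not (NE⇒right l)))))
          (cong (λ i → W.h i ℤ.+ 1ℤ) (opposite-involutive j)))))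
  ; height-otherwise = λ j ¬r ¬l → sym (trans
      (ξC.height-otherwise cond (opposite j)
        (λ (lt , l) → let j<μ = before j (subst (_< ⌜ opposite j ⌝) r≡ lt) in
          ¬l (subst (⌜ j ⌝ <_) (sym m≡) j<μ
             , right⇒NE (trans (sym (not-involutive _)) (cong not
                 (trans (sym (right≡ j (λ { refl → n≮n _ j<μ }))) (SdE⇒¬right l))))))
        (λ (lt , l) → let μ<j = after j (subst (⌜ opposite j ⌝ <_) r≡ lt) in
          ¬r (subst (_< ⌜ j ⌝) (sym m≡) μ<j
             , ¬right⇒SdE (trans (sym (not-involutive _)) (cong not
                 (trans (sym (right≡ j (λ { refl → n≮n _ μ<j }))) (NE⇒right l)))))))
      (cong W.h (opposite-involutive j)))
  ; c-reversed       = λ j → trans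
      (solve 3 (λ H G c → c := (H :- G) :+ ((G :- H) :+ c)) refl (W.h j) (V.h (opposite j)) (W.c j))
      (cong (λ u → W.h j ℤ.- V.h (opposite j) ℤ.+ u) (sym (trans (ξC.c-reversed cond (opposite j))
        (cong (λ i → V.h (opposite j) ℤ.- W.h i ℤ.+ W.c i) (opposite-involutive j)))))
  }
  where
  open ℤ.+-*-Solver using (solve; _:+_; _:-_; _:=_; con)
  module W = 𝔏 W
  module V = 𝔏 V

  μ = proj₁ (∃-lastZero W)

  csW≡ : cs W ≡ ⌜ μ ⌝
  csW≡ = cs-lastZero W (proj₂ (∃-lastZero W))

  r≡ : suc (suc n) ∸ cs W ≡ ⌜ opposite μ ⌝
  r≡ = trans (cong (suc (suc n) ∸_) csW≡) (suc∸⌜⌝ μ)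

  m≡ : suc (suc n) ∸ cs V ≡ ⌜ μ ⌝
  m≡ = trans (cong (suc (suc n) ∸_) (trans (ξC.cs-reversed cond) r≡))
             (trans (suc∸⌜⌝ (opposite μ)) (cong ⌜_⌝ (opposite-involutive μ)))

  before : ∀ j → ⌜ opposite μ ⌝ < ⌜ opposite j ⌝ → ⌜ j ⌝ < ⌜ μ ⌝
  before j lt = subst (λ k → ⌜ k ⌝ < ⌜ μ ⌝) (opposite-involutive j) (opposite-<ˡ lt)

  after : ∀ j → ⌜ opposite j ⌝ < ⌜ opposite μ ⌝ → ⌜ μ ⌝ < ⌜ j ⌝
  after j lt = subst (λ k → ⌜ μ ⌝ < ⌜ k ⌝) (opposite-involutive j) (opposite-<ʳ lt)

  right≡ : ∀ j → j ≢ μ → right (V.w (opposite j)) ≡ not (right (W.w j))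
  right≡ j j≢μ = trans (cases _ _ refl refl) (cong (not ∘ right ∘ W.w) (opposite-involutive j))
    where
    reversed = ξC.letters-reversed cond (opposite j) λ eq →
      j≢μ (trans (sym (opposite-involutive j))
            (trans (cong opposite (⌜⌝-injective (trans eq r≡))) (opposite-involutive μ)))

    cases : ∀ a b → right (V.w (opposite j)) ≡ a → right (W.w (opposite (opposite j))) ≡ b →
            right (V.w (opposite j)) ≡ not (right (W.w (opposite (opposite j))))
    cases true  b eq eq′ = trans eq (cong not (sym (SdE⇒¬right (Equivalence.to reversed (right⇒NE eq)))))
    cases false true  eq eq′ = trans eq (cong not (sym eq′))
    cases false false eq eq′ = trans (NE⇒right (Equivalence.from reversed (¬right⇒SdE eq′))) (cong not (sym eq′))

ξ-isξ : Is-ξ (ξ {n})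
ξ-isξ = record
  { involutive = λ W → ξ-unique {W = ξ W} {ξ (ξ W)} {W} (Reversal.conditions (ξ W))
                         (ξ-Conditions-sym (Reversal.conditions W))
  ; conditions = Reversal.conditions
  }

∃!ξ : ∃! _≗ₕ_ (Is-ξ {suc n})
∃!ξ = ξ , ξ-isξ , λ isξ W → ξ-unique (Reversal.conditions W) (Is-ξ.conditions isξ W)

lastZero-cong : ∀ {W V : 𝔏 (suc n)} → W ≈ₕ V → proj₁ (∃-lastZero W) ≡ proj₁ (∃-lastZero V)
lastZero-cong {W = W} {V} (_ , c≗) with ∃-lastZero W | ∃-lastZero V
... | μ , cμ≡0 , last | ν , cν≡0 , last′ = ⌜⌝-injective (≤-antisym
  (≮⇒≥ (λ lt → last′ μ lt (trans (sym (c≗ μ)) cμ≡0)))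
  (≮⇒≥ (λ lt → last ν lt (trans (c≗ ν) cν≡0))))

ξ-cong : ∀ {W V : 𝔏 (suc n)} → W ≈ₕ V → ξ W ≈ₕ ξ V
ξ-cong {W = W} {V} W≈V@(w≗ , c≗) =
  (λ j → trans (letter≗ (proj₁ (∃-lastZero W)) (opposite j))
               (cong (λ μ → ξ-letter V.w μ (opposite j)) (lastZero-cong {W = W} {V} W≈V))) ,
  (λ j → cong₂ ℤ._+_ (c≗ (opposite j))
    (cong₂ (λ μ b → adjust (side μ (opposite j)) b)
      (lastZero-cong {W = W} {V} W≈V) (cong right (w≗ (opposite j)))))
  where
  module W = 𝔏 W
  module V = 𝔏 V

  previous≗ : ∀ i → previousLeft W.w i ≡ previousLeft V.w i
  previous≗ Fin.zero    = refl
  previous≗ (Fin.suc i) = cong left (w≗ (inject₁ i))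

  letter≗ : ∀ μ i → ξ-letter W.w μ i ≡ ξ-letter V.w μ i
  letter≗ μ i = cong₂ (λ a b → shape (not a) (flipped (side μ i) b)) (previous≗ i) (cong right (w≗ i))

-- The surjectivity of ΦFV

ι : Bool → ℕ
ι b = if b then 1 else 0

-- Recording a, b, d of the occurrence of t + 1 in u ∷ l, with u as left
-- neighbour of l: whether it is larger than its left neighbour, whether it is
-- smaller than its right neighbour, and the entries into [0, t] before it.
data Occurs (t : ℕ) : ℕ → List ℕ → Bool → Bool → ℕ → Set where
  here  : ∀ {u v l a b} → does (u <? suc t) ≡ a → does (suc t <? v) ≡ b →
          Occurs t u (suc t ∷ v ∷ l) a b 0
  there : ∀ {u v l a b d d′} → Occurs t v l a b d →
          χ (t <? u ×-dec v ≤? t) + d ≡ d′ → Occurs t u (v ∷ l) a b d′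

-- Insertion is carried out on lists, while the statistics refer to positions in a sequence; this is
-- the passage between the two.
occurs-transfer : ∀ {t a b d} (f : ℕ → ℕ) m → Occurs t (f 0) (applyUpTo (f ∘ suc) m) a b d →
  ∃ λ k → f (suc k) ≡ suc t × leftAscent f (suc k) ≡ a × rightAscent f (suc k) ≡ b
        × entries f t (suc k) ≡ d
occurs-transfer {t} f m = go f m refl
  where
  go : ∀ {a b d l} (f : ℕ → ℕ) m → applyUpTo (f ∘ suc) m ≡ l → Occurs t (f 0) l a b d →
    ∃ λ k → f (suc k) ≡ suc t × leftAscent f (suc k) ≡ a × rightAscent f (suc k) ≡ b
          × entries f t (suc k) ≡ d
  go f (suc zero) () (here _ _)
  go f (suc (suc m)) eq (here refl refl) with f 1 in eq₁ | f 2 in eq₂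
  go f (suc (suc m)) refl (here refl refl) | _ | _ = 0 , eq₁
    , cong (λ u → does (f 0 <? u)) eq₁ , cong₂ (λ u v → does (u <? v)) eq₁ eq₂
    , trans (+-identityʳ _) (χ-no (t <? f 0 ×-dec f 1 ≤? t)
        (λ (_ , le) → n≮n t (≤-trans (≤-reflexive (sym eq₁)) le)))
  go f (suc m) refl (there occ refl) with go (f ∘ suc) m refl occ
  ... | k , value , left≡ , right≡ , entries≡ = suc k , value , left≡ , right≡
    , trans (Σ<-front (λ j → χ (enters? f t j)) (suc k)) (cong (χ (enters? f t 0) +_) entries≡)

-- Words over [t] ∪ {∞}, with n + 1 as ∞, without two consecutive ∞'s and
-- ending with ∞; h is the number of ∞'s, and the Boolean says whether an ∞
-- precedes.

module Insertion (n : ℕ) where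

  ∞ : ℕ
  ∞ = suc n

  data Word (t : ℕ) : ℕ → Bool → List ℕ → Set where
    end   : Word t 0 true []
    small : ∀ {v h p l} → v ≤ t → Word t h false l → Word t h p (v ∷ l)
    big   : ∀ {h l} → Word t h true l → Word t (suc h) false (∞ ∷ l)

  weaken : ∀ {t h p l} → Word t h p l → Word (suc t) h p l
  weaken end           = end
  weaken (small v≤t w) = small (m≤n⇒m≤1+n v≤t) (weaken w)
  weaken (big w)       = big (weaken w)

  gap : Bool → List ℕ → List ℕ
  gap true  l = ∞ ∷ l
  gap false l = l

  -- The ∞ number d, counted from 0, is replaced by s; an ∞ remains on the left
  -- if a does not hold (the left neighbour is to be larger), and on the right if
  -- b does.
  data Insert (s : ℕ) (a b : Bool) : ℕ → List ℕ → List ℕ → Set where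
    here : ∀ {l} → Insert s a b 0 (∞ ∷ l) (gap (not a) (s ∷ gap b l))
    big  : ∀ {d l l′} → Insert s a b d l l′ → Insert s a b (suc d) (∞ ∷ l) (∞ ∷ l′)
    skip : ∀ {v d l l′} → v ≤ n → Insert s a b d l l′ → Insert s a b d (v ∷ l) (v ∷ l′)

  smalls : List ℕ → List ℕ
  smalls = filter (_≤? n)

  smalls-∞ : ∀ l → smalls (∞ ∷ l) ≡ smalls l
  smalls-∞ l = filter-reject (_≤? n) {xs = l} (n≮n n)

  smalls-gap : ∀ b l → smalls (gap b l) ≡ smalls l
  smalls-gap true  l = smalls-∞ l
  smalls-gap false l = refl

  smalls-∷ : ∀ {v} l → v ≤ n → smalls (v ∷ l) ≡ v ∷ smalls l
  smalls-∷ l v≤n = filter-accept (_≤? n) v≤n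

  smalls-insert : ∀ {s a b d l l′} → s ≤ n → Insert s a b d l l′ → smalls l′ ↭ s ∷ smalls l
  smalls-insert {s} {a} {b} s≤n (here {l}) = ↭-reflexive (trans (smalls-gap (not a) _)
    (trans (smalls-∷ _ s≤n) (cong (s ∷_) (trans (smalls-gap b l) (sym (smalls-∞ l))))))
  smalls-insert {s} s≤n (big {l = l} {l′} ins) = ↭-trans (↭-reflexive (smalls-∞ l′))
    (↭-trans (smalls-insert s≤n ins) (↭-reflexive (cong (s ∷_) (sym (smalls-∞ l)))))
  smalls-insert {s} s≤n (skip {v} {l = l} {l′} v≤n ins) = ↭-trans (↭-reflexive (smalls-∷ l′ v≤n))
    (↭-trans (↭-prep v (smalls-insert s≤n ins))
    (↭-trans (↭-swap v s ↭-refl) (↭-reflexive (cong (s ∷_) (sym (smalls-∷ l v≤n))))))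

  no-∞ : ∀ {t l} → ¬ Word t 0 false l
  no-∞ (small _ w) = no-∞ w

  -- The one ∞ that is left must be the final one, which stands for π(n + 1).
  smalls-complete : ∀ {t l} → t ≤ n → Word t 1 false l → l ≡ smalls l ∷ʳ ∞
  smalls-complete t≤n (small {v} {l = l} v≤t w) = trans (cong (v ∷_) (smalls-complete t≤n w))
    (cong (_∷ʳ ∞) (sym (smalls-∷ l (≤-trans v≤t t≤n))))
  smalls-complete t≤n (big end)         = cong (_∷ʳ ∞) (sym (smalls-∞ []))
  smalls-complete t≤n (big (small _ w)) = contradiction w no-∞

  -- The preceding letter matters only through its comparison with t and t + 1, so all letters above
  -- t + 1 are interchangeable there.
  occurs-previous : ∀ {t u u′ l a b d} → suc t < u → suc t < u′ → Occurs t u l a b d → Occurs t u′ l a b d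
  occurs-previous {t} {u} {u′} s<u s<u′ (here a≡ b≡) = here
    (trans (dec-false (u′ <? suc t) (<⇒≯ s<u′)) (trans (sym (dec-false (u <? suc t) (<⇒≯ s<u))) a≡)) b≡
  occurs-previous {t} {u} {u′} s<u s<u′ (there {v = v} {d = d} occ d≡) = there occ
    (trans (cong (_+ d) (χ-cong (t <? u′ ×-dec v ≤? t) (t <? u ×-dec v ≤? t)
      (λ (_ , le) → <⇒≤ s<u , le) (λ (_ , le) → <⇒≤ s<u′ , le))) d≡)

  occurs-big : ∀ {t u v l a b d} → suc t < v → Occurs t v l a b d → Occurs t u (v ∷ l) a b d
  occurs-big {t} {u} {v} {d = d} s<v occ = there occ
    (cong (_+ d) (χ-no (t <? u ×-dec v ≤? t) (λ (_ , le) → <⇒≱ (<⇒≤ s<v) le)))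

  occurs-gap : ∀ {t s l a b d} c → suc t < s → suc t ≤ n →
    Occurs t ∞ l a b d → Occurs t s (gap c l) a b d
  occurs-gap true  t<s t≤n occ = occurs-big (s≤s t≤n) occ
  occurs-gap false t<s t≤n occ = occurs-previous (s≤s t≤n) t<s occ

  occurs-gap′ : ∀ {t u s l a b d} c → suc t < s → suc t ≤ n →
    Occurs t s l a b d → Occurs t u (gap c (s ∷ l)) a b d
  occurs-gap′ true  t<s t≤n occ = occurs-big (s≤s t≤n) (occurs-big t<s occ)
  occurs-gap′ false t<s t≤n occ = occurs-big t<s occ

  module _ {s : ℕ} {a b : Bool} where

    insert-head : ∀ {t d v l l′} → suc t < s → suc t ≤ n → Insert s a b d (v ∷ l) l′ →
      ∃ λ v′ → ∃ λ l″ → l′ ≡ v′ ∷ l″ × does (suc t <? v) ≡ does (suc t <? v′)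
    insert-head {t} lt t≤n here with not a
    ... | true  = _ , _ , refl , refl
    ... | false = _ , _ , refl , trans (dec-true (suc t <? ∞) (s≤s t≤n)) (sym (dec-true (suc t <? s) lt))
    insert-head lt t≤n (big ins)    = _ , _ , refl , refl
    insert-head lt t≤n (skip _ ins) = _ , _ , refl , refl

    -- Later insertions turn an ∞ into letters that all exceed t + 1, and two adjacent such letters
    -- create no entry into [0, t]. The data of t + 1 therefore persist.
    occurs-insert : ∀ {t u l l′ d x y z} → suc t < s → suc t ≤ n →
      Insert s a b d l l′ → Occurs t u l x y z → Occurs t u l′ x y z
    occurs-insert lt t≤n here (here _ _) = contradiction t≤n (n≮n n)
    occurs-insert lt t≤n (big _) (here _ _) = contradiction t≤n (n≮n n)
    occurs-insert {t} {u} lt t≤n here (there {d = d} occ d≡) = subst (Occurs t _ _ _ _)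
      (trans (sym (cong (_+ d) (χ-no (t <? u ×-dec ∞ ≤? t)
        (λ (_ , le) → <⇒≱ t≤n (≤-trans (n≤1+n n) le))))) d≡)
      (occurs-gap′ (not a) lt t≤n (occurs-gap b lt t≤n occ))
    occurs-insert lt t≤n (big ins) (there occ d≡) = there (occurs-insert lt t≤n ins occ) d≡
    occurs-insert lt t≤n (skip _ ins) (there occ d≡) = there (occurs-insert lt t≤n ins occ) d≡
    occurs-insert lt t≤n (skip v≤n ins) (here a≡ b≡) with insert-head lt t≤n ins
    ... | v′ , l″ , refl , eq = here a≡ (trans (sym eq) b≡)

  module _ {t : ℕ} (t<n : t < n) where

    s = suc t

    insertion : ∀ {a b h p l d} → Word t h p l → d < h → ∃ (Insert s a b d l)
    insertion {d = zero}  (big w) _ = _ , here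
    insertion {d = suc d} (big w) (s≤s d<h) with insertion w d<h
    ... | _ , ins = _ , big ins
    insertion (small v≤t w) d<h with insertion w d<h
    ... | _ , ins = _ , skip (≤-trans v≤t (<⇒≤ t<n)) ins

    ∞≰t : ¬ ∞ ≤ t
    ∞≰t le = n≮n n (≤-trans le (<⇒≤ t<n))

    -- An ∞ that is not the last is followed by a finite letter, which serves as the smaller right
    -- neighbour when b fails.
    nonempty : ∀ {h l} → 0 < h → Word t h true l → Word t h false l × ∃ λ v → ∃ λ l′ → v ≤ t × l ≡ v ∷ l′
    nonempty _ (small v≤t w) = small v≤t w , _ , _ , v≤t , refl

    -- The last hypothesis keeps the final ∞ from being replaced when a smaller right neighbour is
    -- needed. One ∞ is used up and [b] + [¬ a] are put back, which is the height step [b] - [a].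
    insert-word : ∀ {a b h p l l′ d} → Word t h p l → Insert s a b d l l′ → (b ≡ false → suc d < h) →
      ∃ λ h′ → Word s h′ p l′ × suc h′ ≡ h + ι b + χ¬ a
    insert-word (small v≤t w) (skip _ ins) d<h with insert-word w ins d<h
    ... | h′ , w′ , eq = h′ , small (m≤n⇒m≤1+n v≤t) w′ , eq
    insert-word (small v≤t w) here _    = contradiction v≤t ∞≰t
    insert-word (small v≤t w) (big _) _ = contradiction v≤t ∞≰t
    insert-word (big w) (skip v≤n _) _  = contradiction v≤n (n≮n n)
    insert-word (big w) (big ins) d<h with insert-word w ins (≤-pred ∘ d<h)
    ... | h′ , w′ , eq = suc h′ , big w′ , cong suc eq
    insert-word {a} {b} (big {h} w) here d<h with a | b
    ... | true  | true  = suc h , small ≤-refl (big (weaken w))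
                        , sym (trans (+-identityʳ _) (+-comm (suc h) 1))
    ... | true  | false = h , small ≤-refl (weaken (proj₁ (nonempty (≤-pred (d<h refl)) w)))
                        , sym (trans (+-identityʳ _) (+-identityʳ _))
    ... | false | true  = suc (suc h) , big (small ≤-refl (big (weaken w)))
                        , sym (trans (+-comm (suc h + 1) 1) (cong suc (+-comm (suc h) 1)))
    ... | false | false = suc h , big (small ≤-refl (weaken (proj₁ (nonempty (≤-pred (d<h refl)) w))))
                        , sym (trans (cong (_+ 1) (+-identityʳ (suc h))) (+-comm (suc h) 1))

    Precedes : Bool → ℕ → Set
    Precedes true  u = u ≡ ∞
    Precedes false u = u ≤ t

    after-gap : ∀ {a b u h l} → (b ≡ false → 1 < suc h) → Word t h true l → does (u <? s) ≡ a →
      Occurs t u (s ∷ gap b l) a b 0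
    after-gap {b = b} 1<h w a≡ with b
    ... | true  = here a≡ (dec-true (s <? ∞) (s≤s t<n))
    ... | false with nonempty (≤-pred (1<h refl)) w
    ...   | _ , v , l′ , v≤t , refl = here a≡ (dec-false (s <? v) (λ lt → <⇒≱ lt (m≤n⇒m≤1+n v≤t)))

    at-gap : ∀ {a b u h l} → u ≤ t → (b ≡ false → 1 < suc h) → Word t h true l →
      Occurs t u (gap (not a) (s ∷ gap b l)) a b 0
    at-gap {true} {u = u} u≤t 1<h w = after-gap 1<h w (dec-true (u <? s) (s≤s u≤t))
    at-gap {false} {u = u} u≤t 1<h w =
      there (after-gap 1<h w (dec-false (∞ <? s) (λ lt → ∞≰t (≤-pred lt))))
            (cong (_+ 0) (χ-no (t <? u ×-dec ∞ ≤? t) (λ (_ , le) → ∞≰t le)))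

    -- Since no two ∞ are adjacent, each ∞ passed on the way is followed by a finite letter and
    -- gives exactly one entry into [0, t]. The summand `ι p` stands for the entry from an ∞ just
    -- before the word.
    insert-occurs : ∀ {a b h p l l′ d u} → Precedes p u → Word t h p l → Insert s a b d l l′ →
      (b ≡ false → suc d < h) → Occurs t u l′ a b (ι p + d)
    insert-occurs {p = true} {d = d} {u} u≡∞ (small v≤t w) (skip {v} _ ins) d<h =
      there (insert-occurs v≤t w ins d<h) (cong (_+ d) (χ-yes (t <? u ×-dec v ≤? t)
        (≤-trans t<n (≤-trans (n≤1+n n) (≤-reflexive (sym u≡∞))) , v≤t)))
    insert-occurs {p = false} {d = d} {u} u≤t (small v≤t w) (skip {v} _ ins) d<h =
      there (insert-occurs v≤t w ins d<h) (cong (_+ d) (χ-no (t <? u ×-dec v ≤? t) (λ (lt , _) → <⇒≱ lt u≤t)))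
    insert-occurs _ (small v≤t w) here _    = contradiction v≤t ∞≰t
    insert-occurs _ (small v≤t w) (big _) _ = contradiction v≤t ∞≰t
    insert-occurs _ (big w) (skip v≤n _) _  = contradiction v≤n (n≮n n)
    insert-occurs {u = u} u≤t (big w) (big {d} ins) d<h =
      there (insert-occurs refl w ins (≤-pred ∘ d<h))
            (cong (_+ suc d) (χ-no (t <? u ×-dec ∞ ≤? t) (λ (_ , le) → ∞≰t le)))
    insert-occurs u≤t (big w) here d<h = at-gap u≤t d<h w

-- From a word to a permutation with a given history

applyUpTo-lookup : ∀ {f : ℕ → ℕ} l → (∀ k → f (toℕ k) ≡ lookup l k) → applyUpTo f (length l) ≡ l
applyUpTo-lookup []      f≗ = refl
applyUpTo-lookup (_ ∷ l) f≗ = cong₂ _∷_ (f≗ Fin.zero) (applyUpTo-lookup l (f≗ ∘ Fin.suc))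

one-line : ∀ {l} → l ↭ [1… n ] → ∃ λ (π : 𝔖 n) → applyUpTo (λ k → π ⟨ suc k ⟩) n ≡ l
one-line {n} {l} l↭ = π , trans (cong (applyUpTo (λ k → π ⟨ suc k ⟩)) (sym length≡))
                                (applyUpTo-lookup l letters)
  where
  open ≡-Reasoning
  length≡ : length l ≡ n
  length≡ = trans (↭-length l↭) (length-applyUpTo suc n)

  l↭ₛ = ↭⇒↭ₛ l↭

  π : 𝔖 n
  π = Perm.cast-id (sym length≡) Perm.∘ₚ onIndices l↭ₛ Perm.∘ₚ Perm.cast-id (length-applyUpTo suc n)

  letters : ∀ k → π ⟨ suc (toℕ k) ⟩ ≡ lookup l k
  letters k = begin
    π ⟨ suc (toℕ k) ⟩                     ≡⟨ cong (λ j → π ⟨ suc j ⟩) (toℕ-cast length≡ k) ⟨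
    π ⟨ ⌜ Fin.cast length≡ k ⌝ ⟩          ≡⟨ FV.x-value π (Fin.cast length≡ k) ⟩
    ⌜ π ⟨$⟩ʳ Fin.cast length≡ k ⌝
      ≡⟨ cong suc (toℕ-cast (length-applyUpTo suc n) _) ⟩
    ⌜ onIndices l↭ₛ ⟨$⟩ʳ Fin.cast (sym length≡) (Fin.cast length≡ k) ⌝
      ≡⟨ cong (λ j → ⌜ onIndices l↭ₛ ⟨$⟩ʳ j ⌝) (cast-involutive (sym length≡) length≡ k) ⟩
    ⌜ onIndices l↭ₛ ⟨$⟩ʳ k ⌝              ≡⟨ lookup-applyUpTo suc n (onIndices l↭ₛ ⟨$⟩ʳ k) ⟨
    lookup [1… n ] (onIndices l↭ₛ ⟨$⟩ʳ k) ≡⟨ onIndices-lookup l↭ₛ k ⟨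
    lookup l k                            ∎

+∣∣ : ∀ {z} → 0ℤ ℤ.≤ z → ℤ.+ ℤ.∣ z ∣ ≡ z
+∣∣ = ℤ.0≤i⇒+∣i∣≡i

occurs-statistics : ∀ (π : 𝔖 n) i {a b d} →
  Occurs (toℕ i) 0 (applyUpTo (λ k → π ⟨ suc k ⟩) (suc n)) a b d →
  left (FV-w π i) ≡ a × right (FV-w π i) ≡ b × Stats.d31-2 π i ≡ d
occurs-statistics {n} π i occ with occurs-transfer (π ⟨_⟩) (suc n) occ
... | k , value , left≡ , right≡ , entries≡ =
    trans (FV-left i) (trans (cong (leftAscent x) (sym k≡)) left≡)
  , trans (FV-right i) (trans (cong (rightAscent x) (sym k≡)) right≡)
  , trans (d≡entries i) (trans (cong (entries x (toℕ i)) (sym k≡)) entries≡)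
  where
  open Stats π using (x; pos; position-unique; FV-left; FV-right; d≡entries)
  k≡ : suc k ≡ pos i
  k≡ = position-unique i value

module Realisation {n : ℕ} (W : 𝔏 n) where
  open 𝔏 W
  open Insertion n

  H : Fin (suc n) → ℕ
  H i = ℤ.∣ height w i ∣

  H≡ : ∀ i → ℤ.+ H i ≡ height w i
  H≡ i = +∣∣ (Is2Motzkin.height-nonneg motzkin i)

  C D : Fin n → ℕ
  C i = ℤ.∣ c i ∣
  D i = H (inject₁ i) ∸ C i

  C≡ : ∀ i → ℤ.+ C i ≡ c i
  C≡ i = +∣∣ (proj₁ (c-bounds W i))

  C≤H : ∀ i → C i ≤ H (inject₁ i)
  C≤H i = ℤ.drop‿+≤+ (subst₂ ℤ._≤_ (sym (C≡ i)) (sym (H≡ (inject₁ i))) (proj₂ (c-bounds W i)))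

  -- This is the use of 1 ≤ c_i for S and dE: the ∞ number `D i` is then not the last of the word.
  D<H : ∀ i → right (w i) ≡ false → D i < H (inject₁ i)
  D<H i eq = ∸-monoʳ-< {o = 0}
    (ℤ.drop‿+≤+ (subst (1ℤ ℤ.≤_) (sym (C≡ i)) (proj₁ (c-SdE i (¬right⇒SdE eq))))) (C≤H i)

  -- The words built from the first t letters of w, with one ∞ more than the
  -- height h, as the final +∞ counts.
  State : ℕ → ℕ → Set
  State t h = ∃ λ l → Word t (suc h) false l × smalls l ↭ [1… t ]
    × ∀ s → toℕ s < t → Occurs (toℕ s) 0 l (left (w s)) (right (w s)) (D s)

  H-step : ∀ i → suc (suc (H (Fin.suc i))) ≡ suc (H (inject₁ i)) + ι (right (w i)) + χ¬ (left (w i))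
  H-step i = cong suc (ℤ.+-injective (begin
    1ℤ ℤ.+ ℤ.+ H (Fin.suc i)
      ≡⟨ cong (λ u → 1ℤ ℤ.+ u) (trans (H≡ (Fin.suc i)) (height-step w i)) ⟩
    1ℤ ℤ.+ (height w (inject₁ i) ℤ.+ (⟦ b ⟧ ℤ.- ⟦ a ⟧))
      ≡⟨ solve 3 (λ H b a → con 1ℤ :+ (H :+ (b :- a)) := (H :+ b) :+ (con 1ℤ :- a)) refl
           (height w (inject₁ i)) ⟦ b ⟧ ⟦ a ⟧ ⟩
    (height w (inject₁ i) ℤ.+ ⟦ b ⟧) ℤ.+ (1ℤ ℤ.- ⟦ a ⟧)
      ≡⟨ cong₂ ℤ._+_ (cong₂ ℤ._+_ (H≡ (inject₁ i)) (+ι b)) (+χ¬ a) ⟨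
    (ℤ.+ H (inject₁ i) ℤ.+ ℤ.+ ι b) ℤ.+ ℤ.+ χ¬ a
      ≡⟨ cong (ℤ._+ ℤ.+ χ¬ a) (ℤ.pos-+ (H (inject₁ i)) (ι b)) ⟨
    ℤ.+ (H (inject₁ i) + ι b) ℤ.+ ℤ.+ χ¬ a
      ≡⟨ ℤ.pos-+ (H (inject₁ i) + ι b) (χ¬ a) ⟨
    ℤ.+ (H (inject₁ i) + ι b + χ¬ a) ∎))
    where
    open ≡-Reasoning
    open ℤ.+-*-Solver using (solve; _:+_; _:-_; _:=_; con)
    a = left (w i)
    b = right (w i)

    +ι : ∀ b → ℤ.+ ι b ≡ ⟦ b ⟧
    +ι true  = refl
    +ι false = refl

    +χ¬ : ∀ a → ℤ.+ χ¬ a ≡ 1ℤ ℤ.- ⟦ a ⟧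
    +χ¬ true  = refl
    +χ¬ false = refl

  start : State 0 (H Fin.zero)
  start = ∞ ∷ [] , subst (λ h → Word 0 (suc ℤ.∣ h ∣) false (∞ ∷ [])) (sym (height-zero w)) (big end)
        , ↭-reflexive (smalls-∞ []) , λ _ ()

  step : ∀ i → State (toℕ i) (H (inject₁ i)) → State (suc (toℕ i)) (H (Fin.suc i))
  step i (l , word , letters , occurs)
    -- A word at height h contains h + 1 letters ∞, so `D i` ≤ h is an admissible index.
    with insertion (toℕ<n i) {left (w i)} {right (w i)} {d = D i} word (s≤s (m∸n≤m (H (inject₁ i)) (C i)))
  ... | l′ , ins with insert-word (toℕ<n i) word ins (λ eq → s≤s (D<H i eq))
  ...   | h′ , word′ , h′≡ = l′
    , subst (λ h → Word (suc (toℕ i)) h false l′) (suc-injective (trans h′≡ (sym (H-step i)))) word′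
    , ↭-trans (smalls-insert (toℕ<n i) ins) (↭-trans (↭-prep _ letters)
        (↭-trans (∷↭∷ʳ _ _) (↭-reflexive (applyUpTo-∷ʳ suc (toℕ i)))))
    , occurs′
    where
    occurs′ : ∀ s → toℕ s < suc (toℕ i) → Occurs (toℕ s) 0 l′ (left (w s)) (right (w s)) (D s)
    occurs′ s (s≤s s≤i) with m≤n⇒m<n∨m≡n s≤i
    ... | inj₁ s<i = occurs-insert (s≤s s<i) (toℕ<n s) ins (occurs s s<i)
    ... | inj₂ s≡i with toℕ-injective s≡i
    -- The letter before the word is π(0) = 0, which is not ∞; hence the flag `false`.
    ...   | refl = insert-occurs (toℕ<n i) {p = false} z≤n word ins (λ eq → s≤s (D<H i eq))

  state : ∀ i → State (toℕ i) (H i)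
  state = <-weakInduction (λ i → State (toℕ i) (H i)) start
    (λ i → step i ∘ subst (λ t → State t (H (inject₁ i))) (toℕ-inject₁ i))

  final : State n 0
  final = subst₂ State (toℕ-fromℕ n) (cong ℤ.∣_∣ (Is2Motzkin.height-end motzkin)) (state (fromℕ n))

  l : List ℕ
  l = proj₁ final

  π : 𝔖 n
  π = proj₁ (one-line (proj₁ (proj₂ (proj₂ final))))

  open Stats π using (x; x-end; d31-2)

  π≡l : applyUpTo (x ∘ suc) (suc n) ≡ l
  π≡l = begin
    applyUpTo (x ∘ suc) (suc n)            ≡⟨ applyUpTo-∷ʳ (x ∘ suc) n ⟨
    applyUpTo (x ∘ suc) n ∷ʳ x (suc n)
      ≡⟨ cong₂ _∷ʳ_ (proj₂ (one-line (proj₁ (proj₂ (proj₂ final))))) x-end ⟩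
    smalls l ∷ʳ ∞                          ≡⟨ smalls-complete ≤-refl (proj₁ (proj₂ final)) ⟨
    l                                      ∎
    where open ≡-Reasoning

  statistics : ∀ i → left (FV-w π i) ≡ left (w i) × right (FV-w π i) ≡ right (w i) × d31-2 i ≡ D i
  statistics i = occurs-statistics π i
    (subst (λ l → Occurs (toℕ i) 0 l (left (w i)) (right (w i)) (D i)) (sym π≡l)
           (proj₂ (proj₂ (proj₂ final)) i (toℕ<n i)))

  w≗ : ∀ i → FV-w π i ≡ w i
  w≗ i = letter-ext (proj₁ (statistics i)) (proj₁ (proj₂ (statistics i)))

  c≗ : ∀ i → ℤ.+ FV-c π i ≡ c i
  c≗ i = trans (cong ℤ.+_ (+-cancelˡ-≡ (D i) _ _ (ℤ.+-injective (begin
    ℤ.+ (D i + FV-c π i)              ≡⟨ cong (λ d → ℤ.+ (d + FV-c π i)) (proj₂ (proj₂ (statistics i))) ⟨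
    ℤ.+ (d31-2 i + FV-c π i)          ≡⟨ h≡d+c π i ⟨
    height (FV-w π) (inject₁ i)       ≡⟨ height-cong w≗ (inject₁ i) ⟩
    height w (inject₁ i)              ≡⟨ H≡ (inject₁ i) ⟨
    ℤ.+ H (inject₁ i)                 ≡⟨ cong ℤ.+_ (m∸n+n≡m (C≤H i)) ⟨
    ℤ.+ (D i + C i)                   ∎)))) (C≡ i)
    where open ≡-Reasoning

-- Bijectivity of `ΦFV`

module _ {n : ℕ} where
  ≈-isEquivalence : IsEquivalence (_≈_ {n} {n})
  ≈-isEquivalence = record { refl = λ _ → refl ; sym = sym ∘_ ; trans = λ p q i → trans (p i) (q i) }

  ≈ₕ-isEquivalence : IsEquivalence (_≈ₕ_ {n})
  ≈ₕ-isEquivalence = record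
    { refl  = (λ _ → refl) , (λ _ → refl)
    ; sym   = λ {W} {V} → ≈ₕ-sym {W = W} {V}
    ; trans = λ {U} {V} {W} → ≈ₕ-trans {U = U} {V} {W}
    }

  opaque
    ΦFV-bijection : IsBijection _≈_ _≈ₕ_ (ΦFV {n})
    ΦFV-bijection = record
      { isInjection = record
        { isCongruent = record
          { cong           = λ {π} {σ} → ΦFV-cong {π = π} {σ}
          ; isEquivalence₁ = ≈-isEquivalence
          ; isEquivalence₂ = ≈ₕ-isEquivalence
          }
        ; injective = λ {π} {σ} → ΦFV-injective {π = π} {σ}
        }
      ; surjective = λ W → Realisation.π W , λ {σ} σ≈π →
          ≈ₕ-trans {U = ΦFV σ} {ΦFV (Realisation.π W)} {W}
            (ΦFV-cong {π = σ} {Realisation.π W} σ≈π) (Realisation.w≗ W , Realisation.c≗ W)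
      }

-- Sets of values

-- Through `represents-↭` an equality of sets becomes an equivalence of predicates on indices:
-- between duplicate-free lists, equality as sets is equality as multisets.
record Represents {n : ℕ} (L : List ℕ) (P : Fin n → Set) : Set where
  field
    unique   : Unique L
    complete : ∀ {i} → P i → ⌜ i ⌝ ∈ L
    sound    : ∀ {k} → k ∈ L → ∃ λ i → k ≡ ⌜ i ⌝ × P i

open Represents

κ-represents : ∀ {L} {P : Fin n → Set} → Represents L P → Represents (κ (suc n) L) (P ∘ opposite)
κ-represents {n} {L} {P} L-P = record
  { unique   = unique-κ (unique L-P) (λ k∈ → k∈)
  ; complete = λ {i} Pi → subst (_∈ κ (suc n) L)
      (trans (suc∸⌜⌝ (opposite i)) (cong ⌜_⌝ (opposite-involutive i)))
      (∈-map⁺ (suc n ∸_) (complete L-P Pi))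
  ; sound    = sound-κ
  }
  where
  unique-κ : ∀ {xs} → Unique xs → (∀ {k} → k ∈ xs → k ∈ L) → Unique (κ (suc n) xs)
  unique-κ [] _ = []
  unique-κ {x ∷ xs} (x∉ ∷ xs!) ⊆L = All.map⁺ (All.tabulate distinct) ∷ unique-κ xs! (⊆L ∘ Any.there)
    where
    bounded : ∀ {k} → k ∈ L → k ≤ suc n
    bounded k∈ with sound L-P k∈
    ... | i , refl , _ = m≤n⇒m≤1+n (toℕ<n i)

    distinct : ∀ {k} → k ∈ xs → suc n ∸ x ≢ suc n ∸ k
    distinct k∈ eq = All.lookup x∉ k∈
      (∸-cancelˡ-≡ (bounded (⊆L (Any.here refl))) (bounded (⊆L (Any.there k∈))) eq)

  sound-κ : ∀ {k} → k ∈ κ (suc n) L → ∃ λ i → k ≡ ⌜ i ⌝ × P (opposite i)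
  sound-κ k∈ with ∈-map⁻ (suc n ∸_) k∈
  ... | j , j∈ , refl with sound L-P j∈
  ...   | i , refl , Pi = opposite i , suc∸⌜⌝ i , subst P (sym (opposite-involutive i)) Pi

represents-↭ : ∀ {L M} {P Q : Fin n → Set} → Represents L P → Represents M Q →
  (∀ i → P i → Q i) → (∀ i → Q i → P i) → L ↭ M
represents-↭ {L = L} {M} {P} {Q} L-P M-Q P⊆Q Q⊆P =
  ∼bag⇒↭ (unique∧set⇒bag (unique L-P) (unique M-Q) (mk⇔ to from))
  where
  to : ∀ {k} → k ∈ L → k ∈ M
  to k∈ with sound L-P k∈
  ... | i , refl , Pi = complete M-Q (P⊆Q i Pi)

  from : ∀ {k} → k ∈ M → k ∈ L
  from k∈ with sound M-Q k∈
  ... | i , refl , Qi = complete L-P (Q⊆P i Qi)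

represents-filter : ∀ {L} {P : Fin n → Set} {R : ℕ → Set} (R? : Decidable R) → Represents L P →
  Represents (filter R? L) (λ i → P i × R ⌜ i ⌝)
represents-filter {L = L} {P} {R} R? L-P = record
  { unique   = AllPairs.filter⁺ R? (unique L-P)
  ; complete = λ (Pi , Ri) → ∈-filter⁺ R? (complete L-P Pi) Ri
  ; sound    = sound-filter
  }
  where
  sound-filter : ∀ {k} → k ∈ filter R? L → ∃ λ i → k ≡ ⌜ i ⌝ × P i × R ⌜ i ⌝
  sound-filter k∈ with ∈-filter⁻ R? {xs = L} k∈
  ... | k∈L , Rk with sound L-P k∈L
  ...   | i , refl , Pi = i , refl , Pi , Rk

∈[1…]⁺ : ∀ {m k} → k < m → suc k ∈ [1… m ]
∈[1…]⁺ = ∈-applyUpTo⁺ suc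

∈[1…]⁻ : ∀ {m k} → k ∈ [1… m ] → ∃ λ j → j < m × k ≡ suc j
∈[1…]⁻ = ∈-applyUpTo⁻ suc

unique-values : ∀ {m} {f : ℕ → ℕ} {R : ℕ → Set} (R? : Decidable R) →
  (∀ {i j} → i < j → j < m → f (suc i) ≢ f (suc j)) → Unique (map f (filter R? [1… m ]))
unique-values {m} R? f≢ = AllPairs.map⁺ (AllPairs.filter⁺ R? (AllPairs.applyUpTo⁺₁ suc m f≢))

concatMap-↭ : ∀ {A B : Set} (f : A → List B) {xs ys} → xs ↭ ys → concatMap f xs ↭ concatMap f ys
concatMap-↭ f xs↭ys = ∼bag⇒↭ (concat-cong (map-cong (λ _ → refl) (↭⇒∼bag xs↭ys)))

-- Descent and ascent sets in terms of a, b and positions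

module Sets {n : ℕ} (π : 𝔖 (suc n)) where
  open Stats π

  value : ∀ {j} → j < suc n → ∃ λ i → x (suc j) ≡ ⌜ i ⌝
  value j<n = π ⟨$⟩ʳ fromℕ< j<n
    , trans (cong (x ∘ suc) (sym (toℕ-fromℕ< j<n))) (x-value (fromℕ< j<n))

  x-distinct : ∀ {j k} → j < suc n → j ≢ k → x (suc j) ≢ x (suc k)
  x-distinct {j} {k} j<n j≢k eq with value j<n
  ... | i , xj≡i = j≢k (suc-injective (trans (position-unique i xj≡i)
                                              (sym (position-unique i (trans (sym eq) xj≡i)))))

  B-at : ∀ i {j} → x j ≡ ⌜ i ⌝ → B i ≡ rightAscent x j
  B-at i {j} eq = cong (rightAscent x) (sym (position-unique i {j} eq))

  A-at : ∀ i {j} → x j ≡ ⌜ i ⌝ → A i ≡ leftAscent x j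
  A-at i {j} eq = cong (leftAscent x) (sym (position-unique i {j} eq))

  q′ : Fin (suc n) → ℕ
  q′ i = toℕ (π ⟨$⟩ˡ i)

  pos-last : ∀ i → ⌜ i ⌝ ≡ x (suc n) → pos i ≡ suc n
  pos-last i eq = sym (position-unique i (sym eq))

  before-last : ∀ i → ⌜ i ⌝ ≢ x (suc n) → q′ i < n
  before-last i neq = ≤∧≢⇒< (≤-pred (pos≤n i)) (λ eq → neq (trans (sym (x-position i)) (cong (x ∘ suc) eq)))

  ¬B⇒≢last : ∀ i → B i ≡ false → ⌜ i ⌝ ≢ x (suc n)
  ¬B⇒≢last i eq last = contradiction (trans (sym (B-last i (pos-last i last))) eq) λ ()

  Dt-represents : Represents (Dt π) (λ i → B i ≡ false)
  Dt-represents = record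
    { unique   = unique-values descent? (λ i<j j<n → x-distinct (<-trans i<j (m≤n⇒m≤1+n j<n)) (<⇒≢ i<j))
    ; complete = λ {i} → comp i
    ; sound    = snd
    }
    where
    descent? : Decidable (λ i → x (suc i) < x i)
    descent? i = x (suc i) <? x i

    comp : ∀ i → B i ≡ false → ⌜ i ⌝ ∈ Dt π
    comp i eq = ∈-map∘filter⁺ x descent?
      (pos i , ∈[1…]⁺ q<n , sym (x-position i) , ≤∧≢⇒< down (x-distinct {suc (q′ i)} (s≤s q<n) 1+n≢n))
      where
      q<n = before-last i (¬B⇒≢last i eq)
      down : x (suc (pos i)) ≤ x (pos i)
      down = ≮⇒≥ (λ up → contradiction (trans (sym (dec-true (x (pos i) <? x (suc (pos i))) up)) eq) λ ())

    snd : ∀ {k} → k ∈ Dt π → ∃ λ i → k ≡ ⌜ i ⌝ × B i ≡ false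
    snd k∈ with ∈-map∘filter⁻ x descent? {f = x} {xs = [1… n ]} k∈
    ... | j , j∈ , refl , down with ∈[1…]⁻ j∈
    ...   | j′ , j′<n , refl with value (m≤n⇒m≤1+n j′<n)
    ...     | i , xj≡i = i , xj≡i , trans (B-at i xj≡i) (dec-false (x j <? x (suc j)) (<⇒≯ down))

  -- The last letter has a right ascent, to +∞, without being an ascent bottom; it must be excluded
  -- by hand.
  Ab-represents : Represents (Ab π) (λ i → B i ≡ true × ⌜ i ⌝ ≢ x (suc n))
  Ab-represents = record
    { unique   = unique-values ascent? (λ i<j j<n → x-distinct (<-trans i<j (m≤n⇒m≤1+n j<n)) (<⇒≢ i<j))
    ; complete = λ {i} → comp i
    ; sound    = snd
    }
    where
    ascent? : Decidable (λ i → x i < x (suc i))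
    ascent? i = x i <? x (suc i)

    comp : ∀ i → B i ≡ true × ⌜ i ⌝ ≢ x (suc n) → ⌜ i ⌝ ∈ Ab π
    comp i (eq , ≢last) = ∈-map∘filter⁺ x ascent?
      (pos i , ∈[1…]⁺ (before-last i ≢last) , sym (x-position i) , up-step)
      where
      up-step : x (pos i) < x (suc (pos i))
      up-step with x (pos i) <? x (suc (pos i))
      ... | yes up = up
      ... | no ¬up = contradiction (trans (sym eq) (dec-false (x (pos i) <? x (suc (pos i))) ¬up)) λ ()

    snd : ∀ {k} → k ∈ Ab π → ∃ λ i → k ≡ ⌜ i ⌝ × B i ≡ true × ⌜ i ⌝ ≢ x (suc n)
    snd k∈ with ∈-map∘filter⁻ x ascent? {f = x} {xs = [1… n ]} k∈
    ... | j , j∈ , refl , up with ∈[1…]⁻ j∈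
    ...   | j′ , j′<n , refl with value (m≤n⇒m≤1+n j′<n)
    ...     | i , xj≡i = i , xj≡i , trans (B-at i xj≡i) (dec-true (x j <? x (suc j)) up)
                       , λ eq → x-distinct (m≤n⇒m≤1+n j′<n) (<⇒≢ j′<n) (trans xj≡i eq)

  -- A descent bottom is smaller than some value, hence at most n.
  Db-represents : Represents {n} (Db π) (λ o → A (inject₁ o) ≡ false)
  Db-represents = record
    { unique   = unique-values descent? (λ i<j j<n → x-distinct (s≤s (<-trans i<j j<n)) (<⇒≢ (s≤s i<j)))
    ; complete = λ {o} → comp o
    ; sound    = snd
    }
    where
    descent? : Decidable (λ i → x (suc i) < x i)
    descent? i = x (suc i) <? x i

    comp : ∀ o → A (inject₁ o) ≡ false → ⌜ o ⌝ ∈ Db π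
    comp o eq = by-position (q′ (inject₁ o)) refl
      where
      by-position : ∀ k → q′ (inject₁ o) ≡ k → ⌜ o ⌝ ∈ Db π
      -- The first letter has a left ascent, from -∞.
      by-position zero q′≡ = contradiction
        (trans (sym eq) (trans (cong (leftAscent x ∘ suc) q′≡) (dec-true (x 0 <? x 1) x-start))) λ ()
      by-position (suc k) q′≡ = ∈-map∘filter⁺ (x ∘ suc) descent?
        (suc k , ∈[1…]⁺ k<n , trans (cong suc (sym (toℕ-inject₁ o))) (sym x≡)
        , ≤∧≢⇒< (≮⇒≥ ¬up) (x-distinct {suc k} {k} (s≤s k<n) 1+n≢n))
        where
        k<n : k < n
        k<n = ≤-pred (subst (_< suc n) q′≡ (pos≤n (inject₁ o)))

        x≡ : x (suc (suc k)) ≡ ⌜ inject₁ o ⌝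
        x≡ = trans (cong (x ∘ suc) (sym q′≡)) (x-position (inject₁ o))

        ¬up : ¬ x (suc k) < x (suc (suc k))
        ¬up up = contradiction (trans (sym (dec-true (x (suc k) <? x (suc (suc k))) up))
          (trans (sym (A-at (inject₁ o) x≡)) eq)) λ ()

    snd : ∀ {k} → k ∈ Db π → ∃ λ o → k ≡ ⌜ o ⌝ × A (inject₁ o) ≡ false
    snd k∈ with ∈-map∘filter⁻ (x ∘ suc) descent? {f = x ∘ suc} {xs = [1… n ]} k∈
    ... | j , j∈ , refl , down with ∈[1…]⁻ j∈
    ...   | j′ , j′<n , refl with value (s≤s j′<n)
    ...     | i , x≡i = o , trans x≡i (cong suc (sym (toℕ-fromℕ< i<n)))
              , trans (A-at (inject₁ o) (trans x≡i
                  (cong suc (trans (sym (toℕ-fromℕ< i<n)) (sym (toℕ-inject₁ o))))))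
                      (dec-false (x j <? x (suc j)) (<⇒≯ down))
      where
      i<n : toℕ i < n
      i<n = ≤-pred (≤-trans (≤-trans (≤-reflexive (cong suc (sym x≡i))) down) (x-bound (m≤n⇒m≤1+n j′<n)))
      o = fromℕ< i<n

  complement : ∀ {L} {P : Fin n → Set} → Represents L P → Represents ([1… n ] ∖ L) (λ o → ¬ P o)
  complement {L} {P} L-P = record
    { unique   = AllPairs.filter⁺ ∉? (AllPairs.applyUpTo⁺₁ suc n (λ i<j _ → <⇒≢ (s≤s i<j)))
    ; complete = λ {o} ¬Po → ∈-filter⁺ ∉? (∈[1…]⁺ (toℕ<n o)) (λ o∈ → ¬Po (from-⌜⌝ o o∈))
    ; sound    = snd
    }
    where
    ∉? : Decidable (λ k → ¬ k ∈ L)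
    ∉? k = ¬? (k ∈? L)

    from-⌜⌝ : ∀ o → ⌜ o ⌝ ∈ L → P o
    from-⌜⌝ o o∈ with sound L-P o∈
    ... | o′ , eq , Po′ = subst P (sym (⌜⌝-injective eq)) Po′

    snd : ∀ {k} → k ∈ ([1… n ] ∖ L) → ∃ λ o → k ≡ ⌜ o ⌝ × ¬ P o
    snd k∈ with ∈-filter⁻ ∉? {xs = [1… n ]} k∈
    ... | k∈[n] , k∉ with ∈[1…]⁻ k∈[n]
    ...   | j , j<n , refl = fromℕ< j<n , cong suc (sym (toℕ-fromℕ< j<n))
      , λ Po → k∉ (subst (_∈ L) (cong suc (toℕ-fromℕ< j<n)) (complete L-P Po))

  p : ℕ → ℕ
  p = Perm.flip π ⟨_⟩

  p≡pos : ∀ i → p ⌜ i ⌝ ≡ pos i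
  p≡pos = FV.x-value (Perm.flip π)

  Ides-represents : Represents {n} (Ides π) (λ o → pos (Fin.suc o) < pos (inject₁ o))
  Ides-represents = record
    { unique   = AllPairs.filter⁺ descent? (AllPairs.applyUpTo⁺₁ suc n (λ i<j _ → <⇒≢ (s≤s i<j)))
    ; complete = λ {o} lt → ∈-filter⁺ descent? (∈[1…]⁺ (toℕ<n o))
        (subst₂ _<_ (sym (p≡pos (Fin.suc o))) (sym (p-inject₁ o)) lt)
    ; sound    = snd
    }
    where
    descent? : Decidable (λ i → p (suc i) < p i)
    descent? i = p (suc i) <? p i

    p-inject₁ : ∀ o → p ⌜ o ⌝ ≡ pos (inject₁ o)
    p-inject₁ o = trans (cong (p ∘ suc) (sym (toℕ-inject₁ o))) (p≡pos (inject₁ o))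

    snd : ∀ {k} → k ∈ Ides π → ∃ λ o → k ≡ ⌜ o ⌝ × pos (Fin.suc o) < pos (inject₁ o)
    snd k∈ with ∈-filter⁻ descent? {xs = [1… n ]} k∈
    ... | k∈[n] , down with ∈[1…]⁻ k∈[n]
    ...   | j , j<n , refl = o , k≡
      , subst₂ _<_ (trans (cong (p ∘ suc) k≡) (p≡pos (Fin.suc o))) (trans (cong p k≡) (p-inject₁ o)) down
      where
      o = fromℕ< j<n
      k≡ : suc j ≡ ⌜ o ⌝
      k≡ = cong suc (sym (toℕ-fromℕ< j<n))

  values-represent : Represents {suc n} (map x [1… suc n ]) (λ _ → ⊤)
  values-represent = record
    { unique   = AllPairs.map⁺ (AllPairs.applyUpTo⁺₁ suc (suc n)
        (λ i<j j<n → x-distinct (<-trans i<j j<n) (<⇒≢ i<j)))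
    ; complete = λ {i} _ → subst (_∈ map x [1… suc n ]) (x-position i) (∈-map⁺ x (∈[1…]⁺ (pos≤n i)))
    ; sound    = snd
    }
    where
    snd : ∀ {k} → k ∈ map x [1… suc n ] → ∃ λ i → k ≡ ⌜ i ⌝ × ⊤
    snd k∈ with ∈-map⁻ x k∈
    ... | j , j∈ , refl with ∈[1…]⁻ j∈
    ...   | j′ , j′<n , refl with value j′<n
    ...     | i , x≡i = i , x≡i , tt

-- The statistics of π and φ(π)

module _ {n : ℕ} (π : 𝔖 (suc n)) where
  open Stats π

  last-value : Fin (suc n)
  last-value = π ⟨$⟩ʳ fromℕ n

  x-last : x (suc n) ≡ ⌜ last-value ⌝
  x-last = trans (cong (x ∘ suc) (sym (toℕ-fromℕ n))) (x-value (fromℕ n))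

  -- No descent follows the last letter, so c vanishes at π(n). For larger j the term [π(n) < j] of
  -- `f+low≡c` forces c_j ≥ 1.
  lastZero-ΦFV : IsLastZero (ΦFV π) last-value
  lastZero-ΦFV = cong ℤ.+_ (trans (FV-c≡ last-value)
                   (c-last last-value (sym (position-unique last-value x-last))))
               , λ j lt eq → contradiction (ℤ.+-injective eq) (positive j lt)
    where
    positive : ∀ j → ⌜ last-value ⌝ < ⌜ j ⌝ → FV-c π j ≢ 0
    positive j lt eq = contradiction (begin
      1
        ≡⟨ χ-yes (x (suc n) <? ⌜ j ⌝) (subst (_< ⌜ j ⌝) (sym x-last) lt) ⟨
      χ (x (suc n) <? ⌜ j ⌝)                        ≤⟨ m≤n+m _ (f2-13 j) ⟩
      f2-13 j + χ (x (suc n) <? ⌜ j ⌝)              ≡⟨ trans (f+low≡c j) (sym (FV-c≡ j)) ⟩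
      FV-c π j                                      ≡⟨ eq ⟩
      0                                             ∎) (n≮n 0)
      where open ≤-Reasoning

  -- For i = ⌜ o ⌝ the right-hand side is the number of entries into [0, i] up to the position of i,
  -- by `entries-at-q`; comparing it with d_{i+1} is the test of `before⇒` and `after⇒`.
  Ides-criterion⁺ : ∀ o → pos (Fin.suc o) < pos (inject₁ o) →
    d31-2 (Fin.suc o) < d31-2 (inject₁ o) + χ¬ (A (inject₁ o))
  Ides-criterion⁺ o lt = ≤-trans (after⇒ (Fin.suc o) lt (≤-reflexive x≡))
    (≤-reflexive (trans (cong (λ t → entries x (suc t) (pos (inject₁ o))) (sym (toℕ-inject₁ o)))
                        (entries-at-q (inject₁ o))))
    where
    x≡ : x (pos (inject₁ o)) ≡ suc (toℕ o)
    x≡ = trans (x-position (inject₁ o)) (cong suc (toℕ-inject₁ o))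

  Ides-criterion⁻ : ∀ o → d31-2 (Fin.suc o) < d31-2 (inject₁ o) + χ¬ (A (inject₁ o)) →
    pos (Fin.suc o) < pos (inject₁ o)
  Ides-criterion⁻ o lt with <-cmp (pos (Fin.suc o)) (pos (inject₁ o))
  ... | tri< before _ _ = before
  ... | tri≈ _ eq _ = contradiction (cong toℕ (position-injective π eq))
                                    (λ eq → 1+n≢n (trans eq (toℕ-inject₁ o)))
  ... | tri> _ _ after = contradiction
    (≤-trans (≤-reflexive (trans (sym (entries-at-q (inject₁ o)))
                                 (cong (λ t → entries x (suc t) (pos (inject₁ o))) (toℕ-inject₁ o))))
             (before⇒ (Fin.suc o) after))
    (<⇒≱ lt)

χ¬-not : ∀ b → χ¬ (not b) ≡ ι b
χ¬-not true  = refl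
χ¬-not false = refl

-- Comparison of π with a permutation of history ξ(W)

module Correspondence {n : ℕ} (π σ : 𝔖 (suc n)) (W : 𝔏 (suc n))
  (π≈W : ΦFV π ≈ₕ W) (σ≈ξW : ΦFV σ ≈ₕ ξ W) where

  module P = Stats π
  module Q = Stats σ
  open 𝔏 W using (w; c; h)
  open Reversal W using (μ; lastZero; lastZero-image; right-μ; g≡)

  lastZero-unique : ∀ {U V : 𝔏 (suc n)} {i j} → U ≈ₕ V → IsLastZero U i → IsLastZero V j → ⌜ i ⌝ ≡ ⌜ j ⌝
  lastZero-unique {i = i} {j} (_ , c≗) (ci≡0 , last) (cj≡0 , last′) = ≤-antisym
    (≮⇒≥ λ lt → last′ i lt (trans (sym (c≗ i)) ci≡0))
    (≮⇒≥ λ lt → last j lt (trans (c≗ j) cj≡0))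

  μ≡ : P.x (suc n) ≡ ⌜ μ ⌝
  μ≡ = trans (x-last π) (lastZero-unique {ΦFV π} {W} π≈W (lastZero-ΦFV π) lastZero)

  ν≡ : Q.x (suc n) ≡ ⌜ opposite μ ⌝
  ν≡ = trans (x-last σ) (lastZero-unique {ΦFV σ} {ξ W} σ≈ξW (lastZero-ΦFV σ) lastZero-image)

  cmp : ∀ i → Tri (⌜ i ⌝ < ⌜ μ ⌝) (⌜ i ⌝ ≡ ⌜ μ ⌝) (⌜ i ⌝ > ⌜ μ ⌝)
  cmp i = side μ i

  left-w : ∀ i → left (w i) ≡ P.A i
  left-w i = trans (cong left (sym (proj₁ π≈W i))) (P.FV-left i)

  right-w : ∀ i → right (w i) ≡ P.B i
  right-w i = trans (cong right (sym (proj₁ π≈W i))) (P.FV-right i)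

  w-opposite : ∀ i → FV-w σ (opposite i) ≡ ξ-letter w μ i
  w-opposite i = trans (proj₁ σ≈ξW (opposite i)) (cong (ξ-letter w μ) (opposite-involutive i))

  B-opposite : ∀ i → Q.B (opposite i) ≡ flipped (cmp i) (P.B i)
  B-opposite i = trans (sym (Q.FV-right (opposite i))) (trans (cong right (w-opposite i))
    (trans (right-shape (not (previousLeft w i)) (flipped (cmp i) (right (w i))))
           (cong (flipped (cmp i)) (right-w i))))

  A-opposite : ∀ o → Q.A (inject₁ (opposite o)) ≡ not (P.A (inject₁ o))
  -- `inject₁ (opposite o)` is `opposite (Fin.suc o)` by definition, and the index before
  -- `Fin.suc o` is `inject₁ o`.
  A-opposite o = trans (sym (Q.FV-left (opposite (Fin.suc o)))) (trans (cong left (w-opposite (Fin.suc o)))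
    (trans (left-shape (not (left (w (inject₁ o)))) (flipped (cmp (Fin.suc o)) (right (w (Fin.suc o)))))
           (cong not (left-w (inject₁ o)))))

  B-μ : ∀ i → ⌜ i ⌝ ≡ ⌜ μ ⌝ → P.B i ≡ true
  B-μ i eq = trans (sym (right-w i)) (trans (cong (λ j → right (w j)) (⌜⌝-injective eq)) right-μ)

  c-opposite : ∀ i → ℤ.+ FV-c σ (opposite i) ≡ ℤ.+ FV-c π i ℤ.+ adjust (cmp i) (P.B i)
  c-opposite i = trans (proj₂ σ≈ξW (opposite i))
    (trans (cong (λ j → c j ℤ.+ shift w μ j) (opposite-involutive i))
           (cong₂ (λ u b → u ℤ.+ adjust (cmp i) b) (sym (proj₂ π≈W i)) (right-w i)))

  h-opposite : ∀ i → height (FV-w σ) (inject₁ (opposite i)) ≡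
    height (FV-w π) (inject₁ i) ℤ.+ adjust (cmp i) (P.B i)
  h-opposite i = trans (height-cong (proj₁ σ≈ξW) (inject₁ (opposite i)))
    (trans (g≡ (opposite i))
    (trans (cong (λ j → h j ℤ.+ shift w μ j) (opposite-involutive i))
           (cong₂ (λ u b → u ℤ.+ adjust (cmp i) b) (sym (height-cong (proj₁ π≈W) (inject₁ i))) (right-w i))))

  -- Reflection changes h and c by the same amount, so their difference d stays.
  d-opposite : ∀ i → Q.d31-2 (opposite i) ≡ P.d31-2 i
  d-opposite i = ℤ.+-injective (begin
    ℤ.+ d′                             ≡⟨ recover d′ c′ ⟩
    ℤ.+ (d′ + c′) ℤ.- ℤ.+ c′           ≡⟨ cong₂ ℤ._-_ (sym (h≡d+c σ (opposite i))) (c-opposite i) ⟩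
    height (FV-w σ) (inject₁ (opposite i)) ℤ.- (ℤ.+ c₀ ℤ.+ s)
      ≡⟨ cong (ℤ._- (ℤ.+ c₀ ℤ.+ s)) (trans (h-opposite i) (cong (ℤ._+ s) (h≡d+c π i))) ⟩
    (ℤ.+ (d₀ + c₀) ℤ.+ s) ℤ.- (ℤ.+ c₀ ℤ.+ s)
      ≡⟨ solve 3 (λ H c s → (H :+ s) :- (c :+ s) := H :- c) refl (ℤ.+ (d₀ + c₀)) (ℤ.+ c₀) s ⟩
    ℤ.+ (d₀ + c₀) ℤ.- ℤ.+ c₀           ≡⟨ recover d₀ c₀ ⟨
    ℤ.+ d₀                             ∎)
    where
    open ≡-Reasoning
    open ℤ.+-*-Solver using (solve; _:+_; _:-_; _:=_)
    d′ = Q.d31-2 (opposite i)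
    c′ = FV-c σ (opposite i)
    d₀ = P.d31-2 i
    c₀ = FV-c π i
    s = adjust (cmp i) (P.B i)

    recover : ∀ d c → ℤ.+ d ≡ ℤ.+ (d + c) ℤ.- ℤ.+ c
    recover d c = trans (solve 2 (λ d c → d := (d :+ c) :- c) refl (ℤ.+ d) (ℤ.+ c))
                        (cong (ℤ._- ℤ.+ c) (sym (ℤ.pos-+ d c)))

  -- Given the formulas for e and f in terms of c, the two equalities say that the shift of c is
  -- [¬ b′] - [m < i] and also [i < m] - [¬ b], for m = cs(W). Both expressions are [b] before m, 0
  -- at m, where b holds, and [b] - 1 after m.
  patterns : ∀ i → P.f2-13 i ≡ Q.e2-31 (opposite i) × P.e2-31 i ≡ Q.f2-13 (opposite i)
  patterns i = solution (cmp i) (P.B i) refl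
    (trans (P.f+low≡c i) (sym (P.FV-c≡ i))) (P.FV-c≡ i)
    (trans (Q.f+low≡c (opposite i)) (sym (Q.FV-c≡ (opposite i))))
    (trans (Q.FV-c≡ (opposite i)) (cong (λ b → Q.e2-31 (opposite i) + χ¬ b) (B-opposite i)))
    (c-opposite i)
    where
    below? : Dec (P.x (suc n) < ⌜ i ⌝)
    below? = P.x (suc n) <? ⌜ i ⌝

    below′? : Dec (Q.x (suc n) < ⌜ opposite i ⌝)
    below′? = Q.x (suc n) <? ⌜ opposite i ⌝

    +0 : ∀ {a b} → a + 0 ≡ b → a ≡ b
    +0 eq = trans (sym (+-identityʳ _)) eq

    decrement : ∀ {c c′} → ℤ.+ c′ ≡ ℤ.+ c ℤ.- 1ℤ → c′ + 1 ≡ c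
    decrement {c} eq = ℤ.+-injective (trans (cong (ℤ._+ 1ℤ) eq)
      (solve 1 (λ c → (c :- con 1ℤ) :+ con 1ℤ := c) refl (ℤ.+ c)))
      where open ℤ.+-*-Solver using (solve; _:+_; _:-_; _:=_; con)

    not-below : ⌜ i ⌝ ≤ ⌜ μ ⌝ → χ below? ≡ 0
    not-below le = χ-no below? (λ lt → <⇒≱ (subst (_< ⌜ i ⌝) μ≡ lt) le)

    is-below : ⌜ μ ⌝ < ⌜ i ⌝ → χ below? ≡ 1
    is-below lt = χ-yes below? (subst (_< ⌜ i ⌝) (sym μ≡) lt)

    not-below′ : ⌜ opposite i ⌝ ≤ ⌜ opposite μ ⌝ → χ below′? ≡ 0
    not-below′ le = χ-no below′? (λ lt → <⇒≱ (subst (_< ⌜ opposite i ⌝) ν≡ lt) le)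

    is-below′ : ⌜ i ⌝ < ⌜ μ ⌝ → χ below′? ≡ 1
    is-below′ lt = χ-yes below′? (subst (_< ⌜ opposite i ⌝) (sym ν≡) (opposite-< lt))

    solution : ∀ (t : Tri (⌜ i ⌝ < ⌜ μ ⌝) (⌜ i ⌝ ≡ ⌜ μ ⌝) (⌜ i ⌝ > ⌜ μ ⌝)) b
      {f e f′ e′ c c′} → P.B i ≡ b →
      f + χ below? ≡ c → c ≡ e + χ¬ b →
      f′ + χ below′? ≡ c′ → c′ ≡ e′ + χ¬ (flipped t b) →
      ℤ.+ c′ ≡ ℤ.+ c ℤ.+ adjust t b → f ≡ e′ × e ≡ f′
    solution (tri< lt _ _) true {f} {e} {f′} {e′} {c} {c′} _ f≡ e≡ f′≡ e′≡ c′≡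
      rewrite not-below (<⇒≤ lt) | is-below′ lt =
        +-cancelʳ-≡ 1 f e′ (trans (cong (_+ 1) (+0 f≡)) (trans (sym c+1) e′≡))
      , +-cancelʳ-≡ 1 e f′ (trans (cong (_+ 1) (+0 (sym e≡))) (trans (sym c+1) (sym f′≡)))
      where
      c+1 : c′ ≡ c + 1
      c+1 = ℤ.+-injective c′≡
    solution (tri< lt _ _) false {f} {e} {f′} {e′} {c} {c′} _ f≡ e≡ f′≡ e′≡ c′≡
      rewrite not-below (<⇒≤ lt) | is-below′ lt =
        trans (+0 f≡) (trans (sym c≡) (sym (+0 (sym e′≡))))
      , +-cancelʳ-≡ 1 e f′ (trans (sym e≡) (trans (sym c≡) (sym f′≡)))
      where
      c≡ : c′ ≡ c
      c≡ = trans (ℤ.+-injective c′≡) (+-identityʳ c)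
    solution (tri≈ _ i≡μ _) false B≡ _ _ _ _ _ = contradiction (trans (sym B≡) (B-μ i i≡μ)) λ ()
    solution (tri≈ _ i≡μ _) true {f} {e} {f′} {e′} {c} {c′} _ f≡ e≡ f′≡ e′≡ c′≡
      rewrite not-below (≤-reflexive i≡μ)
            | not-below′ (≤-reflexive (cong (⌜_⌝ ∘ opposite) (⌜⌝-injective i≡μ))) =
        trans (+0 f≡) (trans (sym c≡) (sym (+0 (sym e′≡))))
      , trans (+0 (sym e≡)) (trans (sym c≡) (sym (+0 f′≡)))
      where
      c≡ : c′ ≡ c
      c≡ = trans (ℤ.+-injective c′≡) (+-identityʳ c)
    solution (tri> _ _ gt) true {f} {e} {f′} {e′} {c} {c′} _ f≡ e≡ f′≡ e′≡ c′≡
      rewrite is-below gt | not-below′ (<⇒≤ (opposite-< gt)) =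
        +-cancelʳ-≡ 1 f e′ (trans f≡ (trans (sym c≡) e′≡))
      , trans (+0 (sym e≡)) (trans (sym c≡) (sym (+0 f′≡)))
      where
      c≡ : c′ ≡ c
      c≡ = trans (ℤ.+-injective c′≡) (+-identityʳ c)
    solution (tri> _ _ gt) false {f} {e} {f′} {e′} {c} {c′} _ f≡ e≡ f′≡ e′≡ c′≡
      rewrite is-below gt | not-below′ (<⇒≤ (opposite-< gt)) =
        +-cancelʳ-≡ 1 f e′ (trans f≡ (trans (sym (decrement c′≡)) (cong (_+ 1) (sym (+0 (sym e′≡))))))
      , +-cancelʳ-≡ 1 e f′ (trans (sym e≡) (trans (sym (decrement c′≡)) (cong (_+ 1) (sym (+0 f′≡)))))

  B-flip : ∀ i → ⌜ i ⌝ ≢ P.x (suc n) → Q.B (opposite i) ≡ not (P.B i)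
  B-flip i ≢last with cmp i | B-opposite i
  ... | tri< _ _ _  | eq = eq
  ... | tri> _ _ _  | eq = eq
  ... | tri≈ _ eq _ | _  = contradiction (trans eq (sym μ≡)) ≢last

  <last⇒ : ∀ i → ⌜ i ⌝ < P.x (suc n) → Q.x (suc n) < ⌜ opposite i ⌝
  <last⇒ i lt = subst (_< ⌜ opposite i ⌝) (sym ν≡) (opposite-< {i = i} {μ} (subst (⌜ i ⌝ <_) μ≡ lt))

  <last⇐ : ∀ i → Q.x (suc n) < ⌜ opposite i ⌝ → ⌜ i ⌝ < P.x (suc n)
  <last⇐ i lt = subst₂ _<_ (cong ⌜_⌝ (opposite-involutive i)) (sym μ≡)
    (opposite-<ˡ {i = μ} {opposite i} (subst (_< ⌜ opposite i ⌝) ν≡ lt))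

  >last⇒ : ∀ i → P.x (suc n) < ⌜ i ⌝ → ⌜ opposite i ⌝ < Q.x (suc n)
  >last⇒ i lt = subst (⌜ opposite i ⌝ <_) (sym ν≡) (opposite-< {i = μ} {i} (subst (_< ⌜ i ⌝) μ≡ lt))

  >last⇐ : ∀ i → ⌜ opposite i ⌝ < Q.x (suc n) → P.x (suc n) < ⌜ i ⌝
  >last⇐ i lt = subst₂ _<_ (sym μ≡) (cong ⌜_⌝ (opposite-involutive i))
    (opposite-<ʳ {i = μ} {opposite i} (subst (⌜ opposite i ⌝ <_) ν≡ lt))

  B≡not : ∀ i → ⌜ i ⌝ ≢ P.x (suc n) → ∀ {b} → P.B i ≡ b → Q.B (opposite i) ≡ not b
  B≡not i ≢last eq = trans (B-flip i ≢last) (cong not eq)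

  B≡not⁻ : ∀ i → ⌜ i ⌝ ≢ P.x (suc n) → ∀ {b} → Q.B (opposite i) ≡ b → P.B i ≡ not b
  B≡not⁻ i ≢last eq = trans (sym (not-involutive (P.B i))) (cong not (trans (sym (B-flip i ≢last)) eq))

  open Sets using (Dt-represents; Ab-represents; Db-represents; Ides-represents; complement; values-represent)

  Dtb-↭ : Dtb π ↭ κ (suc (suc n)) (Aba σ)
  Dtb-↭ = represents-↭ (represents-filter _ (Dt-represents π))
    (κ-represents (represents-filter _ (Ab-represents σ)))
    (λ i (B≡ , lt) → (B≡not i (<⇒≢ lt) B≡ , <⇒≢ (<last⇒ i lt) ∘ sym) , <last⇒ i lt)
    (λ i ((B≡ , _) , lt) → B≡not⁻ i (<⇒≢ (<last⇐ i lt)) B≡ , <last⇐ i lt)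

  Dta-↭ : Dta π ↭ κ (suc (suc n)) (Abb σ)
  Dta-↭ = represents-↭ (represents-filter _ (Dt-represents π))
    (κ-represents (represents-filter _ (Ab-represents σ)))
    (λ i (B≡ , gt) → (B≡not i (<⇒≢ gt ∘ sym) B≡ , <⇒≢ (>last⇒ i gt)) , >last⇒ i gt)
    (λ i ((B≡ , _) , gt) → B≡not⁻ i (<⇒≢ (>last⇐ i gt) ∘ sym) B≡ , >last⇐ i gt)

  Abb-↭ : Abb π ↭ κ (suc (suc n)) (Dta σ)
  Abb-↭ = represents-↭ (represents-filter _ (Ab-represents π))
    (κ-represents (represents-filter _ (Dt-represents σ)))
    (λ i ((B≡ , _) , lt) → B≡not i (<⇒≢ lt) B≡ , <last⇒ i lt)
    (λ i (B≡ , lt) → (B≡not⁻ i (<⇒≢ (<last⇐ i lt)) B≡ , <⇒≢ (<last⇐ i lt)) , <last⇐ i lt)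

  Aba-↭ : Aba π ↭ κ (suc (suc n)) (Dtb σ)
  Aba-↭ = represents-↭ (represents-filter _ (Ab-represents π))
    (κ-represents (represents-filter _ (Dt-represents σ)))
    (λ i ((B≡ , _) , gt) → B≡not i (<⇒≢ gt ∘ sym) B≡ , >last⇒ i gt)
    (λ i (B≡ , gt) → (B≡not⁻ i (<⇒≢ (>last⇐ i gt) ∘ sym) B≡ , <⇒≢ (>last⇐ i gt) ∘ sym) , >last⇐ i gt)

  Db-↭ : [1… n ] ∖ Db π ↭ κ (suc n) (Db σ)
  Db-↭ = represents-↭ (complement π (Db-represents π)) (κ-represents (Db-represents σ))
    (λ o A≢ → trans (A-opposite o) (cong not (¬-not A≢)))
    (λ o A′≡ A≡ → contradiction (trans (sym A′≡) (trans (A-opposite o) (cong not A≡))) λ ())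

  d-suc : ∀ o → Q.d31-2 (Fin.suc (opposite o)) ≡ P.d31-2 (inject₁ o)
  d-suc o = trans (cong Q.d31-2 (sym (opposite-inject₁ o))) (d-opposite (inject₁ o))

  -- For i = ⌜ o ⌝ the criterion of σ at the reflected value reads d_i < d_{i+1} + [a_i]. This is
  -- d_i ≤ d_{i+1} if a_i holds and d_i < d_{i+1} if not, in both cases the negation of d_{i+1} <
  -- d_i + [¬ a_i].
  Ides-↭ : [1… n ] ∖ Ides π ↭ κ (suc n) (Ides σ)
  Ides-↭ = represents-↭ (complement π (Ides-represents π)) (κ-represents (Ides-represents σ))
    (λ o ¬lt → Ides-criterion⁻ σ (opposite o)
      (subst₂ _<_ (sym (d-suc o)) (sym (bound o))
        (to (P.A (inject₁ o)) (P.d31-2 (inject₁ o)) (P.d31-2 (Fin.suc o)) (¬lt ∘ Ides-criterion⁻ π o))))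
    (λ o lt → from (P.A (inject₁ o)) (P.d31-2 (inject₁ o)) (P.d31-2 (Fin.suc o))
      (subst₂ _<_ (d-suc o) (bound o) (Ides-criterion⁺ σ (opposite o) lt)) ∘ Ides-criterion⁺ π o)
    where
    bound : ∀ o → Q.d31-2 (inject₁ (opposite o)) + χ¬ (Q.A (inject₁ (opposite o)))
                ≡ P.d31-2 (Fin.suc o) + ι (P.A (inject₁ o))
    bound o = cong₂ _+_ (d-opposite (Fin.suc o))
      (trans (cong χ¬ (A-opposite o)) (χ¬-not (P.A (inject₁ o))))

    to : ∀ a u v → ¬ v < u + χ¬ a → u < v + ι a
    to true  u v v≮ = ≤-trans
      (s≤s (≤-trans (≤-reflexive (sym (+-identityʳ u))) (≮⇒≥ v≮))) (≤-reflexive (+-comm 1 v))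
    to false u v v≮ = ≤-trans
      (≤-reflexive (+-comm 1 u)) (≤-trans (≮⇒≥ v≮) (≤-reflexive (sym (+-identityʳ v))))

    from : ∀ a u v → u < v + ι a → ¬ v < u + χ¬ a
    from true  u v u< v< = <⇒≱ v<
      (≤-trans (≤-reflexive (+-identityʳ u)) (≤-pred (≤-trans u< (≤-reflexive (+-comm v 1)))))
    from false u v u< v< = <⇒≱ v<
      (≤-trans (≤-reflexive (+-comm u 1)) (≤-trans u< (≤-reflexive (+-identityʳ v))))

  -- Multiplicities are given by position. Turned into a function `G` of the value, they make both
  -- sides a `concatMap` of the same `G` over two arrangements of [1... n + 1], and a permutation of
  -- the arrangements suffices.
  fromMult-↭ : ∀ (mult mult′ : ℕ → ℕ) → (∀ i → mult (P.pos i) ≡ mult′ (Q.pos (opposite i))) →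
    fromMult π mult ↭ κ (suc (suc n)) (fromMult σ mult′)
  fromMult-↭ mult mult′ mult≡ = begin
    fromMult π mult
      ≡⟨ cong concat (map-cong-local (All.applyUpTo⁺₁ suc (suc n) π-side)) ⟩
    concatMap (G ∘ P.x) [1… suc n ]
      ≡⟨ concatMap-map G P.x [1… suc n ] ⟨
    concatMap G (map P.x [1… suc n ])
      ↭⟨ concatMap-↭ G (represents-↭ (values-represent π) (κ-represents (values-represent σ))
           (λ _ _ → tt) (λ _ _ → tt)) ⟩
    concatMap G (κ M (map Q.x [1… suc n ]))
      ≡⟨ concatMap-map G (M ∸_) (map Q.x [1… suc n ]) ⟩
    concatMap (G ∘ (M ∸_)) (map Q.x [1… suc n ])
      ≡⟨ concatMap-map (G ∘ (M ∸_)) Q.x [1… suc n ] ⟩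
    concatMap (G ∘ (M ∸_) ∘ Q.x) [1… suc n ]
      ≡⟨ cong concat (map-cong-local (All.applyUpTo⁺₁ suc (suc n) σ-side)) ⟨
    concatMap (κ M ∘ (λ k → replicate (mult′ k) (Q.x k))) [1… suc n ]
      ≡⟨ map-concatMap (M ∸_) (λ k → replicate (mult′ k) (Q.x k)) [1… suc n ] ⟨
    κ M (fromMult σ mult′) ∎
    where
    open PermutationReasoning
    M = suc (suc n)

    G : ℕ → List ℕ
    G v = replicate (mult (Sets.p π v)) v

    mult-at : ∀ i → mult′ (Q.pos i) ≡ mult (Sets.p π (M ∸ ⌜ i ⌝))
    mult-at i = trans (cong (mult′ ∘ Q.pos) (sym (opposite-involutive i)))
      (trans (sym (mult≡ (opposite i)))
      (trans (cong mult (sym (Sets.p≡pos π (opposite i)))) (cong (mult ∘ Sets.p π) (sym (suc∸⌜⌝ i)))))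

    π-side : ∀ {j} → j < suc n → replicate (mult (suc j)) (P.x (suc j)) ≡ G (P.x (suc j))
    π-side {j} j<n with Sets.value π j<n
    ... | i , x≡i = cong (λ k → replicate (mult k) (P.x (suc j)))
      (trans (P.position-unique i x≡i) (trans (sym (Sets.p≡pos π i)) (cong (Sets.p π) (sym x≡i))))

    σ-side : ∀ {j} → j < suc n → κ M (replicate (mult′ (suc j)) (Q.x (suc j))) ≡ G (M ∸ Q.x (suc j))
    σ-side {j} j<n with Sets.value σ j<n
    ... | i , x≡i = trans (map-replicate (M ∸_) (mult′ (suc j)) (Q.x (suc j)))
      (cong (λ m → replicate m (M ∸ Q.x (suc j)))
        (trans (cong mult′ (Q.position-unique i x≡i))
        (trans (mult-at i) (cong (λ k → mult (Sets.p π (M ∸ k))) (sym x≡i)))))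

  pat2-13-↭ : pat2-13 π ↭ κ (suc (suc n)) (pat2-31 σ)
  pat2-13-↭ = fromMult-↭ (mult2-13 π) (mult2-31 σ) (proj₁ ∘ patterns)

  pat2-31-↭ : pat2-31 π ↭ κ (suc (suc n)) (pat2-13 σ)
  pat2-31-↭ = fromMult-↭ (mult2-31 π) (mult2-13 σ) (proj₂ ∘ patterns)

  pat31-2-↭ : pat31-2 π ↭ κ (suc (suc n)) (pat31-2 σ)
  pat31-2-↭ = fromMult-↭ (mult31-2 π) (mult31-2 σ) (sym ∘ d-opposite)

  equidistribution :
      Dtb π ↭ κ (suc (suc n)) (Aba σ)
    × Dta π ↭ κ (suc (suc n)) (Abb σ)
    × Abb π ↭ κ (suc (suc n)) (Dta σ)
    × Aba π ↭ κ (suc (suc n)) (Dtb σ)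
    × pat2-13 π ↭ κ (suc (suc n)) (pat2-31 σ)
    × pat2-31 π ↭ κ (suc (suc n)) (pat2-13 σ)
    × pat31-2 π ↭ κ (suc (suc n)) (pat31-2 σ)
    × [1… n ] ∖ Db π ↭ κ (suc n) (Db σ)
    × [1… n ] ∖ Ides π ↭ κ (suc n) (Ides σ)
  equidistribution =
    Dtb-↭ , Dta-↭ , Abb-↭ , Aba-↭ , pat2-13-↭ , pat2-31-↭ , pat31-2-↭ , Db-↭ , Ides-↭

-- Conjugating an involution by a bijection

module _ {A B : Set} {_≈₁_ : Rel A 0ℓ} {_≈₂_ : Rel B 0ℓ} {f : A → B}
  (f-bijection : IsBijection _≈₁_ _≈₂_ f) where

  open IsBijection f-bijection

  inverse-section : ∀ y → f (inverse f-bijection y) ≈₂ y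
  inverse-section y = proj₂ (surjective y) Eq₁.refl

  conjugate-bijection : ∀ {g : B → B} → (∀ {y z} → y ≈₂ z → g y ≈₂ g z) → (∀ y → g (g y) ≈₂ y) →
    IsBijection _≈₁_ _≈₁_ (inverse f-bijection ∘ g ∘ f)
  conjugate-bijection {g} g-cong involutive = record
    { isInjection = record
      { isCongruent = record
        { cong           = φ-cong
        ; isEquivalence₁ = isEquivalence₁
        ; isEquivalence₂ = isEquivalence₁
        }
      ; injective = λ {x} {y} φx≈φy → injective (Eq₂.trans (Eq₂.sym (involutive (f x)))
          (Eq₂.trans (g-cong (Eq₂.trans (Eq₂.sym (f∘φ x)) (Eq₂.trans (f-cong φx≈φy) (f∘φ y))))
          (involutive (f y))))
      }
    -- The conjugate is again an involution up to `_≈₁_`, so φ y is itself a preimage of y.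
    ; surjective = λ y → φ y , λ {z} z≈φy → injective (Eq₂.trans (f∘φ z)
        (Eq₂.trans (g-cong (Eq₂.trans (f-cong z≈φy) (f∘φ y))) (involutive (f y))))
    }
    where
    f-cong = IsBijection.cong f-bijection
    φ = inverse f-bijection ∘ g ∘ f

    f∘φ : ∀ x → f (φ x) ≈₂ g (f x)
    f∘φ x = inverse-section (g (f x))

    φ-cong : ∀ {x y} → x ≈₁ y → φ x ≈₁ φ y
    φ-cong {x} {y} x≈y = injective (Eq₂.trans (f∘φ x) (Eq₂.trans (g-cong (f-cong x≈y)) (Eq₂.sym (f∘φ y))))

corollary4p3 :
    ∀ (n : ℕ) → 1 ≤ n →
    Σ (IsBijection _≈_ _≈ₕ_ (ΦFV {n})) λ ΦFV-bijection →
    Σ (∃! _≗ₕ_ (Is-ξ {n})) λ (ξ , _) →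
      let φ : 𝔖 n → 𝔖 n
          φ = inverse ΦFV-bijection ∘ ξ ∘ ΦFV
      in
      IsBijection _≈_ _≈_ φ
      × (∀ (π : 𝔖 n) →
          Dtb π ↭ κ (suc n) (Aba (φ π))
        × Dta π ↭ κ (suc n) (Abb (φ π))
        × Abb π ↭ κ (suc n) (Dta (φ π))
        × Aba π ↭ κ (suc n) (Dtb (φ π))
        × pat2-13 π ↭ κ (suc n) (pat2-31 (φ π))
        × pat2-31 π ↭ κ (suc n) (pat2-13 (φ π))
        × pat31-2 π ↭ κ (suc n) (pat31-2 (φ π))
        × [1… n ∸ 1 ] ∖ Db π ↭ κ n (Db (φ π))
        × [1… n ∸ 1 ] ∖ Ides π ↭ κ n (Ides (φ π)))
corollary4p3 (suc n) _ = ΦFV-bijection , ∃!ξ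
  , conjugate-bijection ΦFV-bijection (λ {W} {V} → ξ-cong {W = W} {V}) (Is-ξ.involutive ξ-isξ)
  , λ π → Correspondence.equidistribution π (inverse ΦFV-bijection (ξ (ΦFV π))) (ΦFV π)
      ((λ _ → refl) , (λ _ → refl)) (inverse-section ΦFV-bijection (ξ (ΦFV π)))
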